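{- The Strong Majority $2$-Coloring problem is NP-complete on Eulerian graphs; that is, the following decision problem is NP-complete: given a finite Eulerian graph $G$, does $G$ have a strong majority coloring with $2$ colors?
   Context: A strong majority coloring of a graph $G$ is a (possibly improper) vertex coloring such that, for each vertex $v$ and each color $c$, at most $\deg(v)/2$ of the neighbors of $v$ have color $c$. Here an Eulerian graph is a graph in which every vertex has even degree. NP-completeness is with respect to polynomial-time many-one reductions. -}

module Defs where

open import Data.Bool using (Bool; true; false)
open import Data.Fin using (Fin; _≟_)
open import Data.Fin.Subset using (Subset; _∩_; ∣_∣)
open import Data.List using (List; []; _∷_; _++_; length; map; concatMap; replicate; allFin)
open import Data.Maybe as Maybe using (Maybe; just; nothing)
open import Data.Nat using (ℕ; suc; _+_; _*_; _≤_)
open import Data.Nat.Divisibility using (_∣_)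
open import Data.Product using (_×_; _,_; ∃-syntax)
open import Data.Vec as Vec using (Vec; _∷_; tabulate)
open import Function using (_⇔_)
open import Relation.Binary.PropositionalEquality using (_≡_)
open import Relation.Nullary.Decidable using (does)

data Poly : Set where
  con     : ℕ → Poly
  var     : Poly
  _⊕_ _⊗_ : Poly → Poly → Poly

⟦_⟧ : Poly → ℕ → ℕ
⟦ con c ⟧ n = c
⟦ var   ⟧ n = n
⟦ p ⊕ q ⟧ n = ⟦ p ⟧ n + ⟦ q ⟧ n
⟦ p ⊗ q ⟧ n = ⟦ p ⟧ n * ⟦ q ⟧ n

data Symbol (g : ℕ) : Set where
  blank : Symbol g
  bit   : Bool → Symbol g
  extra : Fin g → Symbol g

data Move : Set where
  left right stay : Move

-- Two-way infinite tapes.  Both lists are ordered outwards from the head,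
-- and every cell beyond their ends is blank.
record Tape (g : ℕ) : Set where
  constructor tape
  field
    lefts  : List (Symbol g)
    head   : Symbol g
    rights : List (Symbol g)

module _ {g : ℕ} where

  write : Symbol g → Tape g → Tape g
  write s (tape ls _ rs) = tape ls s rs

  move : Move → Tape g → Tape g
  move stay  t                    = t
  move left  (tape []       h rs) = tape [] blank (h ∷ rs)
  move left  (tape (l ∷ ls) h rs) = tape ls l (h ∷ rs)
  move right (tape ls h [])       = tape (h ∷ ls) blank []
  move right (tape ls h (r ∷ rs)) = tape (h ∷ ls) r rs

  act : Symbol g × Move → Tape g → Tape g
  act (s , m) t = move m (write s t)

  blankTape : Tape g
  blankTape = tape [] blank []

  inputTape : List Bool → Tape g
  inputTape []      = blankTape
  inputTape (b ∷ w) = tape [] (bit b) (map bit w)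

  bits : List (Symbol g) → List Bool
  bits (bit b ∷ ss) = b ∷ bits ss
  bits _            = []

  -- The longest string of bits starting at the head.
  readOutput : Tape g → List Bool
  readOutput (tape _ h rs) = bits (h ∷ rs)

-- The machine has 1 + workTapes tapes; the first one carries the input
-- and, after halting, the output.  It halts when δ yields nothing.
record TM : Set where
  field
    workTapes    : ℕ
    extraSymbols : ℕ
    states       : ℕ
    start        : Fin states

  tapes : ℕ
  tapes = suc workTapes

  Γ : Set
  Γ = Symbol extraSymbols

  field
    δ : Fin states → Vec Γ tapes → Maybe (Fin states × Vec (Γ × Move) tapes)

  Config : Set
  Config = Fin states × Vec (Tape extraSymbols) tapes

  initial : List Bool → Config
  initial w = start , inputTape w ∷ Vec.replicate workTapes blankTape

  step : Config → Maybe Config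
  step (q , ts) =
    Maybe.map (λ (q′ , as) → q′ , Vec.zipWith act as ts)
              (δ q (Vec.map Tape.head ts))

  output : Config → List Bool
  output (_ , ts) = readOutput (Vec.head ts)

  -- c ⇓[ t ] d : started in c, the machine halts in d after exactly t steps.
  data _⇓[_]_ : Config → ℕ → Config → Set where
    halt : ∀ {c} → step c ≡ nothing → c ⇓[ 0 ] c
    next : ∀ {c c′ d t} → step c ≡ just c′ → c′ ⇓[ t ] d → c ⇓[ suc t ] d

Language : Set₁
Language = List Bool → Set

PolyTime : (List Bool → List Bool) → Set
PolyTime f =
  ∃[ M ] ∃[ p ] let open TM M in
    ∀ w → ∃[ t ] ∃[ d ]
      (initial w ⇓[ t ] d × t ≤ ⟦ p ⟧ (length w) × output d ≡ f w)

PolyTimePredicate : (List Bool → Bool) → Set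
PolyTimePredicate V = PolyTime (λ w → V w ∷ [])

-- Self-delimiting pairing: ⟨ x₁…xₙ , u ⟩ = 1x₁1x₂…1xₙ0u.
⟨_,_⟩ : List Bool → List Bool → List Bool
⟨ x , u ⟩ = concatMap (λ b → true ∷ b ∷ []) x ++ false ∷ u

NP : Language → Set
NP L =
  ∃[ V ] ∃[ p ] (PolyTimePredicate V ×
    (∀ x → L x ⇔ (∃[ u ] (length u ≤ ⟦ p ⟧ (length x) × V ⟨ x , u ⟩ ≡ true))))

infix 4 _≤ₚ_

_≤ₚ_ : Language → Language → Set
L ≤ₚ L′ = ∃[ f ] (PolyTime f × (∀ x → L x ⇔ L′ (f x)))

NPHard : Language → Set₁
NPHard L = ∀ L′ → NP L′ → L′ ≤ₚ L

NPComplete : Language → Set₁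
NPComplete L = NP L × NPHard L

record Graph : Set where
  field
    order       : ℕ
    adjacent    : Fin order → Fin order → Bool
    symmetric   : ∀ u v → adjacent u v ≡ adjacent v u
    irreflexive : ∀ v → adjacent v v ≡ false

  Vertex : Set
  Vertex = Fin order

  neighbors : Vertex → Subset order
  neighbors v = tabulate (adjacent v)

  deg : Vertex → ℕ
  deg v = ∣ neighbors v ∣

  Coloring : ℕ → Set
  Coloring k = Vertex → Fin k

  colorClass : ∀ {k} → Coloring k → Fin k → Subset order
  colorClass χ c = tabulate (λ v → does (χ v ≟ c))

  IsStrongMajority : ∀ {k} → Coloring k → Set
  IsStrongMajority χ =
    ∀ v c → 2 * ∣ neighbors v ∩ colorClass χ c ∣ ≤ deg v

  -- Connectedness is not required.
  Eulerian : Set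
  Eulerian = ∀ v → 2 ∣ deg v

  StrongMajorityColorable : ℕ → Set
  StrongMajorityColorable k = ∃[ χ ] IsStrongMajority {k} χ

-- The order n in unary (1ⁿ0), then the n × n adjacency matrix row by row.
encode : Graph → List Bool
encode G = replicate order true ++ false ∷
           concatMap (λ u → map (adjacent u) (allFin order)) (allFin order)
  where open Graph G

-- The words encoding yes-instances; a word that does not encode an Eulerian
-- graph is not in the language.
EulerianStrongMajorityColoring : ℕ → Language
EulerianStrongMajorityColoring k w =
  ∃[ G ] (w ≡ encode G × Graph.Eulerian G × Graph.StrongMajorityColorable G k)

module Submission where

-- With two colours in an Eulerian graph, a strong majority colouring is one in which every neighbourhood
-- contains equally many vertices of both colours.
--
-- Membership: a certificate lists the colours.  All that has to be checked is a bounded arithmetical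
-- statement about the bits of the input, and such statements are decided by nested loops over unary counters.
--
-- Hardness: let a machine verify certificates in polynomial time.  Its computation is described by clauses about
-- a tableau of times and tape cells, the latter taken relative to the head, so that the clauses do not mention
-- head positions.  A clause is a condition of the form “exactly half of these variables are true” once it is
-- given slack variables, and so is the link between a variable and its negation.  A system of such conditions
-- becomes a bipartite graph by joining each variable to two copies of every condition it occurs in: colouring
-- the two copies differently balances the variables.  Adjacency is again a bounded arithmetical statement, so
-- the same nested loops write down the graph.

open import Defs

open import Data.Bool as Bool using (Bool; true; false; if_then_else_; _∧_)
open import Data.Empty using (⊥)
open import Data.Fin as Fin using (Fin; zero; suc; toℕ; fromℕ<; _↑ˡ_; _↑ʳ_; splitAt)
import Data.Fin.Properties as Finₚ
open import Data.Fin.Subset using (Subset; ∣_∣) renaming (_∩_ to _∩ₛ_)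
open import Data.List as List using (List; []; _∷_; _++_; length; replicate; concatMap; allFin)
import Data.List.Properties as Listₚ
open import Data.List.Membership.Propositional using (_∈_)
open import Data.List.Membership.Propositional.Properties using (∈-map⁺; ∈-++⁺ˡ; ∈-++⁺ʳ; ∈-cartesianProductWith⁺; ∈-allFin)
open import Data.List.Relation.Unary.All as All using (All; []; _∷_)
open import Data.List.Relation.Unary.All.Properties using (tabulate⁺; tabulate⁻; ++⁻)
open import Data.List.Relation.Unary.Any using (here; there)
open import Data.Maybe as Maybe using (Maybe; just; nothing; maybe)
open import Data.Nat using (ℕ; zero; suc; _+_; _*_; _∸_; _≤_; _<_; z≤n; s≤s; s≤s⁻¹; _≟_; _≤?_; _<?_; NonZero; ≢-nonZero; _⊔_; _/_; _%_)
open import Data.Nat.Divisibility using (_∣_; divides)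
open import Data.Nat.DivMod using (m≡m%n+[m/n]*n; m%n<n; m<n*o⇒m/o<n; [m+kn]%n≡m%n; m<n⇒m%n≡m; m/n*n≤m; m%n≡m∸m/n*n; m<n⇒m/n≡0; +-distrib-/-∣ʳ; m*n/n≡m)
open import Data.Nat.Properties hiding (_≟_; _≤?_; _<?_)
open import Data.Nat.Tactic.RingSolver using (solve-∀)
open import Data.Product using (∃; ∃-syntax; _×_; _,_; proj₁; proj₂; map₁)
open import Data.Sum using (_⊎_; inj₁; inj₂; [_,_]′)
open import Data.Unit using (⊤; tt)
open import Data.Vec as Vec using (Vec; []; _∷_; lookup; tabulate)
import Data.Vec.Properties as Vecₚ
open import Function using (_∘_; id; _⇔_; mk⇔; Equivalence)
open import Relation.Binary.PropositionalEquality using (_≡_; _≢_; refl; sym; trans; cong; cong₂; subst; subst₂; module ≡-Reasoning)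
open import Relation.Binary.Definitions using (tri<; tri≈; tri>)
open import Relation.Nullary using (¬_; Dec; yes; no; does; contradiction)
open import Relation.Nullary.Decidable using (dec-true; map′)

-- Turing machines from structured programs

-- Balanced colourings know neither constants nor inequalities. The colours are interchangeable, so
-- truth is anchored afterwards: vertex 0 stands for false, and the colour class that misses it is
-- read as the set of true variables. A condition can only demand exactly one half, so a clause on k
-- literals gets a block of 2 k variables: k negated literals, the constant false and k - 1 slack
-- variables. The slack alone cannot supply k true variables, so some literal must be false;
-- conversely any positive number of false literals can be topped up to k. The negations are fresh
-- copies tied to their literals by two-element conditions. This lets a literal occur several times
-- in one clause, as the padding literal does, although adjacency has no multiplicities. All
-- conditions have an even number of members and each occurs twice, so the resulting degrees are
-- even; formally this is read off the balance equation. In the tableau a step of the machine has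
-- positive premises and one positive consequence. A model therefore only has to contain the
-- description of a run, and may make further atoms true.

Cell : Set
Cell = Symbol 1

Heads Actions Tapes : ℕ → Set
Heads n   = Vec Cell n
Actions n = Vec (Cell × Move) n
Tapes n   = Vec (Tape 1) n

heads : ∀ {n} → Tapes n → Heads n
heads = Vec.map Tape.head

apply : ∀ {n} → Actions n → Tapes n → Tapes n
apply = Vec.zipWith act

infixr 5 _⨾_

data Prog (n : ℕ) : Set where
  prim  : (Heads n → Actions n) → Prog n
  _⨾_   : Prog n → Prog n → Prog n
  while : (Heads n → Bool) → Prog n → Prog n
  cond  : (Heads n → Bool) → Prog n → Prog n → Prog n

module _ {n : ℕ} where

  -- Control points of a program. The extra point `nothing` of a loop or a conditional is where the
  -- test is made, in one idle step.
  Node : Prog n → Set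
  Node (prim _)     = ⊤
  Node (p ⨾ q)      = Node p ⊎ Node q
  Node (while _ p)  = Maybe (Node p)
  Node (cond _ p q) = Maybe (Node p ⊎ Node q)

  entry : (p : Prog n) → Node p
  entry (prim _)     = tt
  entry (p ⨾ q)      = inj₁ (entry p)
  entry (while _ _)  = nothing
  entry (cond _ _ _) = nothing

  idle : Heads n → Actions n
  idle = Vec.map (_, stay)

  -- nothing as the successor means that the program exits.
  next : (p : Prog n) → Node p → Heads n → Maybe (Node p) × Actions n
  next (prim f)     _                h = nothing , f h
  next (p ⨾ q)      (inj₁ x)         h = map₁ (maybe (just ∘ inj₁) (just (inj₂ (entry q)))) (next p x h)
  next (p ⨾ q)      (inj₂ y)         h = map₁ (maybe (just ∘ inj₂) nothing) (next q y h)
  next (while t p)  nothing          h = (if t h then just (just (entry p)) else nothing) , idle h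
  next (while t p)  (just x)         h = map₁ (maybe (just ∘ just) (just nothing)) (next p x h)
  next (cond t p q) nothing          h = just (just (if t h then inj₁ (entry p) else inj₂ (entry q))) , idle h
  next (cond t p q) (just (inj₁ x))  h = map₁ (maybe (just ∘ just ∘ inj₁) nothing) (next p x h)
  next (cond t p q) (just (inj₂ y))  h = map₁ (maybe (just ∘ just ∘ inj₂) nothing) (next q y h)

  data Exec (p : Prog n) : Maybe (Node p) → Tapes n → ℕ → Tapes n → Set where
    done : ∀ {ts} → Exec p nothing ts 0 ts
    step : ∀ {x ts t ts′} →
           Exec p (proj₁ (next p x (heads ts))) (apply (proj₂ (next p x (heads ts))) ts) t ts′ →
           Exec p (just x) ts (suc t) ts′

  Run : Prog n → Tapes n → ℕ → Tapes n → Set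
  Run p = Exec p (just (entry p))

  -- A run of a subprogram is a run of the whole under `ι` once the transition functions agree up to
  -- redirecting exits to `e`. This one fact serves sequencing, loop bodies and branches.
  embed : ∀ {p P} (ι : Node p → Node P) (e : Maybe (Node P)) →
          (∀ x h → next P (ι x) h ≡ map₁ (maybe (just ∘ ι) e) (next p x h)) →
          ∀ {mx ts t ts′ t′ ts″} → Exec p mx ts t ts′ → Exec P e ts′ t′ ts″ →
          Exec P (maybe (just ∘ ι) e mx) ts (t + t′) ts″
  embed ι e eq done     r′ = r′
  embed {P = P} ι e eq (step {x} {ts} r) r′ =
    step (subst (λ z → Exec P (proj₁ z) (apply (proj₂ z) ts) _ _) (sym (eq x (heads ts)))
                (embed ι e eq r r′))

  apply-idle : ∀ {m} (ts : Tapes m) → apply (Vec.map (_, stay) (heads ts)) ts ≡ ts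
  apply-idle []       = refl
  apply-idle (t ∷ ts) = cong (t ∷_) (apply-idle ts)

  run-prim : ∀ f ts → Run (prim f) ts 1 (apply (f (heads ts)) ts)
  run-prim f ts = step done

  run-⨾ : ∀ {p q ts t ts′ t′ ts″} → Run p ts t ts′ → Run q ts′ t′ ts″ → Run (p ⨾ q) ts (t + t′) ts″
  run-⨾ {q = q} {t′ = t′} r r′ =
    embed inj₁ (just (inj₂ (entry q))) (λ _ _ → refl) r
      (subst (λ s → Exec _ _ _ s _) (+-identityʳ t′) (embed inj₂ nothing (λ _ _ → refl) r′ done))

  run-while-false : ∀ {b p ts} → b (heads ts) ≡ false → Run (while b p) ts 1 ts
  run-while-false {b} {p} {ts} eq = step go
    where
    go : Exec (while b p) (if b (heads ts) then just (just (entry p)) else nothing) (apply (idle (heads ts)) ts) 0 ts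
    go rewrite eq | apply-idle ts = done

  run-while-true : ∀ {b p ts t ts′ t′ ts″} → b (heads ts) ≡ true →
                   Run p ts t ts′ → Run (while b p) ts′ t′ ts″ → Run (while b p) ts (suc (t + t′)) ts″
  run-while-true {b} {p} {ts} {t} {ts′} {t′} {ts″} eq r r′ = step go
    where
    go : Exec (while b p) (if b (heads ts) then just (just (entry p)) else nothing) (apply (idle (heads ts)) ts) (t + t′) ts″
    go rewrite eq | apply-idle ts = embed just (just nothing) (λ _ _ → refl) r r′

  run-cond-true : ∀ {b p q ts t ts′} → b (heads ts) ≡ true → Run p ts t ts′ → Run (cond b p q) ts (suc t) ts′
  run-cond-true {b} {p} {q} {ts} {t} {ts′} eq r = step go
    where
    go : Exec (cond b p q) (just (just (if b (heads ts) then inj₁ (entry p) else inj₂ (entry q)))) (apply (idle (heads ts)) ts) t ts′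
    go rewrite eq | apply-idle ts =
      subst (λ s → Exec _ _ _ s _) (+-identityʳ t) (embed (just ∘ inj₁) nothing (λ _ _ → refl) r done)

  run-cond-false : ∀ {b p q ts t ts′} → b (heads ts) ≡ false → Run q ts t ts′ → Run (cond b p q) ts (suc t) ts′
  run-cond-false {b} {p} {q} {ts} {t} {ts′} eq r = step go
    where
    go : Exec (cond b p q) (just (just (if b (heads ts) then inj₁ (entry p) else inj₂ (entry q)))) (apply (idle (heads ts)) ts) t ts′
    go rewrite eq | apply-idle ts =
      subst (λ s → Exec _ _ _ s _) (+-identityʳ t) (embed (just ∘ inj₂) nothing (λ _ _ → refl) r done)

  size : Prog n → ℕ
  size (prim _)     = 1
  size (p ⨾ q)      = size p + size q
  size (while _ p)  = suc (size p)
  size (cond _ p q) = suc (size p + size q)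

  enc : (p : Prog n) → Node p → Fin (size p)
  enc (prim _)     _               = zero
  enc (p ⨾ q)      (inj₁ x)        = enc p x ↑ˡ size q
  enc (p ⨾ q)      (inj₂ y)        = size p ↑ʳ enc q y
  enc (while _ p)  nothing         = zero
  enc (while _ p)  (just x)        = suc (enc p x)
  enc (cond _ p q) nothing         = zero
  enc (cond _ p q) (just (inj₁ x)) = suc (enc p x ↑ˡ size q)
  enc (cond _ p q) (just (inj₂ y)) = suc (size p ↑ʳ enc q y)

  dec : (p : Prog n) → Fin (size p) → Node p
  dec (prim _)     _       = tt
  dec (p ⨾ q)      i       = [ inj₁ ∘ dec p , inj₂ ∘ dec q ]′ (splitAt (size p) i)
  dec (while _ p)  zero    = nothing
  dec (while _ p)  (suc i) = just (dec p i)
  dec (cond _ p q) zero    = nothing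
  dec (cond _ p q) (suc i) = just ([ inj₁ ∘ dec p , inj₂ ∘ dec q ]′ (splitAt (size p) i))

  dec-enc : ∀ p x → dec p (enc p x) ≡ x
  dec-enc (prim _)     _               = refl
  dec-enc (p ⨾ q)      (inj₁ x)        rewrite Finₚ.splitAt-↑ˡ (size p) (enc p x) (size q) = cong inj₁ (dec-enc p x)
  dec-enc (p ⨾ q)      (inj₂ y)        rewrite Finₚ.splitAt-↑ʳ (size p) (size q) (enc q y) = cong inj₂ (dec-enc q y)
  dec-enc (while _ p)  nothing         = refl
  dec-enc (while _ p)  (just x)        = cong just (dec-enc p x)
  dec-enc (cond _ p q) nothing         = refl
  dec-enc (cond _ p q) (just (inj₁ x)) rewrite Finₚ.splitAt-↑ˡ (size p) (enc p x) (size q) = cong (just ∘ inj₁) (dec-enc p x)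
  dec-enc (cond _ p q) (just (inj₂ y)) rewrite Finₚ.splitAt-↑ʳ (size p) (size q) (enc q y) = cong (just ∘ inj₂) (dec-enc q y)

module _ {k : ℕ} (p : Prog (suc k)) where

  -- State 0 is the exit and the only state where `δ` yields nothing, so halting is the same as
  -- leaving the program.
  state : Maybe (Node p) → Fin (suc (size p))
  state = maybe (suc ∘ enc p) zero

  machine : TM
  machine = record
    { workTapes    = k
    ; extraSymbols = 1
    ; states       = suc (size p)
    ; start        = suc (enc p (entry p))
    ; δ            = λ { zero    h → nothing
                       ; (suc i) h → just (map₁ state (next p (dec p i) h)) }
    }

  machine-correct : ∀ {mx ts t ts′} → Exec p mx ts t ts′ → TM._⇓[_]_ machine (state mx , ts) t (zero , ts′)
  machine-correct done = TM.halt refl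
  machine-correct (step {x} {ts} r) =
    TM.next (cong (λ y → just (state (proj₁ (next p y (heads ts))) , apply (proj₂ (next p y (heads ts))) ts))
                  (dec-enc p x))
            (machine-correct r)

-- Register programs

mark : Cell
mark = extra zero

at : ∀ {g} → List (Symbol g) → ℕ → Symbol g
at []       _       = blank
at (s ∷ ss) zero    = s
at (s ∷ ss) (suc i) = at ss i

LeftCells : (ℕ → Cell) → ℕ → List Cell → Set
LeftCells c zero    _        = ⊤
LeftCells c (suc p) []       = ⊥
LeftCells c (suc p) (l ∷ ls) = l ≡ c p × LeftCells c p ls

-- The head of the tape is on cell p, and the cells from 0 on contain c 0, c 1, …;
-- nothing is said about the cells to the left of cell 0.
record Zip (c : ℕ → Cell) (p : ℕ) (t : Tape 1) : Set where
  constructor zip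
  field
    leftCells  : LeftCells c p (Tape.lefts t)
    headCell   : Tape.head t ≡ c p
    rightCells : ∀ j → at (Tape.rights t) j ≡ c (j + suc p)

-- At cell 0 no left shift exists, so the unspecified cells left of the mark never come under the
-- head.
data Shift : Move → ℕ → ℕ → Set where
  stay  : ∀ {p} → Shift stay p p
  right : ∀ {p} → Shift right p (suc p)
  left  : ∀ {p} → Shift left (suc p) p

Zip-move : ∀ {c m p q} t → Shift m p q → Zip c p t → Zip c q (act (Tape.head t , m) t)
Zip-move t stay z = z
Zip-move {c} {p = p} (tape ls h []) right (zip l e r) = zip (e , l) (r 0) λ j → trans (r (suc j)) (cong c (sym (+-suc j (suc p))))
Zip-move {c} {p = p} (tape ls h (x ∷ rs)) right (zip l e r) = zip (e , l) (r 0) λ j → trans (r (suc j)) (cong c (sym (+-suc j (suc p))))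
Zip-move (tape [] h rs) left (zip () _ _)
Zip-move {c} {q = q} (tape (x ∷ ls) h rs) left (zip (e′ , l) e r) =
  zip l e′ λ { zero → e ; (suc j) → trans (r j) (cong c (+-suc j (suc q))) }

-- A register is a tape whose cell 0 is marked; its value is the position of the head.
counter : ℕ → Cell
counter zero    = mark
counter (suc _) = blank

inputCells : List Bool → ℕ → Cell
inputCells w zero    = mark
inputCells w (suc i) = at (List.map bit w) i

headAt : ∀ {K} → ℕ → Vec Cell K → Cell
headAt _       []       = blank
headAt zero    (h ∷ _)  = h
headAt (suc r) (_ ∷ hs) = headAt r hs

headAt-lookup : ∀ {K r} (r<K : r < K) (hs : Vec Cell K) → headAt r hs ≡ lookup hs (fromℕ< r<K)
headAt-lookup {r = zero}  (s≤s z≤n)        (h ∷ _)  = refl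
headAt-lookup {r = suc r} (s≤s r<K@(s≤s _)) (_ ∷ hs) = headAt-lookup r<K hs

unmarked : Cell → Bool
unmarked (extra _) = false
unmarked _         = true

isTrue isBit : Cell → Bool
isTrue (bit true) = true
isTrue _          = false
isBit (bit _) = true
isBit _       = false

choose : ∀ {P A : Set} → Dec P → A → A → A
choose (yes _) x _ = x
choose (no _)  _ y = y

upd : (ℕ → ℕ) → ℕ → ℕ → ℕ → ℕ
upd σ r v r′ = choose (r′ ≟ r) v (σ r′)

upd-same : ∀ r v {u : ℕ} → choose (r ≟ r) v u ≡ v
upd-same r v with r ≟ r
... | yes _  = refl
... | no r≢r = contradiction refl r≢r

upd-other : ∀ {r r′} v {u : ℕ} → r′ ≢ r → choose (r′ ≟ r) v u ≡ u
upd-other {r} {r′} v ne with r′ ≟ r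
... | yes e = contradiction e ne
... | no _  = refl

record State : Set where
  constructor st
  field
    regs : ℕ → ℕ
    pos  : ℕ
    out  : List Bool

open State

infixl 8 _[_≔_]
_[_≔_] : State → ℕ → ℕ → State
st σ p o [ r ≔ v ] = st (upd σ r v) p o

infix 4 _≈_
_≈_ : State → State → Set
st σ p o ≈ st σ′ p′ o′ = (∀ r → σ r ≡ σ′ r) × p ≡ p′ × o ≡ o′

only : ℕ → Move → ℕ → Move
only r m r′ = choose (r′ ≟ r) m stay

-- Multiplication, division and bounded quantifiers all come from `sum`. A range is itself the value
-- of an expression, so for a fixed expression all values, and hence all loops over unary counters,
-- stay polynomial in the variables.
data Exp (m : ℕ) : Set where
  var  : Fin m → Exp m
  one  : Exp m
  _⊞_  : Exp m → Exp m → Exp m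
  _⊟_  : Exp m → Exp m → Exp m
  inp  : Exp m → Exp m
  sum  : Exp m → Exp (suc m) → Exp m

data Out (m : ℕ) : Set where
  emit : Exp m → Out m
  _⨟_  : Out m → Out m → Out m
  for  : Exp m → Out (suc m) → Out m

bitAt : List Bool → ℕ → ℕ
bitAt []          _       = 0
bitAt (true ∷ _)  zero    = 1
bitAt (false ∷ _) zero    = 0
bitAt (_ ∷ w)     (suc i) = bitAt w i

sumTo : ℕ → (ℕ → ℕ) → ℕ
sumTo zero    f = 0
sumTo (suc n) f = f n + sumTo n f

concatTo : ℕ → (ℕ → List Bool) → List Bool
concatTo zero    f = []
concatTo (suc n) f = concatTo n f ++ f n

positive : ℕ → Bool
positive zero    = false
positive (suc _) = true

module _ (w : List Bool) where

  eval : ∀ {m} → Exp m → Vec ℕ m → ℕ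
  eval (var x)   ρ = lookup ρ x
  eval one       ρ = 1
  eval (e ⊞ e′)  ρ = eval e ρ + eval e′ ρ
  eval (e ⊟ e′)  ρ = eval e ρ ∸ eval e′ ρ
  eval (inp e)   ρ = bitAt w (eval e ρ)
  eval (sum e e′) ρ = sumTo (eval e ρ) (λ i → eval e′ (i ∷ ρ))

  evalOut : ∀ {m} → Out m → Vec ℕ m → List Bool
  evalOut (emit e)  ρ = positive (eval e ρ) ∷ []
  evalOut (o ⨟ o′)  ρ = evalOut o ρ ++ evalOut o′ ρ
  evalOut (for e o) ρ = concatTo (eval e ρ) (λ i → evalOut o (i ∷ ρ))

  costMonus costInput : ℕ → ℕ → ℕ
  costMonus a b = (a * 4 + 1) + (b * 2 + 1)
  costInput v _ = (v * 3 + 1) + (2 + ((suc v * 2 + 1) + 1))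

  -- Each summand is the time of one of the loops in `add`: for a variable, 4 steps per unit to move
  -- it into two registers and 3 per unit to move one of these back.
  cost : ∀ {m} → Exp m → Vec ℕ m → ℕ
  cost (var x)    ρ = (lookup ρ x * 4 + 1) + (lookup ρ x * 3 + 1)
  cost one        ρ = 1
  cost (e ⊞ e′)   ρ = cost e ρ + cost e′ ρ
  cost (e ⊟ e′)   ρ = cost e ρ + (cost e′ ρ + costMonus (eval e ρ) (eval e′ ρ))
  cost (inp e)    ρ = cost e ρ + costInput (eval e ρ) 0
  cost (sum e e′) ρ = cost e ρ + (sumTo (eval e ρ) (λ i → 2 + cost e′ (i ∷ ρ)) + 1)

  costOut : ∀ {m} → Out m → Vec ℕ m → ℕ
  costOut (emit e)  ρ = cost e ρ + (2 + (eval e ρ * 2 + 1))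
  costOut (o ⨟ o′)  ρ = costOut o′ ρ + costOut o ρ
  costOut (for e o) ρ = cost e ρ + (sumTo (eval e ρ) (λ i → 2 + costOut o (i ∷ ρ)) + 1)

-- The registers from f on are scratch; top e f is the first of them that add e does not use.
top : ∀ {m} → Exp m → ℕ → ℕ
top (var _)    f = suc f
top one        f = f
top (e ⊞ e′)   f = top e′ (top e f)
top (e ⊟ e′)   f = top e′ (top e (2 + f))
top (inp e)    f = top e (1 + f)
top (sum e e′) f = top e′ (top e (1 + f))

topOut : ∀ {m} → Out m → ℕ → ℕ
topOut (emit e)  f = top e (1 + f)
topOut (o ⨟ o′)  f = topOut o′ (topOut o f)
topOut (for e o) f = topOut o (top e (1 + f))

f≤top : ∀ {m} (e : Exp m) f → f ≤ top e f
f≤top (var _)    f = n≤1+n f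
f≤top one        f = ≤-refl
f≤top (e ⊞ e′)   f = ≤-trans (f≤top e f) (f≤top e′ _)
f≤top (e ⊟ e′)   f = ≤-trans (≤-trans (m≤n+m f 2) (f≤top e _)) (f≤top e′ _)
f≤top (inp e)    f = ≤-trans (n≤1+n f) (f≤top e _)
f≤top (sum e e′) f = ≤-trans (≤-trans (n≤1+n f) (f≤top e _)) (f≤top e′ _)

f≤topOut : ∀ {m} (o : Out m) f → f ≤ topOut o f
f≤topOut (emit e)  f = ≤-trans (n≤1+n f) (f≤top e _)
f≤topOut (o ⨟ o′)  f = ≤-trans (f≤topOut o f) (f≤topOut o′ _)
f≤topOut (for e o) f = ≤-trans (≤-trans (n≤1+n f) (f≤top e _)) (f≤topOut o _)

≈-pointwise : ∀ {σ σ′ p o} → (∀ r → σ r ≡ σ′ r) → st σ p o ≈ st σ′ p o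
≈-pointwise e = e , refl , refl

upd-id : ∀ σ r {v} → σ r ≡ v → ∀ x → σ x ≡ upd σ r v x
upd-id σ r e x with x ≟ r
... | yes refl = e
... | no _     = refl

upd-twice : ∀ σ r v v′ x → upd (upd σ r v) r v′ x ≡ upd σ r v′ x
upd-twice σ r v v′ x with x ≟ r
... | yes _ = refl
... | no _  = refl

upd² : ∀ σ r s v u v′ u′ x →
       upd (upd (upd (upd σ r v) s u) r v′) s u′ x ≡ upd (upd σ r v′) s u′ x
upd² σ r s v u v′ u′ x with x ≟ s | x ≟ r
... | yes _ | _     = refl
... | no _  | yes _ = refl
... | no _  | no _  = refl

upd³ : ∀ σ r s t v u y v′ u′ y′ x →
       upd (upd (upd (upd (upd (upd σ r v) s u) t y) r v′) s u′) t y′ x ≡ upd (upd (upd σ r v′) s u′) t y′ x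
upd³ σ r s t v u y v′ u′ y′ x with x ≟ t | x ≟ s | x ≟ r
... | yes _ | _     | _     = refl
... | no _  | yes _ | _     = refl
... | no _  | no _  | yes _ = refl
... | no _  | no _  | no _  = refl

upd-skip : ∀ σ r s v u v′ x → r ≢ s → upd (upd (upd σ r v) s u) r v′ x ≡ upd (upd σ r v′) s u x
upd-skip σ r s v u v′ x r≢s with x ≟ r | x ≟ s
... | yes refl | yes refl = contradiction refl r≢s
... | yes _    | no _     = refl
... | no _     | yes _    = refl
... | no _     | no _     = refl

upd-const : ∀ σ r {v v′} → v ≡ v′ → ∀ x → upd σ r v x ≡ upd σ r v′ x
upd-const σ r refl x = refl

cell-bit : ∀ w i → isTrue (at (List.map bit w) i) ≡ positive (bitAt w i)
cell-bit []          i       = refl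
cell-bit (true ∷ w)  zero    = refl
cell-bit (false ∷ w) zero    = refl
cell-bit (true ∷ w)  (suc i) = cell-bit w i
cell-bit (false ∷ w) (suc i) = cell-bit w i

bitAt≤1 : ∀ w i → bitAt w i ≤ 1
bitAt≤1 []          i       = z≤n
bitAt≤1 (true ∷ w)  zero    = ≤-refl
bitAt≤1 (false ∷ w) zero    = z≤n
bitAt≤1 (true ∷ w)  (suc i) = bitAt≤1 w i
bitAt≤1 (false ∷ w) (suc i) = bitAt≤1 w i

cell-unmarked : ∀ w i → unmarked (at (List.map bit w) i) ≡ true
cell-unmarked []      i       = refl
cell-unmarked (b ∷ w) zero    = refl
cell-unmarked (b ∷ w) (suc i) = cell-unmarked w i

-- The calling convention: variable x lives in register `lookup ρ x` with value `lookup vs x`, and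
-- all registers from `f` on are 0. Programs hand the scratch registers back as zeros, so a loop
-- body can use the same ones in each round.
record Scope {m} (A : State) (ρ vs : Vec ℕ m) (f : ℕ) : Set where
  constructor scope
  field
    scratch : ∀ r → f ≤ r → regs A r ≡ 0
    below   : ∀ x → lookup ρ x < f
    value   : ∀ x → regs A (lookup ρ x) ≡ lookup vs x

open Scope

-- What makes it safe to accumulate in register `a`: writing there disturbs neither the variables
-- nor the scratch registers.
record Fresh {m} (a : ℕ) (ρ : Vec ℕ m) (f : ℕ) : Set where
  constructor fresh-in
  field
    in-scope : a < f
    apart    : ∀ x → lookup ρ x ≢ a

open Fresh

fresh : ∀ {m A} {ρ vs : Vec ℕ m} {f} a → Scope A ρ vs f → f ≤ a → Fresh a ρ (suc a)
fresh a S f≤a = fresh-in ≤-refl λ x → <⇒≢ (<-≤-trans (below S x) f≤a)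

Scope-mono : ∀ {m A} {ρ vs : Vec ℕ m} {f f′} → f ≤ f′ → Scope A ρ vs f → Scope A ρ vs f′
Scope-mono f≤f′ (scope s b v) = scope (λ r f′≤r → s r (≤-trans f≤f′ f′≤r)) (λ x → ≤-trans (b x) f≤f′) v

Scope-upd : ∀ {m A} {ρ vs : Vec ℕ m} {f a v} → Fresh a ρ f → Scope A ρ vs f → Scope (A [ a ≔ v ]) ρ vs f
Scope-upd {v = v} (fresh-in a<f ne) (scope s b va) =
  scope (λ r f≤r → trans (upd-other v (λ e → <⇒≱ a<f (subst (_ ≤_) e f≤r))) (s r f≤r))
        b
        (λ x → trans (upd-other v (ne x)) (va x))

Scope-bind : ∀ {m A} {ρ vs : Vec ℕ m} {f} r → f ≤ r → ∀ v → Scope A ρ vs f → Scope (A [ r ≔ v ]) (r ∷ ρ) (v ∷ vs) (suc r)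
Scope-bind r f≤r v S =
  scope (scratch S′)
        (λ { zero → ≤-refl ; (suc x) → below S′ x })
        (λ { zero → upd-same r v ; (suc x) → value S′ x })
  where S′ = Scope-upd {v = v} (fresh r S f≤r) (Scope-mono (m≤n⇒m≤1+n f≤r) S)

Fresh-mono : ∀ {m a} {ρ : Vec ℕ m} {f f′} → f ≤ f′ → Fresh a ρ f → Fresh a ρ f′
Fresh-mono f≤f′ (fresh-in a<f ne) = fresh-in (≤-trans a<f f≤f′) ne

Fresh-bind : ∀ {m a r} {ρ : Vec ℕ m} {f} → a < r → Fresh a ρ f → Fresh a (r ∷ ρ) (suc r)
Fresh-bind a<r (fresh-in _ ne) = fresh-in (m≤n⇒m≤1+n a<r) λ { zero → λ e → <⇒≢ a<r (sym e) ; (suc x) → ne x }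

-- Programs that evaluate expressions in unary

module _ {K : ℕ} where

  moveRegs : (ℕ → Move) → Heads K → Actions K
  moveRegs f hs = tabulate λ i → lookup hs i , f (toℕ i)

  -- Tape 0 receives the output, tape 1 carries the input behind an end mark, and the remaining
  -- tapes are the registers.
  moves : (Cell → Cell × Move) → Move → (ℕ → Move) → Prog (2 + K)
  moves o m f = prim λ { (h₀ ∷ h₁ ∷ hs) → o h₀ ∷ (h₁ , m) ∷ moveRegs f hs }

  inc dec′ : ℕ → Prog (2 + K)
  inc  r = moves (_, stay) stay (only r right)
  dec′ r = moves (_, stay) stay (only r left)

  moveInput : Move → Prog (2 + K)
  moveInput m = moves (_, stay) m (λ _ → stay)

  skip : Prog (2 + K)
  skip = moveInput stay

  write-out : Bool → Prog (2 + K)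
  write-out b = moves (λ _ → bit b , left) stay (λ _ → stay)

  nonzero : ℕ → Heads (2 + K) → Bool
  nonzero r (_ ∷ _ ∷ hs) = unmarked (headAt r hs)

  reading : (Cell → Bool) → Heads (2 + K) → Bool
  reading τ (_ ∷ h ∷ _) = τ h

  drain : ℕ → Prog (2 + K)
  drain r = while (nonzero r) (dec′ r)

  rewind : Prog (2 + K)
  rewind = while (reading unmarked) (moveInput left) ⨾ moveInput right

  -- add e ρ a f adds the value of e to register a; the variables are in the registers ρ.
  add : ∀ {m} → Exp m → Vec ℕ m → ℕ → ℕ → Prog (2 + K)
  -- Counting `r` down destroys it, so a second copy is built in `f` and moved back.
  add (var x)    ρ a f = while (nonzero r) (dec′ r ⨾ inc f ⨾ inc a) ⨾ while (nonzero f) (dec′ f ⨾ inc r)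
    where r = lookup ρ x
  add one        ρ a f = inc a
  add (e ⊞ e′)   ρ a f = add e ρ a f ⨾ add e′ ρ a (top e f)
  -- Each unit of the minuend cancels a unit of the subtrahend while there is one and otherwise
  -- counts towards `a`; a surplus of the subtrahend is drained.
  add (e ⊟ e′)   ρ a f =
    add e ρ (1 + f) (2 + f) ⨾ add e′ ρ f (top e (2 + f)) ⨾
    while (nonzero (1 + f)) (dec′ (1 + f) ⨾ cond (nonzero f) (dec′ f) (inc a)) ⨾ drain f
  -- The input head rests on cell 1, the first bit; `rewind` finds this position again by the mark
  -- in cell 0.
  add (inp e)    ρ a f =
    add e ρ f (1 + f) ⨾ while (nonzero f) (dec′ f ⨾ moveInput right) ⨾ cond (reading isTrue) (inc a) skip ⨾ rewind
  -- The counter f of the loop doubles as the summation index, which thus runs downwards.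
  add (sum e e′) ρ a f =
    add e ρ f (1 + f) ⨾ while (nonzero f) (dec′ f ⨾ add e′ (f ∷ ρ) a (top e (1 + f)))

  -- The output is written from right to left.
  put : ∀ {m} → Out m → Vec ℕ m → ℕ → Prog (2 + K)
  put (emit e)  ρ f = add e ρ f (1 + f) ⨾ cond (nonzero f) (write-out true) (write-out false) ⨾ drain f
  put (o ⨟ o′)  ρ f = put o′ ρ (topOut o f) ⨾ put o ρ f
  put (for e o) ρ f = add e ρ f (1 + f) ⨾ while (nonzero f) (dec′ f ⨾ put o (f ∷ ρ) (top e (1 + f)))

-- Correctness and running time of these programs

module _ {K : ℕ} (w : List Bool) where

  -- The output lies to the right of the head of tape 0, which waits on the cell where the next bit
  -- is to be prepended.
  Rep : State → Tapes (2 + K) → Set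
  Rep A (t₀ ∷ t₁ ∷ ts) =
    bits (Tape.rights t₀) ≡ out A × Zip (inputCells w) (pos A) t₁ × (∀ i → Zip counter (regs A (toℕ i)) (lookup ts i))

  infix 4 _⊢_⇒[_]_
  -- A total-correctness triple with a bound on the number of steps.
  _⊢_⇒[_]_ : Prog (2 + K) → State → ℕ → State → Set
  p ⊢ A ⇒[ b ] A′ = ∀ ts → Rep A ts → ∃[ t ] ∃[ ts′ ] (t ≤ b × Run p ts t ts′ × Rep A′ ts′)

  Rep-≈ : ∀ {A B} → A ≈ B → ∀ ts → Rep A ts → Rep B ts
  Rep-≈ (e , refl , refl) (t₀ ∷ t₁ ∷ ts) (o , z , c) = o , z , λ i → subst (λ n → Zip counter n (lookup ts i)) (e (toℕ i)) (c i)

  conseq : ∀ {p A B B′ b b′} → p ⊢ A ⇒[ b ] B → B ≈ B′ → b ≤ b′ → p ⊢ A ⇒[ b′ ] B′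
  conseq h e b≤b′ ts rep with h ts rep
  ... | t , ts′ , t≤b , r , rep′ = t , ts′ , ≤-trans t≤b b≤b′ , r , Rep-≈ e ts′ rep′

  infixr 5 _⨾ᵗ_
  _⨾ᵗ_ : ∀ {p q A B C b b′} → p ⊢ A ⇒[ b ] B → q ⊢ B ⇒[ b′ ] C → p ⨾ q ⊢ A ⇒[ b + b′ ] C
  (h ⨾ᵗ h′) ts rep with h ts rep
  ... | t , ts′ , t≤b , r , rep′ with h′ ts′ rep′
  ... | t′ , ts″ , t′≤b′ , r′ , rep″ = t + t′ , ts″ , +-mono-≤ t≤b t′≤b′ , run-⨾ r r′ , rep″

  Tests : (Heads (2 + K) → Bool) → State → Bool → Set
  Tests τ A b = ∀ ts → Rep A ts → τ (heads ts) ≡ b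

  while-false : ∀ {τ p A} → Tests τ A false → while τ p ⊢ A ⇒[ 1 ] A
  while-false f ts rep = 1 , ts , ≤-refl , run-while-false (f ts rep) , rep

  while-true : ∀ {τ p A B C b b′} → Tests τ A true → p ⊢ A ⇒[ b ] B → while τ p ⊢ B ⇒[ b′ ] C →
               while τ p ⊢ A ⇒[ suc (b + b′) ] C
  while-true f h h′ ts rep with h ts rep
  ... | t , ts′ , t≤b , r , rep′ with h′ ts′ rep′
  ... | t′ , ts″ , t′≤b′ , r′ , rep″ =
    suc (t + t′) , ts″ , s≤s (+-mono-≤ t≤b t′≤b′) , run-while-true (f ts rep) r r′ , rep″

  cond-true : ∀ {τ p q A B b} → Tests τ A true → p ⊢ A ⇒[ b ] B → cond τ p q ⊢ A ⇒[ suc b ] B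
  cond-true f h ts rep with h ts rep
  ... | t , ts′ , t≤b , r , rep′ = suc t , ts′ , s≤s t≤b , run-cond-true (f ts rep) r , rep′

  cond-false : ∀ {τ p q A B b} → Tests τ A false → q ⊢ A ⇒[ b ] B → cond τ p q ⊢ A ⇒[ suc b ] B
  cond-false f h ts rep with h ts rep
  ... | t , ts′ , t≤b , r , rep′ = suc t , ts′ , s≤s t≤b , run-cond-false (f ts rep) r , rep′

  head-reg : ∀ {r} A ts → r < K → Rep A ts → ∃[ c ] (nonzero r (heads ts) ≡ unmarked c × c ≡ counter (regs A r))
  head-reg {r} A (t₀ ∷ t₁ ∷ ts) r<K (_ , _ , z) =
    _ , cong unmarked (trans (headAt-lookup r<K (heads ts)) (Vecₚ.lookup-map (fromℕ< r<K) Tape.head ts)) ,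
    trans (Zip.headCell (z (fromℕ< r<K))) (cong (counter ∘ regs A) (Finₚ.toℕ-fromℕ< r<K))

  zero-test : ∀ {r A} → r < K → regs A r ≡ 0 → Tests (nonzero r) A false
  zero-test {A = A} r<K e ts rep with head-reg A ts r<K rep
  ... | c , q , refl rewrite e = q

  suc-test : ∀ {r A n} → r < K → regs A r ≡ suc n → Tests (nonzero r) A true
  suc-test {A = A} r<K e ts rep with head-reg A ts r<K rep
  ... | c , q , refl rewrite e = q

  input-test : ∀ {A} τ → Tests (reading τ) A (τ (inputCells w (pos A)))
  input-test τ (t₀ ∷ t₁ ∷ ts) (_ , z , _) = cong τ (Zip.headCell z)

  Zip-moveRegs : ∀ (σ σ′ : ℕ → ℕ) (f : ℕ → Move) → (∀ r → Shift (f r) (σ r) (σ′ r)) → (ts : Tapes K) →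
                 (∀ i → Zip counter (σ (toℕ i)) (lookup ts i)) →
                 ∀ i → Zip counter (σ′ (toℕ i)) (lookup (apply (moveRegs f (heads ts)) ts) i)
  Zip-moveRegs σ σ′ f s ts z i
    rewrite Vecₚ.lookup-zipWith act i (moveRegs f (heads ts)) ts
          | Vecₚ.lookup∘tabulate (λ j → lookup (heads ts) j , f (toℕ j)) i
          | Vecₚ.lookup-map i Tape.head ts
    = Zip-move (lookup ts i) (s (toℕ i)) (z i)

  run-moves : ∀ {m f} {σ σ′ : ℕ → ℕ} {p p′ o} → Shift m p p′ → (∀ r → Shift (f r) (σ r) (σ′ r)) →
              moves (_, stay) m f ⊢ st σ p o ⇒[ 1 ] st σ′ p′ o
  run-moves {f = f} {σ} {σ′} sₘ s ts@(t₀ ∷ t₁ ∷ us) (o , z , c) =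
    1 , _ , ≤-refl , run-prim _ ts , o , Zip-move t₁ sₘ z , Zip-moveRegs σ σ′ f s us c

  run-inc : ∀ r A {n} → regs A r ≡ n → inc r ⊢ A ⇒[ 1 ] A [ r ≔ suc n ]
  run-inc r A {n} e = run-moves stay shift
    where
    shift : ∀ r′ → Shift (only r right r′) (regs A r′) (upd (regs A) r (suc n) r′)
    shift r′ with r′ ≟ r
    ... | yes refl rewrite e = right
    ... | no _     = stay

  run-dec : ∀ r A {n} → regs A r ≡ suc n → dec′ r ⊢ A ⇒[ 1 ] A [ r ≔ n ]
  run-dec r A {n} e = run-moves stay shift
    where
    shift : ∀ r′ → Shift (only r left r′) (regs A r′) (upd (regs A) r n r′)
    shift r′ with r′ ≟ r
    ... | yes refl rewrite e = left
    ... | no _     = stay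

  run-moveInput : ∀ {m σ p p′ o} → Shift m p p′ → moveInput m ⊢ st σ p o ⇒[ 1 ] st σ p′ o
  run-moveInput s = run-moves s (λ _ → stay)

  run-write : ∀ b {σ p o} → write-out b ⊢ st σ p o ⇒[ 1 ] st σ p (b ∷ o)
  run-write b {σ} ts@(t₀ ∷ t₁ ∷ us) (o , z , c) =
    1 , _ , ≤-refl , run-prim _ ts , written t₀ o , z , Zip-moveRegs σ σ (λ _ → stay) (λ _ → stay) us c
    where
    written : ∀ t {o} → bits (Tape.rights t) ≡ o → bits (Tape.rights (act (bit b , left) t)) ≡ b ∷ o
    written (tape [] _ _)      refl = refl
    written (tape (_ ∷ _) _ _) refl = refl

  pre : ∀ {p A A′ B b} → A ≈ A′ → p ⊢ A′ ⇒[ b ] B → p ⊢ A ⇒[ b ] B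
  pre e h ts rep = h ts (Rep-≈ e ts rep)

  post : ∀ {p A B B′ b} → p ⊢ A ⇒[ b ] B → B ≈ B′ → p ⊢ A ⇒[ b ] B′
  post h e = conseq h e ≤-refl

  run-drain : ∀ r n A → r < K → regs A r ≡ n → drain r ⊢ A ⇒[ n * 2 + 1 ] A [ r ≔ 0 ]
  run-drain r zero    A r<K e = post (while-false (zero-test r<K e)) (≈-pointwise (upd-id (regs A) r e))
  run-drain r (suc n) A r<K e =
    post (while-true (suc-test r<K e) (run-dec r A e)
                     (run-drain r n (A [ r ≔ n ]) r<K (upd-same r n)))
         (≈-pointwise (upd-twice (regs A) r n 0))

  run-rewind : ∀ p σ o → rewind ⊢ st σ p o ⇒[ (p * 2 + 1) + 1 ] st σ 1 o
  run-rewind p σ o = _⨾ᵗ_ (back p) (run-moveInput right)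
    where
    back : ∀ p → while (reading unmarked) (moveInput left) ⊢ st σ p o ⇒[ p * 2 + 1 ] st σ 0 o
    back zero    = while-false (input-test unmarked)
    back (suc p) = while-true (λ ts rep → trans (input-test unmarked ts rep) (cell-unmarked w p))
                              (run-moveInput left) (back p)

  -- The registers involved are displayed as updates of a common `σ`, so that every round starts
  -- from a state of the same shape; the distinctness hypotheses allow the updates to be commuted
  -- back into it.
  copy-loop : ∀ {r f a} → r < K → r ≢ f → r ≢ a → f ≢ a → ∀ n y z σ p o →
              while (nonzero r) (dec′ r ⨾ inc f ⨾ inc a) ⊢ st (upd (upd (upd σ r n) f y) a z) p o
                ⇒[ n * 4 + 1 ] st (upd (upd (upd σ r 0) f (n + y)) a (n + z)) p o
  copy-loop {r} {f} {a} r<K r≢f r≢a f≢a n y z σ p o = go n y z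
    where
    valᵣ : ∀ n y z → upd (upd (upd σ r n) f y) a z r ≡ n
    valᵣ n y z = trans (upd-other z r≢a) (trans (upd-other y r≢f) (upd-same r n))
    go : ∀ n y z → while (nonzero r) (dec′ r ⨾ inc f ⨾ inc a) ⊢ st (upd (upd (upd σ r n) f y) a z) p o
                     ⇒[ n * 4 + 1 ] st (upd (upd (upd σ r 0) f (n + y)) a (n + z)) p o
    go zero    y z = while-false (zero-test r<K (valᵣ 0 y z))
    go (suc n) y z =
      post (while-true (suc-test r<K (valᵣ (suc n) y z))
             (post (_⨾ᵗ_ (run-dec r _ (valᵣ (suc n) y z))
                   (_⨾ᵗ_ (run-inc f _ (trans (upd-other n (r≢f ∘ sym)) (trans (upd-other z f≢a) (upd-same f y))))
                           (run-inc a _ (trans (upd-other (suc y) (f≢a ∘ sym)) (trans (upd-other n (r≢a ∘ sym)) (upd-same a z))))))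
                   (≈-pointwise (upd³ σ r f a _ _ _ _ _ _)))
             (go n (suc y) (suc z)))
           (≈-pointwise λ x → cong₂ (λ u v → upd (upd (upd σ r 0) f u) a v x) (+-suc n y) (+-suc n z))

  move-loop : ∀ {f r} → f < K → f ≢ r → ∀ n y σ p o →
              while (nonzero f) (dec′ f ⨾ inc r) ⊢ st (upd (upd σ f n) r y) p o
                ⇒[ n * 3 + 1 ] st (upd (upd σ f 0) r (n + y)) p o
  move-loop {f} {r} f<K f≢r n y σ p o = go n y
    where
    val : ∀ n y → upd (upd σ f n) r y f ≡ n
    val n y = trans (upd-other y f≢r) (upd-same f n)
    go : ∀ n y → while (nonzero f) (dec′ f ⨾ inc r) ⊢ st (upd (upd σ f n) r y) p o
                   ⇒[ n * 3 + 1 ] st (upd (upd σ f 0) r (n + y)) p o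
    go zero    y = while-false (zero-test f<K (val 0 y))
    go (suc n) y =
      post (while-true (suc-test f<K (val (suc n) y))
             (post (_⨾ᵗ_ (run-dec f _ (val (suc n) y))
                           (run-inc r _ (trans (upd-other n (f≢r ∘ sym)) (upd-same r y))))
                   (≈-pointwise (upd² σ f r _ _ _ _)))
             (go n (suc y)))
           (≈-pointwise λ x → cong (λ v → upd (upd σ f 0) r v x) (+-suc n y))

  monus-loop : ∀ {c b a} → c < K → b < K → c ≢ b → c ≢ a → b ≢ a → ∀ n y z σ p o →
               while (nonzero c) (dec′ c ⨾ cond (nonzero b) (dec′ b) (inc a)) ⊢ st (upd (upd (upd σ c n) b y) a z) p o
                 ⇒[ n * 4 + 1 ] st (upd (upd (upd σ c 0) b (y ∸ n)) a (z + (n ∸ y))) p o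
  monus-loop {c} {b} {a} c<K b<K c≢b c≢a b≢a n y z σ p o = go n y z
    where
    valᶜ : ∀ n y z → upd (upd (upd σ c n) b y) a z c ≡ n
    valᶜ n y z = trans (upd-other z c≢a) (trans (upd-other y c≢b) (upd-same c n))
    valᵇ : ∀ n n′ y z → upd (upd (upd (upd σ c n) b y) a z) c n′ b ≡ y
    valᵇ n n′ y z = trans (upd-other n′ (c≢b ∘ sym)) (trans (upd-other z b≢a) (upd-same b y))
    valᵃ : ∀ n n′ y z → upd (upd (upd (upd σ c n) b y) a z) c n′ a ≡ z
    valᵃ n n′ y z = trans (upd-other n′ (c≢a ∘ sym)) (upd-same a z)
    normᵃ : ∀ v u y v′ y′ x → upd (upd (upd (upd (upd σ c v) b u) a y) c v′) a y′ x ≡ upd (upd (upd σ c v′) b u) a y′ x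
    normᵃ v u y v′ y′ x with x ≟ a | x ≟ c | x ≟ b
    ... | yes _ | _        | _        = refl
    ... | no _  | yes refl | yes refl = contradiction refl c≢b
    ... | no _  | yes _    | no _     = refl
    ... | no _  | no _     | yes _    = refl
    ... | no _  | no _     | no _     = refl
    normᵇ : ∀ v u y v′ u′ x → upd (upd (upd (upd (upd σ c v) b u) a y) c v′) b u′ x ≡ upd (upd (upd σ c v′) b u′) a y x
    normᵇ v u y v′ u′ x with x ≟ b | x ≟ c | x ≟ a
    ... | yes refl | _        | yes refl = contradiction refl b≢a
    ... | yes _    | _        | no _     = refl
    ... | no _     | yes refl | yes refl = contradiction refl c≢a
    ... | no _     | yes _    | no _     = refl
    ... | no _     | no _     | yes _    = refl
    ... | no _     | no _     | no _     = refl
    go : ∀ n y z → while (nonzero c) (dec′ c ⨾ cond (nonzero b) (dec′ b) (inc a)) ⊢ st (upd (upd (upd σ c n) b y) a z) p o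
                     ⇒[ n * 4 + 1 ] st (upd (upd (upd σ c 0) b (y ∸ n)) a (z + (n ∸ y))) p o
    go zero    y z = post (while-false (zero-test c<K (valᶜ 0 y z)))
                          (≈-pointwise λ x → cong (λ u → upd (upd (upd σ c 0) b y) a u x)
                                                  (sym (trans (cong (z +_) (0∸n≡0 y)) (+-identityʳ z))))
    go (suc n) zero z =
      post (while-true (suc-test c<K (valᶜ (suc n) 0 z))
             (post (_⨾ᵗ_ (run-dec c _ (valᶜ (suc n) 0 z))
                           (cond-false (zero-test b<K (valᵇ (suc n) n 0 z)) (run-inc a _ (valᵃ (suc n) n 0 z))))
                   (≈-pointwise (normᵃ _ _ _ _ _)))
             (go n 0 (suc z)))
           (≈-pointwise λ x → cong₂ (λ u v → upd (upd (upd σ c 0) b u) a v x) (0∸n≡0 n) (sym (+-suc z n)))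
    go (suc n) (suc y) z =
      while-true (suc-test c<K (valᶜ (suc n) (suc y) z))
             (post (_⨾ᵗ_ (run-dec c _ (valᶜ (suc n) (suc y) z))
                           (cond-true (suc-test b<K (valᵇ (suc n) n (suc y) z)) (run-dec b _ (valᵇ (suc n) n (suc y) z))))
                   (≈-pointwise (normᵇ _ _ _ _ _)))
             (go n y z)

  seek-loop : ∀ {f} → f < K → ∀ n p σ o →
              while (nonzero f) (dec′ f ⨾ moveInput right) ⊢ st (upd σ f n) p o ⇒[ n * 3 + 1 ] st (upd σ f 0) (n + p) o
  seek-loop {f} f<K zero    p σ o = while-false (zero-test f<K (upd-same f 0))
  seek-loop {f} f<K (suc n) p σ o =
    post (while-true (suc-test f<K (upd-same f (suc n)))
           (post (_⨾ᵗ_ (run-dec f _ (upd-same f (suc n))) (run-moveInput right)) (≈-pointwise (upd-twice σ f _ _)))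
           (seek-loop f<K n (suc p) σ o))
         ((λ _ → refl) , +-suc n p , refl)

  run-add : ∀ {m} (e : Exp m) {ρ vs a f A} → Scope A ρ vs f → Fresh a ρ f → top e f ≤ K → pos A ≡ 1 →
            add e ρ a f ⊢ A ⇒[ cost w e vs ] A [ a ≔ regs A a + eval w e vs ]
  -- The accumulator is fresh, hence zero.
  run-set : ∀ {m} (e : Exp m) {ρ vs a f A} → Scope A ρ vs f → f ≤ a → top e (suc a) ≤ K → pos A ≡ 1 →
            add e ρ a (suc a) ⊢ A ⇒[ cost w e vs ] A [ a ≔ eval w e vs ]
  run-set e {vs = vs} {a} {f} {A} S f≤a t p₁ =
    post (run-add e (Scope-mono (m≤n⇒m≤1+n f≤a) S) (fresh a S f≤a) t p₁)
         (≈-pointwise (upd-const (regs A) a (cong (_+ eval w e vs) (scratch S a f≤a))))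

  run-add (var i) {ρ} {vs} {a} {f} {A} S F t p₁ =
    subst (λ u → add (var i) ρ a f ⊢ A ⇒[ (u * 4 + 1) + (u * 3 + 1) ] A [ a ≔ regs A a + u ]) (value S i)
      (pre (≈-pointwise before)
        (copy-loop r<K (<⇒≢ r<f) r≢a f≢a v 0 z σ (pos A) (out A)
         ⨾ᵗ pre (≈-pointwise between) (post (move-loop t (<⇒≢ r<f ∘ sym) v 0 (upd σ a (v + z)) (pos A) (out A)) (≈-pointwise after))))
    where
    σ = regs A
    r = lookup ρ i
    v = σ r
    z = σ a
    r<f = below S i
    r<K = <-trans r<f t
    r≢a = apart F i
    f≢a : f ≢ a
    f≢a e = <⇒≢ (in-scope F) (sym e)
    before : ∀ x → σ x ≡ upd (upd (upd σ r v) f 0) a z x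
    before x with x ≟ a | x ≟ f | x ≟ r
    ... | yes refl | _        | _        = refl
    ... | no _     | yes refl | _        = scratch S x ≤-refl
    ... | no _     | no _     | yes refl = refl
    ... | no _     | no _     | no _     = refl
    between : ∀ x → upd (upd (upd σ r 0) f (v + 0)) a (v + z) x ≡ upd (upd (upd σ a (v + z)) f v) r 0 x
    between x with x ≟ a | x ≟ f | x ≟ r
    ... | yes refl | yes e    | _        = contradiction (sym e) f≢a
    ... | yes refl | no _     | yes e    = contradiction (sym e) r≢a
    ... | yes _    | no _     | no _     = refl
    ... | no _     | yes refl | yes e    = contradiction (sym e) (<⇒≢ r<f)
    ... | no _     | yes _    | no _     = +-identityʳ v
    ... | no _     | no _     | yes _    = refl
    ... | no _     | no _     | no _     = refl
    after : ∀ x → upd (upd (upd σ a (v + z)) f 0) r (v + 0) x ≡ upd σ a (z + v) x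
    after x with x ≟ r | x ≟ f | x ≟ a
    ... | yes refl | _        | yes e    = contradiction e r≢a
    ... | yes refl | _        | no _     = +-identityʳ v
    ... | no _     | yes refl | yes e    = contradiction e f≢a
    ... | no _     | yes refl | no _     = sym (scratch S x ≤-refl)
    ... | no _     | no _     | yes _    = +-comm v z
    ... | no _     | no _     | no _     = refl

  run-add one {a = a} {A = A} S F t p₁ =
    post (run-inc a A refl) (≈-pointwise (upd-const (regs A) a (+-comm 1 (regs A a))))

  run-add (e ⊞ e′) {ρ} {vs} {a} {f} {A} S F t p₁ =
    post (run-add e S F (≤-trans (f≤top e′ _) t) p₁
            ⨾ᵗ run-add e′ (Scope-upd F′ (Scope-mono f≤ S)) F′ t p₁)
         (≈-pointwise λ x → trans (upd-twice (regs A) a _ _ x)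
                                  (upd-const (regs A) a (trans (cong (_+ eval w e′ vs) (upd-same a _)) (+-assoc (regs A a) _ _)) x))
    where
    f≤ = f≤top e f
    F′ = Fresh-mono f≤ F

  run-add (e ⊟ e′) {ρ} {vs} {a} {f} {A} S F t p₁ =
    run-set e S (n≤1+n f) t₁ p₁
    ⨾ᵗ post (run-add e′ (Scope-upd Fc S₂) Fb t p₁) (≈-pointwise λ x → trans (upd-const (upd σ (1 + f) n) f setb x) (before x))
    ⨾ᵗ monus-loop c<K b<K (λ e → 1+n≢n e) (λ e → <⇒≢ (m<n⇒m<1+n (in-scope F)) (sym e)) (λ e → <⇒≢ (in-scope F) (sym e)) n y z σ (pos A) (out A)
    ⨾ᵗ post (conseq (run-drain f (y ∸ n) _ b<K bval) ((λ _ → refl) , refl , refl)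
                      (+-monoˡ-≤ 1 (*-monoˡ-≤ 2 (m∸n≤m y n))))
            (≈-pointwise after)
    where
    σ = regs A
    n = eval w e vs
    y = eval w e′ vs
    z = σ a
    f₂ = top e (2 + f)
    t₁ = ≤-trans (f≤top e′ f₂) t
    c<K = ≤-trans (f≤top e (2 + f)) t₁
    b<K = <-trans (n<1+n f) c<K
    S₂ : Scope A ρ vs f₂
    S₂ = Scope-mono (≤-trans (m≤n+m f 2) (f≤top e _)) S
    Fc : Fresh (1 + f) ρ f₂
    Fc = Fresh-mono (f≤top e _) (fresh (1 + f) S (n≤1+n f))
    Fb : Fresh f ρ f₂
    Fb = Fresh-mono (≤-trans (n≤1+n (1 + f)) (f≤top e _)) (fresh f S ≤-refl)
    setb : upd σ (1 + f) n f + y ≡ y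
    setb = cong (_+ y) (trans (upd-other n (λ e → 1+n≢n (sym e))) (scratch S f ≤-refl))
    before : ∀ x → upd (upd σ (1 + f) n) f y x ≡ upd (upd (upd σ (1 + f) n) f y) a z x
    before x with x ≟ a | x ≟ f | x ≟ 1 + f
    ... | yes refl | yes e | _     = contradiction e (<⇒≢ (in-scope F))
    ... | yes refl | no _  | yes e = contradiction e (<⇒≢ (m<n⇒m<1+n (in-scope F)))
    ... | yes refl | no _  | no _  = refl
    ... | no _     | yes _ | _     = refl
    ... | no _     | no _  | yes _ = refl
    ... | no _     | no _  | no _  = refl
    bval : upd (upd (upd σ (1 + f) 0) f (y ∸ n)) a (z + (n ∸ y)) f ≡ y ∸ n
    bval = trans (upd-other _ (λ e → <⇒≢ (in-scope F) (sym e))) (upd-same f _)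
    after : ∀ x → upd (upd (upd (upd σ (1 + f) 0) f (y ∸ n)) a (z + (n ∸ y))) f 0 x ≡ upd σ a (z + (n ∸ y)) x
    after x with x ≟ f | x ≟ a | x ≟ 1 + f
    ... | yes refl | yes e | _        = contradiction (sym e) (<⇒≢ (in-scope F))
    ... | yes refl | no _  | _        = sym (scratch S x ≤-refl)
    ... | no _     | yes _ | _        = refl
    ... | no _     | no _  | yes refl = sym (scratch S x (n≤1+n f))
    ... | no _     | no _  | no _     = refl

  run-add (inp e) {ρ} {vs} {a} {f} {A} S F t p₁ =
    run-set e S ≤-refl t p₁
    ⨾ᵗ seek-loop f<K v (pos A) σ (out A)
    ⨾ᵗ readBit
    ⨾ᵗ conseq (run-rewind (v + pos A) _ (out A)) (after , sym p₁ , refl)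
              (≤-reflexive (cong (λ p → p * 2 + 1 + 1) (trans (cong (v +_) p₁) (+-comm v 1))))
    where
    σ = regs A
    v = eval w e vs
    z = σ a
    f<K = ≤-trans (f≤top e _) t
    bv = bitAt w v
    a-val : upd σ f 0 a ≡ z
    a-val = upd-other 0 (<⇒≢ (in-scope F))
    atpos : ∀ b → isTrue (at (List.map bit w) v) ≡ b → Tests (reading isTrue) (st (upd σ f 0) (v + pos A) (out A)) b
    atpos b q ts rep = trans (input-test isTrue ts rep)
      (trans (cong (isTrue ∘ inputCells w) (trans (cong (v +_) p₁) (+-comm v 1))) q)
    bit-cases : positive bv ≡ true → bv ≡ 1
    bit-cases q with bitAt w v | bitAt≤1 w v
    bit-cases () | zero  | _
    ... | suc zero | _ = refl
    ... | suc (suc _) | s≤s ()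
    bit-zero : positive bv ≡ false → bv ≡ 0
    bit-zero q with bitAt w v
    ... | zero = refl
    bit-zero () | suc _
    readBit : cond (reading isTrue) (inc a) skip ⊢ st (upd σ f 0) (v + pos A) (out A)
                ⇒[ 2 ] st (upd (upd σ f 0) a (z + bv)) (v + pos A) (out A)
    readBit with isTrue (at (List.map bit w) v) in q
    ... | true  = post (cond-true (atpos true q) (run-inc a _ a-val))
                         (≈-pointwise (upd-const (upd σ f 0) a (trans (+-comm 1 z) (cong (z +_) (sym (bit-cases (trans (sym (cell-bit w v)) q)))))))
    ... | false = post (cond-false (atpos false q) (run-moveInput stay))
                         (≈-pointwise (upd-id (upd σ f 0) a
                           (trans a-val (sym (trans (cong (z +_) (bit-zero (trans (sym (cell-bit w v)) q))) (+-identityʳ z))))))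
    after : ∀ x → upd (upd σ f 0) a (z + bv) x ≡ upd σ a (z + bv) x
    after x with x ≟ a | x ≟ f
    ... | yes _ | _        = refl
    ... | no _  | yes refl = sym (scratch S x ≤-refl)
    ... | no _  | no _     = refl

  run-add (sum e e′) {ρ} {vs} {a} {f} {A} S F t p₁ =
    run-set e S ≤-refl t₁ p₁
    ⨾ᵗ pre (≈-pointwise before) (post (loop (eval w e vs) z) (≈-pointwise after))
    where
    σ = regs A
    z = σ a
    f₂ = top e (1 + f)
    t₁ = ≤-trans (f≤top e′ f₂) t
    f<K = ≤-trans (f≤top e (1 + f)) t₁
    a≢f = <⇒≢ (in-scope F)
    g : ℕ → ℕ
    g i = eval w e′ (i ∷ vs)
    body = dec′ f ⨾ add e′ (f ∷ ρ) a f₂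
    before : ∀ x → upd σ f (eval w e vs) x ≡ upd (upd σ f (eval w e vs)) a z x
    before x with x ≟ a | x ≟ f
    ... | yes refl | yes e = contradiction e a≢f
    ... | yes refl | no _  = refl
    ... | no _     | yes _ = refl
    ... | no _     | no _  = refl
    after : ∀ x → upd (upd σ f 0) a (z + sumTo (eval w e vs) g) x ≡ upd σ a (z + sumTo (eval w e vs) g) x
    after x with x ≟ a | x ≟ f
    ... | yes _ | _        = refl
    ... | no _  | yes refl = sym (scratch S x ≤-refl)
    ... | no _  | no _     = refl
    val : ∀ n u → upd (upd σ f n) a u f ≡ n
    val n u = trans (upd-other u (a≢f ∘ sym)) (upd-same f n)
    F₂ : Fresh a (f ∷ ρ) f₂
    F₂ = Fresh-mono (f≤top e (1 + f)) (Fresh-bind (in-scope F) F)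
    loop : ∀ n u → while (nonzero f) body ⊢ st (upd (upd σ f n) a u) (pos A) (out A)
                     ⇒[ sumTo n (λ i → 2 + cost w e′ (i ∷ vs)) + 1 ] st (upd (upd σ f 0) a (u + sumTo n g)) (pos A) (out A)
    loop zero    u = post (while-false (zero-test f<K (val 0 u))) (≈-pointwise (upd-const (upd σ f 0) a (sym (+-identityʳ u))))
    loop (suc n) u =
      conseq
        (while-true (suc-test f<K (val (suc n) u))
          (post (run-dec f _ (val (suc n) u)) (≈-pointwise λ x → upd-skip σ f a _ _ _ x (a≢f ∘ sym))
           ⨾ᵗ post (run-add e′ (Scope-upd F₂ (Scope-mono (f≤top e (1 + f)) (Scope-bind f ≤-refl n S))) F₂ t p₁)
                     (≈-pointwise λ x → trans (upd-twice (upd σ f n) a u _ x) (upd-const (upd σ f n) a (cong (_+ g n) (upd-same a u)) x)))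
          (loop n (u + g n)))
        (≈-pointwise (upd-const (upd σ f 0) a (+-assoc u (g n) _)))
        (≤-reflexive (cong (2 +_) (sym (+-assoc (cost w e′ (n ∷ vs)) _ 1))))

  run-put : ∀ {m} (o : Out m) {ρ vs f A} → Scope A ρ vs f → topOut o f ≤ K → pos A ≡ 1 →
            put o ρ f ⊢ A ⇒[ costOut w o vs ] st (regs A) (pos A) (evalOut w o vs ++ out A)
  run-put (emit e) {ρ} {vs} {f} {A} S t p₁ =
    run-set e S ≤-refl t p₁
    ⨾ᵗ write-positive (eval w e vs)
    ⨾ᵗ post (run-drain f (eval w e vs) _ f<K (upd-same f _)) (≈-pointwise after)
    where
    σ = regs A
    f<K = ≤-trans (f≤top e _) t
    write-positive : ∀ v → cond (nonzero f) (write-out true) (write-out false) ⊢ st (upd σ f v) (pos A) (out A)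
                             ⇒[ 2 ] st (upd σ f v) (pos A) (positive v ∷ out A)
    write-positive zero    = cond-false (zero-test f<K (upd-same f 0)) (run-write false)
    write-positive (suc v) = cond-true (suc-test f<K (upd-same f (suc v))) (run-write true)
    after : ∀ x → upd (upd σ f (eval w e vs)) f 0 x ≡ σ x
    after x with x ≟ f
    ... | yes refl = sym (scratch S x ≤-refl)
    ... | no _     = refl
  run-put (o ⨟ o′) {ρ} {vs} {f} {A} S t p₁ =
    post (run-put o′ (Scope-mono (f≤topOut o f) S) t p₁
            ⨾ᵗ run-put o (scope (scratch S) (below S) (value S)) (≤-trans (f≤topOut o′ _) t) p₁)
         ((λ _ → refl) , refl , sym (Listₚ.++-assoc (evalOut w o vs) (evalOut w o′ vs) (out A)))
  run-put (for e o) {ρ} {vs} {f} {A} S t p₁ =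
    run-set e S ≤-refl t₁ p₁
    ⨾ᵗ post (loop (eval w e vs) (out A)) (after , refl , refl)
    where
    σ = regs A
    f₂ = top e (1 + f)
    t₁ = ≤-trans (f≤topOut o f₂) t
    f<K = ≤-trans (f≤top e (1 + f)) t₁
    g : ℕ → List Bool
    g i = evalOut w o (i ∷ vs)
    after : ∀ x → upd σ f 0 x ≡ σ x
    after x = sym (upd-id σ f (scratch S f ≤-refl) x)
    loop : ∀ n u → while (nonzero f) (dec′ f ⨾ put o (f ∷ ρ) f₂) ⊢ st (upd σ f n) (pos A) u
                     ⇒[ sumTo n (λ i → 2 + costOut w o (i ∷ vs)) + 1 ] st (upd σ f 0) (pos A) (concatTo n g ++ u)
    loop zero    u = while-false (zero-test f<K (upd-same f 0))
    loop (suc n) u =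
      conseq
        (while-true (suc-test f<K (upd-same f (suc n)))
          (post (run-dec f _ (upd-same f (suc n))) (≈-pointwise (upd-twice σ f _ _))
           ⨾ᵗ run-put o (Scope-mono (f≤top e (1 + f)) (rescope (Scope-bind f ≤-refl n S))) t p₁)
          (loop n (g n ++ u)))
        ((λ _ → refl) , refl , sym (Listₚ.++-assoc (concatTo n g) (g n) u))
        (≤-reflexive (cong (2 +_) (sym (+-assoc (costOut w o (n ∷ vs)) _ 1))))
      where
      rescope : ∀ {m p o o′ σ f} {ρ vs : Vec ℕ m} → Scope (st σ p o) ρ vs f → Scope (st σ p o′) ρ vs f
      rescope (scope s b v) = scope s b v

-- Polynomial bounds on values and running times

sumTo-bound : ∀ n {f B} → (∀ i → i < n → f i ≤ B) → sumTo n f ≤ n * B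
sumTo-bound zero    h = z≤n
sumTo-bound (suc n) h = +-mono-≤ (h n ≤-refl) (sumTo-bound n λ i i<n → h i (m≤n⇒m≤1+n i<n))

_∘ₚ_ : Poly → Poly → Poly
con c   ∘ₚ r = con c
var     ∘ₚ r = r
(p ⊕ q) ∘ₚ r = (p ∘ₚ r) ⊕ (q ∘ₚ r)
(p ⊗ q) ∘ₚ r = (p ∘ₚ r) ⊗ (q ∘ₚ r)

⟦∘ₚ⟧ : ∀ p r n → ⟦ p ∘ₚ r ⟧ n ≡ ⟦ p ⟧ (⟦ r ⟧ n)
⟦∘ₚ⟧ (con c) r n = refl
⟦∘ₚ⟧ var     r n = refl
⟦∘ₚ⟧ (p ⊕ q) r n = cong₂ _+_ (⟦∘ₚ⟧ p r n) (⟦∘ₚ⟧ q r n)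
⟦∘ₚ⟧ (p ⊗ q) r n = cong₂ _*_ (⟦∘ₚ⟧ p r n) (⟦∘ₚ⟧ q r n)

⟦⟧-mono : ∀ p {m n} → m ≤ n → ⟦ p ⟧ m ≤ ⟦ p ⟧ n
⟦⟧-mono (con c) m≤n = ≤-refl
⟦⟧-mono var     m≤n = m≤n
⟦⟧-mono (p ⊕ q) m≤n = +-mono-≤ (⟦⟧-mono p m≤n) (⟦⟧-mono q m≤n)
⟦⟧-mono (p ⊗ q) m≤n = *-mono-≤ (⟦⟧-mono p m≤n) (⟦⟧-mono q m≤n)

-- The argument bounds all variables at once. Inside a sum the index is below the range, so adding
-- the bound for the range gives a common bound for the extended environment.
valueₚ : ∀ {m} → Exp m → Poly
valueₚ (var _)    = var
valueₚ one        = con 1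
valueₚ (e ⊞ e′)   = valueₚ e ⊕ valueₚ e′
valueₚ (e ⊟ e′)   = valueₚ e
valueₚ (inp e)    = con 1
valueₚ (sum e e′) = valueₚ e ⊗ (valueₚ e′ ∘ₚ (var ⊕ valueₚ e))

costₚ : ∀ {m} → Exp m → Poly
costₚ (var _)    = ((var ⊗ con 4) ⊕ con 1) ⊕ ((var ⊗ con 3) ⊕ con 1)
costₚ one        = con 1
costₚ (e ⊞ e′)   = costₚ e ⊕ costₚ e′
costₚ (e ⊟ e′)   = costₚ e ⊕ (costₚ e′ ⊕ (((valueₚ e ⊗ con 4) ⊕ con 1) ⊕ ((valueₚ e′ ⊗ con 2) ⊕ con 1)))
costₚ (inp e)    =
  costₚ e ⊕ (((valueₚ e ⊗ con 3) ⊕ con 1) ⊕ (con 2 ⊕ ((((con 1 ⊕ valueₚ e) ⊗ con 2) ⊕ con 1) ⊕ con 1)))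
costₚ (sum e e′) = costₚ e ⊕ ((valueₚ e ⊗ (con 2 ⊕ (costₚ e′ ∘ₚ (var ⊕ valueₚ e)))) ⊕ con 1)

costOutₚ : ∀ {m} → Out m → Poly
costOutₚ (emit e)  = costₚ e ⊕ (con 2 ⊕ ((valueₚ e ⊗ con 2) ⊕ con 1))
costOutₚ (o ⨟ o′)  = costOutₚ o′ ⊕ costOutₚ o
costOutₚ (for e o) = costₚ e ⊕ ((valueₚ e ⊗ (con 2 ⊕ (costOutₚ o ∘ₚ (var ⊕ valueₚ e)))) ⊕ con 1)

Bounded : ∀ {m} → Vec ℕ m → ℕ → Set
Bounded ρ x = ∀ i → lookup ρ i ≤ x

bind-bound : ∀ {m} {ρ : Vec ℕ m} {x i v} → Bounded ρ x → i ≤ v → Bounded (i ∷ ρ) (x + v)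
bind-bound {x = x} {v = v} b i≤v zero    = ≤-trans i≤v (m≤n+m v x)
bind-bound {x = x} {v = v} b i≤v (suc j) = ≤-trans (b j) (m≤m+n x v)

module _ (w : List Bool) where

  value-bound : ∀ {m} (e : Exp m) {ρ x} → Bounded ρ x → eval w e ρ ≤ ⟦ valueₚ e ⟧ x

  under-bound : ∀ {m} (e : Exp m) (p : Poly) (f : Vec ℕ (suc m) → ℕ) →
                (∀ {ρ x} → Bounded ρ x → f ρ ≤ ⟦ p ⟧ x) →
                ∀ {ρ x i} → Bounded ρ x → i < eval w e ρ → f (i ∷ ρ) ≤ ⟦ p ∘ₚ (var ⊕ valueₚ e) ⟧ x
  under-bound e p f h {ρ} {x} {i} b i<v rewrite ⟦∘ₚ⟧ p (var ⊕ valueₚ e) x =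
    h (bind-bound b (≤-trans (<⇒≤ i<v) (value-bound e b)))

  value-bound (var i)    b = b i
  value-bound one        b = ≤-refl
  value-bound (e ⊞ e′)   b = +-mono-≤ (value-bound e b) (value-bound e′ b)
  value-bound (e ⊟ e′) {ρ} b = ≤-trans (m∸n≤m (eval w e ρ) (eval w e′ ρ)) (value-bound e b)
  value-bound (inp e) {ρ} b = bitAt≤1 w (eval w e ρ)
  value-bound (sum e e′) {ρ} {x} b =
    ≤-trans (sumTo-bound (eval w e ρ) λ i i<v → under-bound e (valueₚ e′) (eval w e′) (value-bound e′) b i<v)
            (*-monoˡ-≤ _ (value-bound e b))

  loop-bound : ∀ {m} (e : Exp m) (p : Poly) (f : Vec ℕ (suc m) → ℕ) →
               (∀ {ρ x} → Bounded ρ x → f ρ ≤ ⟦ p ⟧ x) → ∀ {ρ x} → Bounded ρ x →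
               sumTo (eval w e ρ) (λ i → 2 + f (i ∷ ρ)) + 1 ≤ ⟦ (valueₚ e ⊗ (con 2 ⊕ (p ∘ₚ (var ⊕ valueₚ e)))) ⊕ con 1 ⟧ x
  loop-bound e p f h {ρ} b =
    +-monoˡ-≤ 1 (≤-trans (sumTo-bound (eval w e ρ) λ i i<v → +-monoʳ-≤ 2 (under-bound e p f h b i<v))
                         (*-monoˡ-≤ _ (value-bound e b)))

  cost-bound : ∀ {m} (e : Exp m) {ρ x} → Bounded ρ x → cost w e ρ ≤ ⟦ costₚ e ⟧ x
  cost-bound (var i)  b = +-mono-≤ (+-monoˡ-≤ 1 (*-monoˡ-≤ 4 (b i))) (+-monoˡ-≤ 1 (*-monoˡ-≤ 3 (b i)))
  cost-bound one      b = ≤-refl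
  cost-bound (e ⊞ e′) b = +-mono-≤ (cost-bound e b) (cost-bound e′ b)
  cost-bound (e ⊟ e′) b =
    +-mono-≤ (cost-bound e b) (+-mono-≤ (cost-bound e′ b)
      (+-mono-≤ (+-monoˡ-≤ 1 (*-monoˡ-≤ 4 (value-bound e b))) (+-monoˡ-≤ 1 (*-monoˡ-≤ 2 (value-bound e′ b)))))
  cost-bound (inp e)  b =
    +-mono-≤ (cost-bound e b) (+-mono-≤ (+-monoˡ-≤ 1 (*-monoˡ-≤ 3 (value-bound e b)))
      (+-monoʳ-≤ 2 (+-monoˡ-≤ 1 (+-monoˡ-≤ 1 (*-monoˡ-≤ 2 (s≤s (value-bound e b)))))))
  cost-bound (sum e e′) b = +-mono-≤ (cost-bound e b) (loop-bound e (costₚ e′) (cost w e′) (cost-bound e′) b)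

  costOut-bound : ∀ {m} (o : Out m) {ρ x} → Bounded ρ x → costOut w o ρ ≤ ⟦ costOutₚ o ⟧ x
  costOut-bound (emit e)  b = +-mono-≤ (cost-bound e b) (+-monoʳ-≤ 2 (+-monoˡ-≤ 1 (*-monoˡ-≤ 2 (value-bound e b))))
  costOut-bound (o ⨟ o′)  b = +-mono-≤ (costOut-bound o′ b) (costOut-bound o b)
  costOut-bound (for e o) b = +-mono-≤ (cost-bound e b) (loop-bound e (costOutₚ o) (costOut w o) (costOut-bound o) b)

-- Loading the input and reading off the output

onlyFirst : ℕ → ℕ → ℕ
onlyFirst i = upd (λ _ → 0) 0 i

module _ {K : ℕ} where

  -- Tape 0 serves for input and output alike, so the input is copied behind a mark on tape 1, and
  -- its length is counted into register 0 on the way. The output then overwrites tape 0 leftwards,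
  -- and `finish` steps onto its first bit.
  setup copy finish : Prog (2 + K)
  setup  = prim λ { (h₀ ∷ h₁ ∷ hs) → (h₀ , stay) ∷ (mark , right) ∷ Vec.map (λ _ → mark , stay) hs }
  copy   = while (λ hs → isBit (Vec.head hs))
                 (prim λ { (h₀ ∷ h₁ ∷ hs) → (h₀ , right) ∷ (h₀ , right) ∷ moveRegs (only 0 right) hs })
  finish = prim λ { (h₀ ∷ hs) → (h₀ , right) ∷ idle hs }

  remaining : List Cell → List Bool → Tape 1
  remaining ls []      = tape ls blank []
  remaining ls (b ∷ u) = tape ls (bit b) (List.map bit u)

  module _ (w : List Bool) where

    record Copying (u : List Bool) (i : ℕ) (ts : Tapes (2 + K)) : Set where
      field
        {outer inner} : List Cell
        {counters}    : Tapes K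
        shape    : ts ≡ remaining outer u ∷ tape inner blank [] ∷ counters
        copied   : LeftCells (inputCells w) (suc i) inner
        pending  : ∀ j → at {1} (List.map bit w) (j + i) ≡ at (List.map bit u) j
        counted  : ∀ r → Zip counter (onlyFirst i (toℕ r)) (lookup counters r)

    run-copy : ∀ u i {ts} → Copying u i ts →
               ∃[ ts′ ] (Run copy ts (length u * 2 + 1) ts′ × Rep {K} w (st (onlyFirst (length u + i)) (suc (length u + i)) []) ts′)
    run-copy [] i record { inner = ls ; shape = refl ; copied = c ; pending = p ; counted = n } =
      _ , run-while-false refl , refl , zip c (sym (p 0)) (λ j → sym (trans (cong (inputCells w) (trans (+-suc j (suc i)) (cong suc (+-suc j i)))) (p (suc j)))) , n
    run-copy (b ∷ u) i {ts} record { outer = os ; inner = ls ; counters = cs ; shape = refl ; copied = c ; pending = p ; counted = n }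
      with run-copy u (suc i) record
             { shape   = cong (_∷ (tape (bit b ∷ ls) blank [] ∷ apply (moveRegs (only 0 right) (heads cs)) cs)) (advance u)
             ; copied  = sym (p 0) , c
             ; pending = λ j → trans (cong (at {1} (List.map bit w)) (+-suc j i)) (p (suc j))
             ; counted = Zip-moveRegs w (onlyFirst i) (onlyFirst (suc i)) (only 0 right) shift cs n
             }
      where
      advance : ∀ u → act (bit b , right) (remaining os (b ∷ u)) ≡ remaining (bit b ∷ os) u
      advance []      = refl
      advance (_ ∷ _) = refl
      shift : ∀ r → Shift (only 0 right r) (onlyFirst i r) (onlyFirst (suc i) r)
      shift r with r ≟ 0
      ... | yes _ = right
      ... | no _  = stay
    ... | ts′ , r , rep =
      ts′ , run-while-true refl (run-prim _ ts) r , subst (λ k → Rep {K} w (st (onlyFirst k) (suc k) []) ts′) (+-suc (length u) i) rep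

    start-tapes : Tapes (2 + K)
    start-tapes = inputTape w ∷ Vec.replicate (suc K) blankTape

    copying₀ : Copying w 0 (apply ((Tape.head (inputTape w) , stay) ∷ (mark , right) ∷ Vec.map (λ _ → mark , stay) (heads (Vec.replicate K blankTape))) start-tapes)
    copying₀ = record
      { shape   = cong₂ _∷_ (shape₀ w) refl
      ; copied  = refl , tt
      ; pending = λ j → cong (at {1} (List.map bit w)) (+-identityʳ j)
      ; counted = λ r → marked K r
      }
      where
      shape₀ : ∀ w → act (Tape.head (inputTape w) , stay) (inputTape w) ≡ remaining [] w
      shape₀ []      = refl
      shape₀ (_ ∷ _) = refl
      zero-everywhere : ∀ r → onlyFirst 0 r ≡ 0
      zero-everywhere r with r ≟ 0
      ... | yes _ = refl
      ... | no _  = refl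
      zeroTape : Zip counter 0 (tape [] mark [])
      zeroTape = zip tt refl λ j → cong counter (sym (+-comm j 1))
      marked : ∀ K (r : Fin K) → Zip counter (onlyFirst 0 (toℕ r))
                 (lookup (apply (Vec.map (λ _ → mark , stay) (heads (Vec.replicate K blankTape))) (Vec.replicate K blankTape)) r)
      marked K r rewrite zero-everywhere (toℕ r) = all-marked K r
        where
        all-marked : ∀ K (r : Fin K) → Zip counter 0
                       (lookup (apply (Vec.map (λ _ → mark , stay) (heads (Vec.replicate K blankTape))) (Vec.replicate K blankTape)) r)
        all-marked (suc K) zero    = zeroTape
        all-marked (suc K) (suc r) = all-marked K r

    run-prepare : ∃[ ts ] (Run (setup ⨾ copy) start-tapes (1 + (length w * 2 + 1)) ts × Rep {K} w (st (onlyFirst (length w)) (suc (length w)) []) ts)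
    run-prepare with run-copy w 0 copying₀
    ... | ts , r , rep =
      ts , run-⨾ (run-prim _ start-tapes) r , subst (λ k → Rep {K} w (st (onlyFirst k) (suc k) []) ts) (+-identityʳ (length w)) rep

    run-finish : ∀ A ts → Rep {K} w A ts → ∃[ ts′ ] (Run finish ts 1 ts′ × readOutput (Vec.head ts′) ≡ out A)
    run-finish A ts@(t₀ ∷ t₁ ∷ us) (o , _ , _) = _ , run-prim _ ts , trans (shifted t₀) o
      where
      shifted : ∀ t → readOutput (act (Tape.head t , right) t) ≡ bits (Tape.rights t)
      shifted (tape _ _ [])      = refl
      shifted (tape _ _ (_ ∷ _)) = refl

-- The single variable is the length of the input, which `copy` has left in register 0; the
-- registers from 1 on are scratch.
polyTime : (o : Out 1) → PolyTime (λ w → evalOut w o (length w ∷ []))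
polyTime o = machine main , timeₚ , λ w → correct w
  where
  K = topOut o 1
  main : Prog (2 + K)
  main = (setup ⨾ copy) ⨾ (rewind ⨾ put o (0 ∷ []) 1) ⨾ finish
  timeₚ : Poly
  timeₚ = (con 1 ⊕ ((var ⊗ con 2) ⊕ con 1)) ⊕ ((((((con 1 ⊕ var) ⊗ con 2) ⊕ con 1) ⊕ con 1) ⊕ costOutₚ o) ⊕ con 1)
  correct : ∀ w → ∃[ t ] ∃[ d ] (TM._⇓[_]_ (machine main) (TM.initial (machine main) w) t d × t ≤ ⟦ timeₚ ⟧ (length w)
                                  × TM.output (machine main) d ≡ evalOut w o (length w ∷ []))
  correct w with run-prepare {K} w
  ... | ts₁ , r₁ , rep₁
    with _⨾ᵗ_ w (run-rewind {K} w (suc (length w)) (onlyFirst (length w)) [])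
              (run-put w o {ρ = 0 ∷ []} {vs = length w ∷ []}
                 (scope (λ { (suc _) (s≤s _) → refl }) (λ { zero → s≤s z≤n }) (λ { zero → refl })) ≤-refl refl)
              ts₁ rep₁
  ... | t₂ , ts₂ , t₂≤ , r₂ , rep₂ with run-finish {K} w _ ts₂ rep₂
  ... | ts₃ , r₃ , o₃ =
    _ , _ , machine-correct main (run-⨾ r₁ (run-⨾ r₂ r₃)) ,
    +-monoʳ-≤ (1 + (length w * 2 + 1))
      (+-monoˡ-≤ 1 (≤-trans t₂≤ (+-monoʳ-≤ (suc (length w) * 2 + 1 + 1)
        (costOut-bound w o {ρ = length w ∷ []} λ { zero → ≤-refl })))) ,
    trans o₃ (Listₚ.++-identityʳ _)

-- Bounded arithmetic

sumTo-cong : ∀ n {f g} → (∀ i → i < n → f i ≡ g i) → sumTo n f ≡ sumTo n g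
sumTo-cong zero    h = refl
sumTo-cong (suc n) h = cong₂ _+_ (h n ≤-refl) (sumTo-cong n λ i i<n → h i (m≤n⇒m≤1+n i<n))

sumTo-const : ∀ n c → sumTo n (λ _ → c) ≡ n * c
sumTo-const zero    c = refl
sumTo-const (suc n) c = cong (c +_) (sumTo-const n c)

sumTo-+ : ∀ n f g → sumTo n (λ i → f i + g i) ≡ sumTo n f + sumTo n g
sumTo-+ zero    f g = refl
sumTo-+ (suc n) f g = trans (cong (f n + g n +_) (sumTo-+ n f g)) (rearrange (f n) (g n) (sumTo n f) (sumTo n g))
  where
  rearrange : ∀ a b c d → a + b + (c + d) ≡ a + c + (b + d)
  rearrange = solve-∀

sumTo-0 : ∀ n {f} → (∀ i → i < n → f i ≡ 0) → sumTo n f ≡ 0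
sumTo-0 n h = trans (sumTo-cong n h) (trans (sumTo-const n 0) (*-zeroʳ n))

sumTo-member : ∀ n f {i} → i < n → f i ≤ sumTo n f
sumTo-member (suc n) f {i} i<1+n with m≤n⇒m<n∨m≡n (s≤s⁻¹ i<1+n)
... | inj₁ i<n  = ≤-trans (sumTo-member n f i<n) (m≤n+m _ (f n))
... | inj₂ refl = m≤m+n (f n) _

sumTo-find : ∀ n f → 1 ≤ sumTo n f → ∃[ i ] (i < n × 1 ≤ f i)
sumTo-find (suc n) f h with f n in eq
... | suc k = n , ≤-refl , subst (1 ≤_) (sym eq) (s≤s z≤n)
... | zero with sumTo-find n f h
... | i , i<n , p = i , m≤n⇒m≤1+n i<n , p

sumTo-split : ∀ m n f → sumTo (m + n) f ≡ sumTo m f + sumTo n (λ i → f (m + i))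
sumTo-split m zero    f rewrite +-identityʳ m = sym (+-identityʳ _)
sumTo-split m (suc n) f rewrite +-suc m n | sumTo-split m n f = swap (f (m + n)) (sumTo m f) _
  where
  swap : ∀ a b c → a + (b + c) ≡ b + (a + c)
  swap = solve-∀

sumTo-threshold : ∀ n q {f} → q ≤ n → (∀ i → i < q → f i ≡ 1) → (∀ i → q ≤ i → i < n → f i ≡ 0) → sumTo n f ≡ q
sumTo-threshold n q {f} q≤n h₁ h₀ = begin
  sumTo n f                                       ≡⟨ cong (λ k → sumTo k f) (sym (m+[n∸m]≡n q≤n)) ⟩
  sumTo (q + (n ∸ q)) f                           ≡⟨ sumTo-split q (n ∸ q) f ⟩
  sumTo q f + sumTo (n ∸ q) (λ i → f (q + i))     ≡⟨ cong₂ _+_ (trans (sumTo-cong q h₁) (sumTo-const q 1)) (sumTo-0 (n ∸ q) λ i i<n∸q → h₀ (q + i) (m≤m+n q i) (≤-trans (+-monoʳ-< q i<n∸q) (≤-reflexive (m+[n∸m]≡n q≤n)))) ⟩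
  q * 1 + 0                                       ≡⟨ trans (+-identityʳ _) (*-identityʳ q) ⟩
  q                                               ∎
  where open ≡-Reasoning

le : ℕ → ℕ → ℕ
le a b = 1 ∸ (a ∸ b)

le-true : ∀ {a b} → a ≤ b → le a b ≡ 1
le-true a≤b = cong (1 ∸_) (m≤n⇒m∸n≡0 a≤b)

le-false : ∀ {a b} → b < a → le a b ≡ 0
le-false b<a with m<n⇒0<n∸m b<a
... | p = m≤n⇒m∸n≡0 p

-- The quotient counts the positive multiples of the divisor that do not exceed u.
quotient-sum : ∀ u d → sumTo u (λ i → le (suc i * suc d) u) ≡ u / suc d
quotient-sum u d = sumTo-threshold u (u / suc d) q≤u (λ i i<q → le-true (≤-trans (*-monoˡ-≤ (suc d) i<q) (m/n*n≤m u (suc d)))) big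
  where
  q≤u : u / suc d ≤ u
  q≤u = ≤-trans (m≤m*n (u / suc d) (suc d)) (m/n*n≤m u (suc d))
  big : ∀ i → u / suc d ≤ i → i < u → le (suc i * suc d) u ≡ 0
  big i q≤i _ = le-false (begin-strict
    u                                         ≡⟨ m≡m%n+[m/n]*n u (suc d) ⟩
    u % suc d + u / suc d * suc d             <⟨ +-monoˡ-< _ (m%n<n u (suc d)) ⟩
    suc d + u / suc d * suc d                 ≤⟨ +-monoʳ-≤ (suc d) (*-monoˡ-≤ (suc d) q≤i) ⟩
    suc i * suc d                             ∎)
    where open ≤-Reasoning

remainder-monus : ∀ u d → u ∸ u / suc d * suc d ≡ u % suc d
remainder-monus u d = sym (m%n≡m∸m/n*n u (suc d))

lift : ∀ {m n} → (Fin m → Fin n) → Fin (suc m) → Fin (suc n)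
lift f zero    = zero
lift f (suc i) = suc (f i)

ren : ∀ {m n} → (Fin m → Fin n) → Exp m → Exp n
ren f (var x)    = var (f x)
ren f one        = one
ren f (e ⊞ e′)   = ren f e ⊞ ren f e′
ren f (e ⊟ e′)   = ren f e ⊟ ren f e′
ren f (inp e)    = inp (ren f e)
ren f (sum e e′) = sum (ren f e) (ren (lift f) e′)

eval-ren : ∀ w {m n} (f : Fin m → Fin n) e {ρ ρ′} → (∀ i → lookup ρ′ (f i) ≡ lookup ρ i) →
           eval w (ren f e) ρ′ ≡ eval w e ρ
eval-ren w f (var x)    h = h x
eval-ren w f one        h = refl
eval-ren w f (e ⊞ e′)   h = cong₂ _+_ (eval-ren w f e h) (eval-ren w f e′ h)
eval-ren w f (e ⊟ e′)   h = cong₂ _∸_ (eval-ren w f e h) (eval-ren w f e′ h)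
eval-ren w f (inp e)    h = cong (bitAt w) (eval-ren w f e h)
eval-ren w f (sum e e′) {ρ} {ρ′} h =
  trans (cong (λ k → sumTo k (λ i → eval w (ren (lift f) e′) (i ∷ ρ′))) (eval-ren w f e h))
        (sumTo-cong (eval w e ρ) λ i _ → eval-ren w (lift f) e′ λ { zero → refl ; (suc j) → h j })

-- Computable functions and definable relations

Fun : ℕ → Set
Fun m = List Bool → Vec ℕ m → ℕ

Rel : ℕ → Set₁
Rel m = List Bool → Vec ℕ m → Set

-- The meaning `f` stays an ordinary function. All later reasoning is about `f`, and `code` is only
-- there to be run.
record Computable {m} (f : Fun m) : Set where
  constructor computable
  field
    code   : Exp m
    sound  : ∀ w ρ → eval w code ρ ≡ f w ρ

open Computable public

castᶜ : ∀ {m} {f g : Fun m} → (∀ w ρ → f w ρ ≡ g w ρ) → Computable f → Computable g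
castᶜ h (computable e s) = computable e λ w ρ → trans (s w ρ) (h w ρ)

varᶜ : ∀ {m} (i : Fin m) → Computable (λ w ρ → lookup ρ i)
varᶜ i = computable (var i) λ _ _ → refl

oneᶜ : ∀ {m} → Computable {m} (λ w ρ → 1)
oneᶜ = computable one λ _ _ → refl

infixl 6 _+ᶜ_ _∸ᶜ_
infixl 7 _*ᶜ_

_+ᶜ_ : ∀ {m} {f g : Fun m} → Computable f → Computable g → Computable (λ w ρ → f w ρ + g w ρ)
computable e s +ᶜ computable e′ s′ = computable (e ⊞ e′) λ w ρ → cong₂ _+_ (s w ρ) (s′ w ρ)

_∸ᶜ_ : ∀ {m} {f g : Fun m} → Computable f → Computable g → Computable (λ w ρ → f w ρ ∸ g w ρ)
computable e s ∸ᶜ computable e′ s′ = computable (e ⊟ e′) λ w ρ → cong₂ _∸_ (s w ρ) (s′ w ρ)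

inputᶜ : ∀ {m} {f : Fun m} → Computable f → Computable (λ w ρ → bitAt w (f w ρ))
inputᶜ (computable e s) = computable (inp e) λ w ρ → cong (bitAt w) (s w ρ)

sumᶜ : ∀ {m} {f : Fun m} {g : Fun (suc m)} → Computable f → Computable g →
       Computable (λ w ρ → sumTo (f w ρ) (λ i → g w (i ∷ ρ)))
sumᶜ {f = f} (computable e s) (computable e′ s′) = computable (sum e e′) λ w ρ →
  trans (cong (λ n → sumTo n (λ i → eval w e′ (i ∷ ρ))) (s w ρ)) (sumTo-cong (f w ρ) λ i _ → s′ w (i ∷ ρ))

weakenᶜ : ∀ {m} {f : Fun m} → Computable f → Computable {suc m} (λ w ρ → f w (Vec.tail ρ))
weakenᶜ (computable e s) = computable (ren suc e) λ { w (i ∷ ρ) → trans (eval-ren w suc e λ _ → refl) (s w ρ) }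

_*ᶜ_ : ∀ {m} {f g : Fun m} → Computable f → Computable g → Computable (λ w ρ → f w ρ * g w ρ)
_*ᶜ_ {f = f} {g} c d = castᶜ (λ w ρ → sumTo-const (f w ρ) (g w ρ)) (sumᶜ c (weakenᶜ d))

constᶜ : ∀ {m} n → Computable {m} (λ w ρ → n)
constᶜ zero          = oneᶜ ∸ᶜ oneᶜ
constᶜ (suc zero)    = oneᶜ
constᶜ (suc (suc n)) = oneᶜ +ᶜ constᶜ (suc n)

sucᶜ : ∀ {m} {f : Fun m} → Computable f → Computable (λ w ρ → suc (f w ρ))
sucᶜ c = oneᶜ +ᶜ c

quotᶜ : ∀ {m} {f d : Fun m} → Computable f → Computable d → Computable (λ w ρ → f w ρ / suc (d w ρ))
quotᶜ {f = f} {d} c e =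
  castᶜ (λ w ρ → quotient-sum (f w ρ) (d w ρ))
        (sumᶜ c (oneᶜ ∸ᶜ (sucᶜ (varᶜ zero) *ᶜ sucᶜ (weakenᶜ e) ∸ᶜ weakenᶜ c)))

remᶜ : ∀ {m} {f d : Fun m} → Computable f → Computable d → Computable (λ w ρ → f w ρ % suc (d w ρ))
remᶜ {f = f} {d} c e = castᶜ (λ w ρ → remainder-monus (f w ρ) (d w ρ)) (c ∸ᶜ quotᶜ c e *ᶜ sucᶜ e)

polyᶜ : ∀ {m} {f : Fun m} p → Computable f → Computable (λ w ρ → ⟦ p ⟧ (f w ρ))
polyᶜ (con n) c = constᶜ n
polyᶜ var     c = c
polyᶜ (p ⊕ q) c = polyᶜ p c +ᶜ polyᶜ q c
polyᶜ (p ⊗ q) c = polyᶜ p c *ᶜ polyᶜ q c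

-- Truth is a positive value rather than the value 1: then conjunction is a product, disjunction a
-- sum and bounded existence a summation, with no normalisation in between.
record Definable {m} (P : Rel m) : Set where
  constructor definable
  field
    test     : Exp m
    holds    : ∀ {w ρ} → 1 ≤ eval w test ρ → P w ρ
    accepted : ∀ {w ρ} → P w ρ → 1 ≤ eval w test ρ

open Definable public

_≤ᵈ_ : ∀ {m} {f g : Fun m} → Computable f → Computable g → Definable (λ w ρ → f w ρ ≤ g w ρ)
_≤ᵈ_ {f = f} {g} c d = definable (code e) from to
  where
  e = oneᶜ ∸ᶜ (c ∸ᶜ d)
  from : ∀ {w ρ} → 1 ≤ eval w (code e) ρ → f w ρ ≤ g w ρ
  from {w} {ρ} h rewrite sound c w ρ | sound d w ρ with f w ρ ≤? g w ρ
  ... | yes p = p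
  ... | no ¬p = contradiction (subst (1 ≤_) (le-false (≰⇒> ¬p)) h) λ ()
  to : ∀ {w ρ} → f w ρ ≤ g w ρ → 1 ≤ eval w (code e) ρ
  to {w} {ρ} h rewrite sound c w ρ | sound d w ρ = ≤-reflexive (sym (le-true h))

_<ᵈ_ : ∀ {m} {f g : Fun m} → Computable f → Computable g → Definable (λ w ρ → f w ρ < g w ρ)
c <ᵈ d = sucᶜ c ≤ᵈ d

infix 4 _≤ᵈ_ _<ᵈ_ _≡ᵈ_
infixr 3 _×ᵈ_
infixr 2 _⊎ᵈ_

_×ᵈ_ : ∀ {m} {P Q : Rel m} → Definable P → Definable Q → Definable (λ w ρ → P w ρ × Q w ρ)
_×ᵈ_ {P = P} {Q} (definable e h a) (definable e′ h′ a′) =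
  definable (code p) from λ {w} {ρ} (x , y) → subst (1 ≤_) (sym (sound p w ρ)) (*-mono-≤ (a x) (a′ y))
  where
  p = computable e (λ _ _ → refl) *ᶜ computable e′ (λ _ _ → refl)
  both : ∀ a b → 1 ≤ a * b → 1 ≤ a × 1 ≤ b
  both (suc a) (suc b) _ = s≤s z≤n , s≤s z≤n
  both (suc a) zero    q = contradiction (subst (1 ≤_) (*-zeroʳ a) q) λ ()
  from : ∀ {w ρ} → 1 ≤ eval w (code p) ρ → P w ρ × Q w ρ
  from {w} {ρ} q with both (eval w e ρ) (eval w e′ ρ) (subst (1 ≤_) (sound p w ρ) q)
  ... | x , y = h x , h′ y

_⊎ᵈ_ : ∀ {m} {P Q : Rel m} → Definable P → Definable Q → Definable (λ w ρ → P w ρ ⊎ Q w ρ)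
_⊎ᵈ_ {P = P} {Q} (definable e h a) (definable e′ h′ a′) = definable (e ⊞ e′) from to
  where
  from : ∀ {w ρ} → 1 ≤ eval w e ρ + eval w e′ ρ → P w ρ ⊎ Q w ρ
  from {w} {ρ} q with eval w e ρ in eq
  ... | suc n = inj₁ (h (subst (1 ≤_) (sym eq) (s≤s z≤n)))
  ... | zero  = inj₂ (h′ q)
  to : ∀ {w ρ} → P w ρ ⊎ Q w ρ → 1 ≤ eval w e ρ + eval w e′ ρ
  to (inj₁ x) = ≤-trans (a x) (m≤m+n _ _)
  to (inj₂ y) = ≤-trans (a′ y) (m≤n+m _ _)

_≡ᵈ_ : ∀ {m} {f g : Fun m} → Computable f → Computable g → Definable (λ w ρ → f w ρ ≡ g w ρ)
c ≡ᵈ d with (c ≤ᵈ d) ×ᵈ (d ≤ᵈ c)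
... | definable e h a =
  definable e (λ p → ≤-antisym (proj₁ (h p)) (proj₂ (h p))) λ p → a (≤-reflexive p , ≤-reflexive (sym p))

∃ᵈ : ∀ {m} {f : Fun m} {P : Rel (suc m)} → Computable f → Definable P →
     Definable (λ w ρ → ∃[ i ] (i < f w ρ × P w (i ∷ ρ)))
∃ᵈ {f = f} {P} c (definable e h a) = definable (sum (code c) e) from to
  where
  from : ∀ {w ρ} → 1 ≤ sumTo (eval w (code c) ρ) (λ i → eval w e (i ∷ ρ)) → ∃[ i ] (i < f w ρ × P w (i ∷ ρ))
  from {w} {ρ} q rewrite sound c w ρ with sumTo-find (f w ρ) _ q
  ... | i , i<n , p = i , i<n , h p
  to : ∀ {w ρ} → ∃[ i ] (i < f w ρ × P w (i ∷ ρ)) → 1 ≤ sumTo (eval w (code c) ρ) (λ i → eval w e (i ∷ ρ))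
  to {w} {ρ} (i , i<n , p) rewrite sound c w ρ = ≤-trans (a p) (sumTo-member (f w ρ) (λ i → eval w e (i ∷ ρ)) i<n)

¬ᵈ : ∀ {m} {P : Rel m} → Definable P → Definable (λ w ρ → ¬ P w ρ)
¬ᵈ {P = P} (definable e h a) = definable (one ⊟ e) (λ q p → contradiction (subst (1 ≤_) (m≤n⇒m∸n≡0 (a p)) q) λ ()) to
  where
  to : ∀ {w ρ} → ¬ P w ρ → 1 ≤ 1 ∸ eval w e ρ
  to {w} {ρ} ¬p with eval w e ρ in eq
  ... | zero  = ≤-refl
  ... | suc n = contradiction (h (subst (1 ≤_) (sym eq) (s≤s z≤n))) ¬p

-- Obtained from `∃ᵈ` by two negations, which is constructively sound because the value of the test
-- decides the body.
∀ᵈ : ∀ {m} {f : Fun m} {P : Rel (suc m)} → Computable f → Definable P →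
     Definable (λ w ρ → ∀ i → i < f w ρ → P w (i ∷ ρ))
∀ᵈ {f = f} {P} c d = definable (test e) from λ p → accepted e λ (i , i<n , ¬q) → ¬q (p i i<n)
  where
  e = ¬ᵈ (∃ᵈ c (¬ᵈ d))
  from : ∀ {w ρ} → 1 ≤ eval w (test e) ρ → ∀ i → i < f w ρ → P w (i ∷ ρ)
  from {w} {ρ} q i i<n with eval w (test d) (i ∷ ρ) in eq
  ... | suc n = holds d (subst (1 ≤_) (sym eq) (s≤s z≤n))
  ... | zero  = contradiction (i , i<n , λ p → contradiction (subst (1 ≤_) eq (accepted d p)) λ ()) (holds e q)

indicator : ∀ {m} {P : Rel m} → Definable P → Fun m
indicator d w ρ = 1 ∸ (1 ∸ eval w (test d) ρ)

indicatorᶜ : ∀ {m} {P : Rel m} (d : Definable P) → Computable (indicator d)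
indicatorᶜ d = computable (one ⊟ (one ⊟ test d)) λ _ _ → refl

indicator-true : ∀ {m} {P : Rel m} (d : Definable P) {w ρ} → P w ρ → indicator d w ρ ≡ 1
indicator-true d p = cong (1 ∸_) (m≤n⇒m∸n≡0 (accepted d p))

indicator-false : ∀ {m} {P : Rel m} (d : Definable P) {w ρ} → ¬ P w ρ → indicator d w ρ ≡ 0
indicator-false d {w} {ρ} ¬p with eval w (test d) ρ in eq
... | zero  = refl
... | suc n = contradiction (holds d (subst (1 ≤_) (sym eq) (s≤s z≤n))) ¬p

indicator-holds : ∀ {m} {P : Rel m} (d : Definable P) {w ρ} → indicator d w ρ ≡ 1 → P w ρ
indicator-holds d {w} {ρ} q with eval w (test d) ρ in eq
indicator-holds d () | zero
... | suc n = holds d (subst (1 ≤_) (sym eq) (s≤s z≤n))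

decide : ∀ {m} {P : Rel m} → Definable P → ∀ w ρ → Dec (P w ρ)
decide d w ρ with 1 ≤? eval w (test d) ρ
... | yes p = yes (holds d p)
... | no ¬p = no (¬p ∘ accepted d)

-- Graphs and their codes

b2n : Bool → ℕ
b2n true  = 1
b2n false = 0

b2n≤1 : ∀ b → b2n b ≤ 1
b2n≤1 true  = ≤-refl
b2n≤1 false = z≤n

b2n-positive : ∀ {n} → n ≤ 1 → b2n (positive n) ≡ n
b2n-positive {zero}        _ = refl
b2n-positive {suc zero}    _ = refl
b2n-positive {suc (suc _)} (s≤s ())

b2n-∧ : ∀ a b → b2n (a ∧ b) ≡ b2n a * b2n b
b2n-∧ true  b = sym (+-identityʳ (b2n b))
b2n-∧ false b = refl

b2n-injective : ∀ {a b} → b2n a ≡ b2n b → a ≡ b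
b2n-injective {true}  {true}  _ = refl
b2n-injective {false} {false} _ = refl

bitAt-head : ∀ b w → bitAt (b ∷ w) 0 ≡ b2n b
bitAt-head true  w = refl
bitAt-head false w = refl

bitAt-tail : ∀ b w i → bitAt (b ∷ w) (suc i) ≡ bitAt w i
bitAt-tail true  w i = refl
bitAt-tail false w i = refl

bitAt-++ˡ : ∀ xs {ys i} → i < length xs → bitAt (xs ++ ys) i ≡ bitAt xs i
bitAt-++ˡ (b ∷ xs) {ys} {zero}  _ = trans (bitAt-head b (xs ++ ys)) (sym (bitAt-head b xs))
bitAt-++ˡ (b ∷ xs) {ys} {suc i} (s≤s i<) =
  trans (bitAt-tail b (xs ++ ys) i) (trans (bitAt-++ˡ xs i<) (sym (bitAt-tail b xs i)))

bitAt-++ʳ : ∀ xs {ys} i → bitAt (xs ++ ys) (length xs + i) ≡ bitAt ys i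
bitAt-++ʳ []       i = refl
bitAt-++ʳ (b ∷ xs) i = trans (bitAt-tail b (xs ++ _) (length xs + i)) (bitAt-++ʳ xs i)

bitAt-ext : ∀ xs ys → length xs ≡ length ys → (∀ i → i < length xs → bitAt xs i ≡ bitAt ys i) → xs ≡ ys
bitAt-ext []       []       _ _ = refl
bitAt-ext (x ∷ xs) (y ∷ ys) e h = cong₂ _∷_
  (b2n-injective (trans (sym (bitAt-head x xs)) (trans (h 0 (s≤s z≤n)) (bitAt-head y ys))))
  (bitAt-ext xs ys (suc-injective e) λ i i< → trans (sym (bitAt-tail x xs i)) (trans (h (suc i) (s≤s i<)) (bitAt-tail y ys i)))

length-concatTo : ∀ n k f → (∀ i → length (f i) ≡ k) → length (concatTo n f) ≡ n * k
length-concatTo zero    k f h = refl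
length-concatTo (suc n) k f h =
  trans (Listₚ.length-++ (concatTo n f)) (trans (cong₂ _+_ (length-concatTo n k f h) (h n)) (+-comm (n * k) k))

position< : ∀ {u n v k} → u < n → v < k → u * k + v < n * k
position< {u} {n} {v} {k} u<n v<k = begin-strict
  u * k + v  <⟨ +-monoʳ-< (u * k) v<k ⟩
  u * k + k  ≡⟨ +-comm (u * k) k ⟩
  suc u * k  ≤⟨ *-monoˡ-≤ k u<n ⟩
  n * k      ∎
  where open ≤-Reasoning

bitAt-concatTo : ∀ n k f → (∀ i → length (f i) ≡ k) → ∀ {u v} → u < n → v < k →
                 bitAt (concatTo n f) (u * k + v) ≡ bitAt (f u) v
bitAt-concatTo (suc n) k f h {u} {v} u<1+n v<k with m≤n⇒m<n∨m≡n (s≤s⁻¹ u<1+n)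
... | inj₁ u<n  = trans (bitAt-++ˡ (concatTo n f) (subst (u * k + v <_) (sym (length-concatTo n k f h)) (position< u<n v<k)))
                        (bitAt-concatTo n k f h u<n v<k)
... | inj₂ refl = trans (cong (λ l → bitAt (concatTo n f ++ f n) (l + v)) (sym (length-concatTo n k f h)))
                        (bitAt-++ʳ (concatTo n f) v)

concatTo-head : ∀ n f → concatTo (suc n) f ≡ f 0 ++ concatTo n (f ∘ suc)
concatTo-head zero    f = sym (Listₚ.++-identityʳ (f 0))
concatTo-head (suc n) f =
  trans (cong (_++ f (suc n)) (concatTo-head n f)) (Listₚ.++-assoc (f 0) (concatTo n (f ∘ suc)) (f (suc n)))

concatTo-cong : ∀ n {f g} → (∀ i → i < n → f i ≡ g i) → concatTo n f ≡ concatTo n g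
concatTo-cong zero    h = refl
concatTo-cong (suc n) h = cong₂ _++_ (concatTo-cong n λ i i<n → h i (m≤n⇒m≤1+n i<n)) (h n ≤-refl)

concatMap-tabulate : ∀ {A : Set} n (g : A → List Bool) (h : Fin n → A) f → (∀ i → g (h i) ≡ f (toℕ i)) →
                     concatMap g (List.tabulate h) ≡ concatTo n f
concatMap-tabulate zero    g h f e = refl
concatMap-tabulate (suc n) g h f e =
  trans (cong₂ _++_ (e zero) (concatMap-tabulate n g (h ∘ suc) (f ∘ suc) (e ∘ suc))) (sym (concatTo-head n f))

map-tabulate : ∀ {A : Set} n (g : A → Bool) (h : Fin n → A) (f : ℕ → Bool) → (∀ i → g (h i) ≡ f (toℕ i)) →
               List.map g (List.tabulate h) ≡ concatTo n (λ i → f i ∷ [])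
map-tabulate zero    g h f e = refl
map-tabulate (suc n) g h f e =
  trans (cong₂ _∷_ (e zero) (map-tabulate n g (h ∘ suc) (f ∘ suc) (e ∘ suc))) (sym (concatTo-head n (λ i → f i ∷ [])))

replicate-concatTo : ∀ n → replicate n true ≡ concatTo n (λ _ → true ∷ [])
replicate-concatTo zero    = refl
replicate-concatTo (suc n) = trans (cong (true ∷_) (replicate-concatTo n)) (sym (concatTo-head n (λ _ → true ∷ [])))

-- `encode` restated through single bits. Words need not be parsed, every field is a bounded
-- arithmetical statement that the verifier can check, and the order is recovered as the position of
-- the first 0.
record Coded (w : List Bool) (n : ℕ) (a : ℕ → ℕ → ℕ) : Set where
  constructor coded
  field
    total : length w ≡ suc (n + n * n)
    ones  : ∀ j → j < n → bitAt w j ≡ 1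
    sep   : bitAt w n ≡ 0
    cells : ∀ u v → u < n → v < n → bitAt w (suc n + (u * n + v)) ≡ a u v

matrixWord : ℕ → (ℕ → ℕ → Bool) → List Bool
matrixWord n f = concatTo n (λ _ → true ∷ []) ++ false ∷ concatTo n (λ u → concatTo n (λ v → f u v ∷ []))

coded-matrixWord : ∀ n f → Coded (matrixWord n f) n (λ u v → b2n (f u v))
coded-matrixWord n f = coded size′ ones′ sep′ entry′
  where
  ws = concatTo n (λ _ → true ∷ [])
  row : ℕ → List Bool
  row u = concatTo n (λ v → f u v ∷ [])
  rows = concatTo n row
  |ws| : length ws ≡ n
  |ws| = trans (length-concatTo n 1 _ λ _ → refl) (*-identityʳ n)
  |row| : ∀ u → length (row u) ≡ n
  |row| u = trans (length-concatTo n 1 _ λ _ → refl) (*-identityʳ n)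
  size′ : length (ws ++ false ∷ rows) ≡ suc (n + n * n)
  size′ = trans (Listₚ.length-++ ws) (trans (cong₂ _+_ |ws| (cong suc (length-concatTo n n row |row|))) (+-suc n (n * n)))
  ones′ : ∀ j → j < n → bitAt (ws ++ false ∷ rows) j ≡ 1
  ones′ j j<n = trans (bitAt-++ˡ ws (subst (j <_) (sym |ws|) j<n))
    (trans (cong (bitAt ws) (sym (trans (+-identityʳ (j * 1)) (*-identityʳ j)))) (bitAt-concatTo n 1 _ (λ _ → refl) j<n (s≤s z≤n)))
  sep′ : bitAt (ws ++ false ∷ rows) n ≡ 0
  sep′ = trans (cong (bitAt (ws ++ false ∷ rows)) (sym (trans (+-identityʳ (length ws)) |ws|))) (bitAt-++ʳ ws 0)
  entry′ : ∀ u v → u < n → v < n → bitAt (ws ++ false ∷ rows) (suc n + (u * n + v)) ≡ b2n (f u v)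
  entry′ u v u<n v<n = begin
    bitAt (ws ++ false ∷ rows) (suc n + (u * n + v))        ≡⟨ cong (bitAt (ws ++ false ∷ rows)) (trans (cong (λ l → suc (l + (u * n + v))) (sym |ws|)) (sym (+-suc (length ws) _))) ⟩
    bitAt (ws ++ false ∷ rows) (length ws + suc (u * n + v)) ≡⟨ bitAt-++ʳ ws (suc (u * n + v)) ⟩
    bitAt rows (u * n + v)                                   ≡⟨ bitAt-concatTo n n row |row| u<n v<n ⟩
    bitAt (row u) v                                          ≡⟨ cong (bitAt (row u)) (sym (trans (+-identityʳ (v * 1)) (*-identityʳ v))) ⟩
    bitAt (row u) (v * 1 + 0)                                ≡⟨ bitAt-concatTo n 1 _ (λ _ → refl) v<n (s≤s z≤n) ⟩
    bitAt (f u v ∷ []) 0                                     ≡⟨ bitAt-head (f u v) [] ⟩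
    b2n (f u v)                                              ∎
    where open ≡-Reasoning

coded-size-unique : ∀ {w n a n′ a′} → Coded w n a → Coded w n′ a′ → n ≡ n′
coded-size-unique {w} {n} {n′ = n′} c c′ with <-cmp n n′
... | tri< n<n′ _ _ = contradiction (trans (sym (Coded.ones c′ n n<n′)) (Coded.sep c)) λ ()
... | tri≈ _ e _    = e
... | tri> _ _ n′<n = contradiction (trans (sym (Coded.ones c n′ n′<n)) (Coded.sep c′)) λ ()

coded-entry-unique : ∀ {w n a a′} → Coded w n a → Coded w n a′ → ∀ u v → u < n → v < n → a u v ≡ a′ u v
coded-entry-unique c c′ u v u<n v<n = trans (sym (Coded.cells c u v u<n v<n)) (Coded.cells c′ u v u<n v<n)

-- Beyond the separator, dividing the position by n recovers row and column, so the fields of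
-- `Coded` account for every bit.
coded-word-unique : ∀ {w w′ n a} → Coded w n a → Coded w′ n a → w ≡ w′
coded-word-unique {w} {w′} {n} c c′ = bitAt-ext w w′ (trans (Coded.total c) (sym (Coded.total c′))) same
  where
  same : ∀ i → i < length w → bitAt w i ≡ bitAt w′ i
  same i i<|w| with <-cmp i n
  ... | tri< i<n _ _ = trans (Coded.ones c i i<n) (sym (Coded.ones c′ i i<n))
  ... | tri≈ _ refl _ = trans (Coded.sep c) (sym (Coded.sep c′))
  ... | tri> _ _ n<i = subst (λ j → bitAt w j ≡ bitAt w′ j) (trans (cong (suc n +_) (sym decomp)) (m+[n∸m]≡n n<i))
                         (trans (Coded.cells c u v u<n v<n) (sym (Coded.cells c′ u v u<n v<n)))
    where
    k = i ∸ suc n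
    k<n*n : k < n * n
    k<n*n = ≤-trans (∸-monoˡ-< (subst (i <_) (Coded.total c) i<|w|) n<i) (≤-reflexive (m+n∸m≡n (suc n) (n * n)))
    instance
      n≢0 : NonZero n
      n≢0 = ≢-nonZero λ { refl → contradiction k<n*n λ () }
    u = k / n
    v = k % n
    u<n : u < n
    u<n = m<n*o⇒m/o<n k<n*n
    v<n : v < n
    v<n = m%n<n k n
    decomp : k ≡ u * n + v
    decomp = trans (m≡m%n+[m/n]*n k n) (+-comm (k % n) _)

extend : ∀ {n} {X : Set} → X → (Fin n → X) → ℕ → X
extend {n} d f i with i <? n
... | yes i<n = f (fromℕ< i<n)
... | no _    = d

extend-toℕ : ∀ {n} {X : Set} (d : X) (f : Fin n → X) i → extend d f (toℕ i) ≡ f i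
extend-toℕ {n} d f i with toℕ i <? n
... | yes p = cong f (Finₚ.fromℕ<-toℕ i p)
... | no ¬p = contradiction (Finₚ.toℕ<n i) ¬p

∀-fin : ∀ {n} (P : ℕ → Set) → (∀ (i : Fin n) → P (toℕ i)) → ∀ u → u < n → P u
∀-fin P h u u<n = subst P (Finₚ.toℕ-fromℕ< u<n) (h (fromℕ< u<n))

sumTo-head : ∀ n f → sumTo (suc n) f ≡ f 0 + sumTo n (f ∘ suc)
sumTo-head zero    f = refl
sumTo-head (suc n) f = trans (cong (f (suc n) +_) (sumTo-head n f)) (swap (f (suc n)) (f 0) _)
  where
  swap : ∀ a b c → a + (b + c) ≡ b + (a + c)
  swap = solve-∀

card-∷ : ∀ {n} b (p : Subset n) → ∣ b ∷ p ∣ ≡ b2n b + ∣ p ∣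
card-∷ true  p = refl
card-∷ false p = refl

card-tabulate : ∀ n (f : Fin n → Bool) F → (∀ i → b2n (f i) ≡ F (toℕ i)) → ∣ tabulate f ∣ ≡ sumTo n F
card-tabulate zero    f F h = refl
card-tabulate (suc n) f F h =
  trans (card-∷ (f zero) (tabulate (f ∘ suc)))
        (trans (cong₂ _+_ (h zero) (card-tabulate n (f ∘ suc) (F ∘ suc) (h ∘ suc))) (sym (sumTo-head n F)))

∩-tabulate : ∀ n (f g : Fin n → Bool) → tabulate f ∩ₛ tabulate g ≡ tabulate (λ i → f i ∧ g i)
∩-tabulate zero    f g = refl
∩-tabulate (suc n) f g = cong ((f zero ∧ g zero) ∷_) (∩-tabulate n (f ∘ suc) (g ∘ suc))

-- Colourings as balanced 0-1 vectors

record IsGraph (n : ℕ) (a : ℕ → ℕ → ℕ) : Set where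
  field
    binary : ∀ u v → u < n → v < n → a u v ≤ 1
    symm   : ∀ u v → u < n → v < n → a u v ≡ a v u
    irrefl : ∀ v → v < n → a v v ≡ 0

-- An exact equation for one colour class. It exhibits every degree as even and, the other class
-- being the complement, expresses strong majority for both colours.
Balanced : ℕ → (ℕ → ℕ → ℕ) → (ℕ → ℕ) → Set
Balanced n a x = ∀ v → v < n → sumTo n (a v) ≡ 2 * sumTo n (λ u → a v u * x u)

module _ (G : Graph) where

  open Graph G

  private
    n = order

  adjacency : ℕ → ℕ → Bool
  adjacency u v = extend false (λ i → extend false (adjacent i) v) u

  adjacency-toℕ : ∀ i j → adjacency (toℕ i) (toℕ j) ≡ adjacent i j
  adjacency-toℕ i j = trans (extend-toℕ false _ i) (extend-toℕ false (adjacent i) j)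

  coded-encode : Coded (encode G) n (λ u v → b2n (adjacency u v))
  coded-encode = subst (λ w → Coded w n (λ u v → b2n (adjacency u v))) (sym encode≡) (coded-matrixWord n adjacency)
    where
    encode≡ : encode G ≡ matrixWord n adjacency
    encode≡ = cong₂ _++_ (replicate-concatTo n) (cong (false ∷_)
      (concatMap-tabulate n (λ u → List.map (adjacent u) (allFin n)) id _ λ i →
        map-tabulate n (adjacent i) id (adjacency (toℕ i)) λ j → sym (adjacency-toℕ i j)))

  isGraph : IsGraph n (λ u v → b2n (adjacency u v))
  isGraph = record
    { binary = λ u v _ _ → b2n≤1 (adjacency u v)
    ; symm   = λ u v u<n v<n → ∀-fin (λ u → b2n (adjacency u v) ≡ b2n (adjacency v u))
                 (λ i → ∀-fin (λ v → b2n (adjacency (toℕ i) v) ≡ b2n (adjacency v (toℕ i)))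
                   (λ j → cong b2n (trans (adjacency-toℕ i j) (trans (symmetric i j) (sym (adjacency-toℕ j i))))) v v<n) u u<n
    ; irrefl = ∀-fin (λ v → b2n (adjacency v v) ≡ 0) λ i → cong b2n (trans (adjacency-toℕ i i) (irreflexive i))
    }

  module _ (χ : Coloring 2) where

    inClass : Fin 2 → ℕ → ℕ
    inClass c = extend 0 (λ i → b2n (does (χ i Fin.≟ c)))

    degree-in : Fin 2 → ℕ → ℕ
    degree-in c v = sumTo n (λ u → b2n (adjacency v u) * inClass c u)

    deg-sum : ∀ i → deg i ≡ sumTo n (λ u → b2n (adjacency (toℕ i) u))
    deg-sum i = card-tabulate n (adjacent i) _ λ j → cong b2n (sym (adjacency-toℕ i j))

    class-sum : ∀ i c → ∣ neighbors i ∩ₛ colorClass χ c ∣ ≡ degree-in c (toℕ i)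
    class-sum i c =
      trans (cong ∣_∣ (∩-tabulate n (adjacent i) (λ j → does (χ j Fin.≟ c))))
            (card-tabulate n (λ j → adjacent i j ∧ does (χ j Fin.≟ c)) _ λ j →
              trans (b2n-∧ (adjacent i j) _)
                    (cong₂ _*_ (cong b2n (sym (adjacency-toℕ i j))) (sym (extend-toℕ 0 (λ i → b2n (does (χ i Fin.≟ c))) j))))

    two-classes : ∀ u → u < n → inClass zero u + inClass (suc zero) u ≡ 1
    two-classes = ∀-fin (λ u → inClass zero u + inClass (suc zero) u ≡ 1) λ i →
      trans (cong₂ _+_ (extend-toℕ 0 (λ i → b2n (does (χ i Fin.≟ zero))) i) (extend-toℕ 0 (λ i → b2n (does (χ i Fin.≟ suc zero))) i)) (cases (χ i))
      where
      cases : (c : Fin 2) → b2n (does (c Fin.≟ zero)) + b2n (does (c Fin.≟ suc zero)) ≡ 1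
      cases zero       = refl
      cases (suc zero) = refl

    split-degree : ∀ v → sumTo n (λ u → b2n (adjacency v u)) ≡ degree-in zero v + degree-in (suc zero) v
    split-degree v = trans (sumTo-cong n λ u u<n → sym (trans (sym (*-distribˡ-+ (b2n (adjacency v u)) _ _))
                              (trans (cong (b2n (adjacency v u) *_) (two-classes u u<n)) (*-identityʳ _))))
                           (sumTo-+ n _ _)

    inClass≤1 : ∀ c u → inClass c u ≤ 1
    inClass≤1 c u with u <? n
    ... | yes p = b2n≤1 _
    ... | no _  = z≤n

    -- Neither class exceeds half of the neighbours and together they exhaust them, so both are
    -- exactly half.
    majority⇒balanced : IsStrongMajority χ → ∀ c → Balanced n (λ u v → b2n (adjacency u v)) (inClass c)
    majority⇒balanced m c = ∀-fin (λ v → sumTo n (λ u → b2n (adjacency v u)) ≡ 2 * degree-in c v) λ i →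
      halves c (toℕ i) λ c → subst₂ _≤_ (cong (2 *_) (class-sum i c)) (trans (deg-sum i) (split-degree (toℕ i))) (m i c)
      where
      double : ∀ a → a + a ≡ 2 * a
      double = solve-∀
      halves : ∀ c v → (∀ c → 2 * degree-in c v ≤ degree-in zero v + degree-in (suc zero) v) →
               sumTo n (λ u → b2n (adjacency v u)) ≡ 2 * degree-in c v
      halves c v le′ = trans (split-degree v) (by-class c)
        where
        d₀ = degree-in zero v
        d₁ = degree-in (suc zero) v
        d₀≡d₁ : d₀ ≡ d₁
        d₀≡d₁ = ≤-antisym (+-cancelˡ-≤ d₀ d₀ d₁ (subst (_≤ d₀ + d₁) (sym (double d₀)) (le′ zero)))
                          (+-cancelʳ-≤ d₁ d₁ d₀ (subst (_≤ d₀ + d₁) (sym (double d₁)) (le′ (suc zero))))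
        by-class : ∀ c → d₀ + d₁ ≡ 2 * degree-in c v
        by-class zero       = trans (cong (d₀ +_) (sym d₀≡d₁)) (double d₀)
        by-class (suc zero) = trans (cong (_+ d₁) d₀≡d₁) (double d₁)

    -- The colours are interchangeable, so the class to be read as true may be chosen to miss a
    -- prescribed vertex. This is how the constant false gets its value.
    avoiding : ∀ z → ∃[ c ] inClass c z ≡ 0
    avoiding z with z <? n
    ... | no _ = zero , refl
    ... | yes p with χ (fromℕ< p)
    ...   | zero     = suc zero , refl
    ...   | suc zero = zero , refl

solution : ∀ {w} → EulerianStrongMajorityColoring 2 w →
           ∃[ n ] ∃[ a ] (Coded w n a × IsGraph n a × ∀ z → ∃[ x ] (x z ≡ 0 × (∀ v → x v ≤ 1) × Balanced n a x))
solution (G , refl , _ , χ , m) = Graph.order G , _ , coded-encode G , isGraph G , λ z →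
  let c , e = avoiding G χ z in inClass G χ c , e , inClass≤1 G χ c , majority⇒balanced G χ m c

colorable : ∀ {w n a x} → Coded w n a → IsGraph n a → (∀ v → v < n → x v ≤ 1) → Balanced n a x →
            EulerianStrongMajorityColoring 2 w
colorable {w} {n} {a} {x} cw g x≤1 bal = G , w≡ , eulerian , χ , majority
  where
  open IsGraph g
  b2n-entry : (i j : Fin n) → b2n (positive (a (toℕ i) (toℕ j))) ≡ a (toℕ i) (toℕ j)
  b2n-entry i j = b2n-positive (binary _ _ (Finₚ.toℕ<n i) (Finₚ.toℕ<n j))
  G : Graph
  G = record
    { order       = n
    ; adjacent    = λ i j → positive (a (toℕ i) (toℕ j))
    ; symmetric   = λ i j → cong positive (symm _ _ (Finₚ.toℕ<n i) (Finₚ.toℕ<n j))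
    ; irreflexive = λ i → cong positive (irrefl _ (Finₚ.toℕ<n i))
    }
  open Graph G using (deg; neighbors; colorClass)
  entries : ∀ u v → u < n → v < n → b2n (adjacency G u v) ≡ a u v
  entries u v u<n v<n = ∀-fin (λ u → b2n (adjacency G u v) ≡ a u v)
    (λ i → ∀-fin (λ v → b2n (adjacency G (toℕ i) v) ≡ a (toℕ i) v) (λ j → trans (cong b2n (adjacency-toℕ G i j)) (b2n-entry i j)) v v<n) u u<n
  w≡ : w ≡ encode G
  w≡ = coded-word-unique cw (coded (Coded.total c) (Coded.ones c) (Coded.sep c)
                              λ u v u<n v<n → trans (Coded.cells c u v u<n v<n) (entries u v u<n v<n))
    where c = coded-encode G
  χ : Fin n → Fin 2
  χ i = if positive (x (toℕ i)) then suc zero else zero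
  colored : ∀ u → u < n → inClass G χ (suc zero) u ≡ x u
  colored = ∀-fin (λ u → inClass G χ (suc zero) u ≡ x u) λ i →
    trans (extend-toℕ 0 _ i) (trans (cases (positive (x (toℕ i)))) (b2n-positive (x≤1 _ (Finₚ.toℕ<n i))))
    where
    cases : ∀ b → b2n (does ((if b then suc zero else zero) Fin.≟ suc {1} zero)) ≡ b2n b
    cases true  = refl
    cases false = refl
  half : ∀ i → deg i ≡ 2 * degree-in G χ (suc zero) (toℕ i)
  half i = trans (deg-sum G χ i) (trans (sumTo-cong n λ u u<n → entries _ u (Finₚ.toℕ<n i) u<n)
    (trans (bal (toℕ i) (Finₚ.toℕ<n i)) (cong (2 *_) (sumTo-cong n λ u u<n →
      cong₂ _*_ (sym (entries _ u (Finₚ.toℕ<n i) u<n)) (sym (colored u u<n))))))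
  eulerian : ∀ i → 2 ∣ deg i
  eulerian i = divides (degree-in G χ (suc zero) (toℕ i)) (trans (half i) (*-comm 2 (degree-in G χ (suc zero) (toℕ i))))
  other-half : ∀ i → deg i ≡ 2 * degree-in G χ zero (toℕ i)
  other-half i = trans (half i) (cong (2 *_) (sym (+-cancelʳ-≡ d₁ d₀ d₁
    (trans (sym (split-degree G χ (toℕ i))) (trans (sym (deg-sum G χ i)) (trans (half i) (cong (d₁ +_) (+-identityʳ d₁))))))))
    where
    d₀ = degree-in G χ zero (toℕ i)
    d₁ = degree-in G χ (suc zero) (toℕ i)
  majority : ∀ i c → 2 * ∣ neighbors i ∩ₛ colorClass χ c ∣ ≤ deg i
  majority i zero       = ≤-reflexive (trans (cong (2 *_) (class-sum G χ i zero)) (sym (other-half i)))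
  majority i (suc zero) = ≤-reflexive (trans (cong (2 *_) (class-sum G χ i (suc zero))) (sym (half i)))

-- Membership in NP

length-pair : ∀ x u → length ⟨ x , u ⟩ ≡ suc (length x * 2 + length u)
length-pair []      u = refl
length-pair (b ∷ x) u = cong (λ k → suc (suc k)) (length-pair x u)

pair-flag : ∀ x u {i} → i < length x → bitAt ⟨ x , u ⟩ (i * 2) ≡ 1
pair-flag (b ∷ x) u {zero}  _        = refl
pair-flag (b ∷ x) u {suc i} (s≤s i<) = trans (bitAt-tail b ⟨ x , u ⟩ (i * 2)) (pair-flag x u i<)

pair-bit : ∀ x u {i} → i < length x → bitAt ⟨ x , u ⟩ (suc (i * 2)) ≡ bitAt x i
pair-bit (b ∷ x) u {zero}  _        = trans (bitAt-head b ⟨ x , u ⟩) (sym (bitAt-head b x))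
pair-bit (b ∷ x) u {suc i} (s≤s i<) =
  trans (bitAt-tail b ⟨ x , u ⟩ (suc (i * 2))) (trans (pair-bit x u i<) (sym (bitAt-tail b x i)))

pair-end : ∀ x u → bitAt ⟨ x , u ⟩ (length x * 2) ≡ 0
pair-end []      u = refl
pair-end (b ∷ x) u = trans (bitAt-tail b ⟨ x , u ⟩ (length x * 2)) (pair-end x u)

pair-certificate : ∀ x u v → bitAt ⟨ x , u ⟩ (suc (length x * 2 + v)) ≡ bitAt u v
pair-certificate []      u v = refl
pair-certificate (b ∷ x) u v = trans (bitAt-tail b ⟨ x , u ⟩ (suc (length x * 2 + v))) (pair-certificate x u v)

infixl 8 _‼_
-- Access to the first component of a pair: its bits stand at the odd positions, behind their flags.
_‼_ : List Bool → ℕ → ℕ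
y ‼ i = bitAt y (suc (i * 2))

entryIn : List Bool → ℕ → ℕ → ℕ → ℕ
entryIn y n u v = y ‼ (suc n + (u * n + v))

colorIn : List Bool → ℕ → ℕ → ℕ
colorIn y m v = bitAt y (suc (m * 2 + v))

-- Here m is the length of the first component, found as the place of the first flag that is 0, and
-- n is the order of the graph. What follows the flags is read as a vector of colours. The last
-- condition covers the evenness of the degrees as well.
Accepts : List Bool → ℕ → Set
Accepts y N =
  ∃[ m ] (m < N × ∃[ n ] (n < N ×
    bitAt y (m * 2) ≡ 0 × (∀ j → j < m → bitAt y (j * 2) ≡ 1) ×
    y ‼ n ≡ 0 × (∀ j → j < n → y ‼ j ≡ 1) × m ≡ suc (n + n * n) ×
    (∀ v → v < n → entryIn y n v v ≡ 0) ×
    (∀ u → u < n → ∀ v → v < n → entryIn y n u v ≡ entryIn y n v u) ×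
    (∀ v → v < n → sumTo n (entryIn y n v) ≡ 2 * sumTo n (λ u → entryIn y n v u * colorIn y m u))))

abstract

  verifier : Definable {1} (λ y ρ → Accepts y (lookup ρ zero))
  verifier =
    ∃ᵈ (varᶜ zero) (∃ᵈ (varᶜ (suc zero))
      ((inputᶜ (v₁ *ᶜ two) ≡ᵈ constᶜ 0) ×ᵈ
       ∀ᵈ v₁ (inputᶜ (v₀ *ᶜ two) ≡ᵈ oneᶜ) ×ᵈ
       (bᶜ v₀ ≡ᵈ constᶜ 0) ×ᵈ
       ∀ᵈ v₀ (bᶜ v₀ ≡ᵈ oneᶜ) ×ᵈ
       (v₁ ≡ᵈ sucᶜ (v₀ +ᶜ v₀ *ᶜ v₀)) ×ᵈ
       ∀ᵈ v₀ (eᶜ v₁ v₀ v₀ ≡ᵈ constᶜ 0) ×ᵈ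
       ∀ᵈ v₀ (∀ᵈ v₁ (eᶜ v₂ v₁ v₀ ≡ᵈ eᶜ v₂ v₀ v₁)) ×ᵈ
       ∀ᵈ v₀ (sumᶜ v₁ (eᶜ v₂ v₁ v₀) ≡ᵈ two *ᶜ sumᶜ v₁ (eᶜ v₂ v₁ v₀ *ᶜ inputᶜ (sucᶜ (v₃ *ᶜ two +ᶜ v₀))))))
    where
    two : ∀ {m} → Computable {m} (λ _ _ → 2)
    two = constᶜ 2
    v₀ : ∀ {m} → Computable {suc m} (λ w ρ → lookup ρ zero)
    v₀ = varᶜ zero
    v₁ : ∀ {m} → Computable {suc (suc m)} (λ w ρ → lookup ρ (suc zero))
    v₁ = varᶜ (suc zero)
    v₂ : ∀ {m} → Computable {suc (suc (suc m))} (λ w ρ → lookup ρ (suc (suc zero)))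
    v₂ = varᶜ (suc (suc zero))
    v₃ : ∀ {m} → Computable {suc (suc (suc (suc m)))} (λ w ρ → lookup ρ (suc (suc (suc zero))))
    v₃ = varᶜ (suc (suc (suc zero)))
    bᶜ : ∀ {m} {f : Fun m} → Computable f → Computable (λ w ρ → w ‼ f w ρ)
    bᶜ c = inputᶜ (sucᶜ (c *ᶜ two))
    eᶜ : ∀ {m} {f g h : Fun m} → Computable f → Computable g → Computable h → Computable (λ w ρ → entryIn w (f w ρ) (g w ρ) (h w ρ))
    eᶜ n u v = bᶜ (sucᶜ n +ᶜ (u *ᶜ n +ᶜ v))

verify : List Bool → Bool
verify y = positive (eval y (test verifier) (length y ∷ []))

verify-sound : ∀ y → verify y ≡ true → Accepts y (length y)
verify-sound y e = holds verifier (positive-≥1 (eval y (test verifier) (length y ∷ [])) e)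
  where
  positive-≥1 : ∀ n → positive n ≡ true → 1 ≤ n
  positive-≥1 (suc n) _ = s≤s z≤n

verify-complete : ∀ y → Accepts y (length y) → verify y ≡ true
verify-complete y acc with eval y (test verifier) (length y ∷ []) | accepted verifier {y} {length y ∷ []} acc
... | suc _ | _ = refl

accepts-complete : ∀ x → EulerianStrongMajorityColoring 2 x → ∃[ u ] (length u ≤ length x × Accepts ⟨ x , u ⟩ (length ⟨ x , u ⟩))
accepts-complete x l with solution l
... | n , a , cx , g , sol with sol 0
... | χ , _ , χ≤1 , bal =
  u , ≤-trans (≤-reflexive |u|) n≤ ,
  length x , m<N , n , ≤-<-trans n≤ m<N , pair-end x u , (λ j → pair-flag x u) ,
  trans (pair-bit x u n<) (Coded.sep cx) ,
  (λ j j<n → trans (pair-bit x u (<-trans j<n n<)) (Coded.ones cx j j<n)) , Coded.total cx ,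
  (λ v v<n → trans (cell v v v<n v<n) (IsGraph.irrefl g v v<n)) ,
  (λ u u<n v v<n → trans (cell u v u<n v<n) (trans (IsGraph.symm g u v u<n v<n) (sym (cell v u v<n u<n)))) ,
  λ v v<n → trans (sumTo-cong n λ u u<n → cell v u v<n u<n)
              (trans (bal v v<n) (cong (2 *_) (sumTo-cong n λ u u<n → sym (cong₂ _*_ (cell v u v<n u<n) (color u u<n)))))
  where
  u = concatTo n (λ v → positive (χ v) ∷ [])
  |u| : length u ≡ n
  |u| = trans (length-concatTo n 1 _ λ _ → refl) (*-identityʳ n)
  n< : n < length x
  n< = subst (n <_) (sym (Coded.total cx)) (s≤s (m≤m+n n (n * n)))
  n≤ = <⇒≤ n<
  m<N : length x < length ⟨ x , u ⟩
  m<N = subst (length x <_) (sym (length-pair x u)) (s≤s (≤-trans (m≤m*n (length x) 2) (m≤m+n _ (length u))))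
  cell : ∀ v w → v < n → w < n → entryIn ⟨ x , u ⟩ n v w ≡ a v w
  cell v w v<n w<n = trans (pair-bit x u (subst (suc n + (v * n + w) <_) (sym (Coded.total cx)) (s≤s (+-monoʳ-< n (position< v<n w<n)))))
                           (Coded.cells cx v w v<n w<n)
  color : ∀ v → v < n → colorIn ⟨ x , u ⟩ (length x) v ≡ χ v
  color v v<n = trans (pair-certificate x u v)
    (trans (cong (bitAt u) (sym (trans (+-identityʳ (v * 1)) (*-identityʳ v))))
    (trans (bitAt-concatTo n 1 _ (λ _ → refl) v<n (s≤s z≤n))
    (trans (bitAt-head (positive (χ v)) []) (b2n-positive (χ≤1 v)))))

accepts-sound : ∀ x u → Accepts ⟨ x , u ⟩ (length ⟨ x , u ⟩) → EulerianStrongMajorityColoring 2 x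
accepts-sound x u (m , _ , n , _ , end , flags , sep , ones , size≡ , irr , sy , bal) =
  colorable {x = colorIn y (length x)} cx
    (record { binary = λ _ _ _ _ → bitAt≤1 y _ ; symm = λ u v u<n v<n → sy u u<n v v<n ; irrefl = irr })
    (λ v _ → bitAt≤1 y _)
    (subst (λ m → ∀ v → v < n → sumTo n (entryIn y n v) ≡ 2 * sumTo n (λ u → entryIn y n v u * colorIn y m u)) m≡ bal)
  where
  y = ⟨ x , u ⟩
  m≡ : m ≡ length x
  m≡ with <-cmp m (length x)
  ... | tri< m< _ _ = contradiction (trans (sym (pair-flag x u m<)) end) λ ()
  ... | tri≈ _ e _  = e
  ... | tri> _ _ m> = contradiction (trans (sym (flags (length x) m>)) (pair-end x u)) λ ()
  |x| : length x ≡ suc (n + n * n)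
  |x| = trans (sym m≡) size≡
  n< : n < length x
  n< = subst (n <_) (sym |x|) (s≤s (m≤m+n n (n * n)))
  cx : Coded x n (entryIn y n)
  cx = coded |x| (λ j j<n → trans (sym (pair-bit x u (<-trans j<n n<))) (ones j j<n)) (trans (sym (pair-bit x u n<)) sep)
             (λ v w v<n w<n → sym (pair-bit x u (subst (suc n + (v * n + w) <_) (sym |x|) (s≤s (+-monoʳ-< n (position< v<n w<n))))))

coloring-NP : NP (EulerianStrongMajorityColoring 2)
-- A certificate has one letter per vertex, and the code of a graph is longer than its order, so
-- `var` bounds its length.
coloring-NP = verify , var , polyTime (emit (test verifier)) , λ x → mk⇔
  (λ l → let u , u≤ , acc = accepts-complete x l in u , u≤ , verify-complete ⟨ x , u ⟩ acc)
  (λ (u , _ , v) → accepts-sound x u (verify-sound ⟨ x , u ⟩ v))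

-- From clauses to graphs

quotient≡ : ∀ q r d → r < suc d → (q * suc d + r) / suc d ≡ q
quotient≡ q r d r<d = begin
  (q * suc d + r) / suc d          ≡⟨ cong (_/ suc d) (+-comm (q * suc d) r) ⟩
  (r + q * suc d) / suc d          ≡⟨ +-distrib-/-∣ʳ r (divides q refl) ⟩
  r / suc d + q * suc d / suc d    ≡⟨ cong₂ _+_ (m<n⇒m/n≡0 r<d) (m*n/n≡m q (suc d)) ⟩
  q                                ∎
  where open ≡-Reasoning

remainder≡ : ∀ q r d → r < suc d → (q * suc d + r) % suc d ≡ r
remainder≡ q r d r<d =
  trans (cong (_% suc d) (+-comm (q * suc d) r)) (trans ([m+kn]%n≡m%n r q (suc d)) (m<n⇒m%n≡m r<d))

divide : ∀ m d → m ≡ m / suc d * suc d + m % suc d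
divide m d = trans (m≡m%n+[m/n]*n m (suc d)) (+-comm (m % suc d) _)

sumTo-single : ∀ D {f p} → p < D → (∀ v → v < D → v ≢ p → f v ≡ 0) → sumTo D f ≡ f p
sumTo-single (suc D) {f} {p} p<1+D h with m≤n⇒m<n∨m≡n (s≤s⁻¹ p<1+D)
... | inj₁ p<D  = cong₂ _+_ (h D ≤-refl λ e → <⇒≢ p<D (sym e)) (sumTo-single D p<D λ v v<D → h v (m≤n⇒m≤1+n v<D))
... | inj₂ refl = trans (cong (f p +_) (sumTo-0 D λ v v<D → h v (m≤n⇒m≤1+n v<D) (<⇒≢ v<D))) (+-identityʳ (f p))

sumTo-pair : ∀ D {f p q} → p < q → q < D → (∀ v → v < D → v ≢ p → v ≢ q → f v ≡ 0) → sumTo D f ≡ f p + f q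
sumTo-pair (suc D) {f} {p} {q} p<q q<1+D h with m≤n⇒m<n∨m≡n (s≤s⁻¹ q<1+D)
... | inj₁ q<D  = cong₂ _+_ (h D ≤-refl (λ e → <⇒≢ (<-trans p<q q<D) (sym e)) (λ e → <⇒≢ q<D (sym e)))
                            (sumTo-pair D p<q q<D λ v v<D → h v (m≤n⇒m≤1+n v<D))
... | inj₂ refl = trans (cong (f q +_) (sumTo-single D p<q λ v v<D v≢p → h v (m≤n⇒m≤1+n v<D) v≢p (<⇒≢ v<D))) (+-comm (f q) (f p))

sumTo-block : ∀ D s K {f} → s + K ≤ D → (∀ v → v < D → v < s ⊎ s + K ≤ v → f v ≡ 0) →
              sumTo D f ≡ sumTo K (λ i → f (s + i))
sumTo-block D s K {f} s+K≤D h = begin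
  sumTo D f                                      ≡⟨ cong (λ d → sumTo d f) (sym (m+[n∸m]≡n s+K≤D)) ⟩
  sumTo (s + K + r) f                            ≡⟨ sumTo-split (s + K) r f ⟩
  sumTo (s + K) f + sumTo r (λ i → f (s + K + i)) ≡⟨ cong₂ _+_ (sumTo-split s K f) (sumTo-0 r λ i i<r → h (s + K + i) (≤-trans (+-monoʳ-< (s + K) i<r) (≤-reflexive (m+[n∸m]≡n s+K≤D))) (inj₂ (m≤m+n _ i))) ⟩
  sumTo s f + sumTo K (λ i → f (s + i)) + 0      ≡⟨ +-identityʳ _ ⟩
  sumTo s f + sumTo K (λ i → f (s + i))          ≡⟨ cong (_+ sumTo K (λ i → f (s + i))) (sumTo-0 s λ v v<s → h v (≤-trans v<s (≤-trans (m≤m+n s K) s+K≤D)) (inj₁ v<s)) ⟩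
  sumTo K (λ i → f (s + i))                      ∎
  where
  r = D ∸ (s + K)
  open ≡-Reasoning

-- Three copies of 0, …, D − 1: the variables, and every constraint twice.
-- Colouring the two copies of a constraint differently balances the neighbourhood of each variable.
module Doubling (D : ℕ) (mem : ℕ → ℕ → ℕ) where

  abstract

    -- A formula in `le` and subtraction instead of a case distinction, so that it translates into
    -- code. The first summand joins a variable u < D to the first copies, D ≤ v < 2 D, and the
    -- second to the second copies, 2 D ≤ v.
    upper : ℕ → ℕ → ℕ
    upper u v = le (suc u) D * (le D v * le (suc v) (D + D) * mem (v ∸ D) u + le (D + D) v * mem (v ∸ (D + D)) u)

    bipartite : ℕ → ℕ → ℕ
    bipartite u v = upper u v + upper v u

    bipartite-def : ∀ u v → bipartite u v ≡
      le (suc u) D * (le D v * le (suc v) (D + D) * mem (v ∸ D) u + le (D + D) v * mem (v ∸ (D + D)) u) +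
      le (suc v) D * (le D u * le (suc u) (D + D) * mem (u ∸ D) v + le (D + D) u * mem (u ∸ (D + D)) v)
    bipartite-def u v = refl

    upper-low : ∀ {u v} → v < D → upper u v ≡ 0
    upper-low {u} v<D rewrite le-false v<D | le-false (≤-trans v<D (m≤m+n D D)) = *-zeroʳ (le (suc u) D)

    upper-high : ∀ {u v} → D ≤ u → upper u v ≡ 0
    upper-high D≤u rewrite le-false (s≤s D≤u) = refl

    upper₁ : ∀ {u z} → u < D → z < D → upper u (D + z) ≡ mem z u
    upper₁ {u} {z} u<D z<D
      rewrite le-true u<D | le-true (m≤m+n D z) | le-true (+-monoʳ-< D z<D) | le-false (+-monoʳ-< D z<D) | m+n∸m≡n D z = tidy (mem z u)
      where
      tidy : ∀ a → a + 0 + 0 + 0 ≡ a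
      tidy = solve-∀

    upper₂ : ∀ {u z} → u < D → upper u (D + D + z) ≡ mem z u
    upper₂ {u} {z} u<D
      rewrite le-true u<D | le-true (≤-trans (m≤m+n D D) (m≤m+n (D + D) z)) | le-false (s≤s (m≤m+n (D + D) z))
            | le-true (m≤m+n (D + D) z) | m+n∸m≡n (D + D) z = tidy (mem z u)
      where
      tidy : ∀ a → a + 0 + 0 ≡ a
      tidy = solve-∀

    D≤₂ : ∀ z → D ≤ D + D + z
    D≤₂ z = ≤-trans (m≤m+n D D) (m≤m+n (D + D) z)

    bipartite-low : ∀ {u v} → u < D → v < D → bipartite u v ≡ 0
    bipartite-low {u} {v} u<D v<D = cong₂ _+_ (upper-low {u} {v} v<D) (upper-low {v} {u} u<D)

    bipartite-high : ∀ {u v} → D ≤ u → D ≤ v → bipartite u v ≡ 0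
    bipartite-high {u} {v} D≤u D≤v = cong₂ _+_ (upper-high {u} {v} D≤u) (upper-high {v} {u} D≤v)

    bipartite₁ : ∀ {u z} → u < D → z < D → bipartite u (D + z) ≡ mem z u
    bipartite₁ {u} {z} u<D z<D = trans (cong₂ _+_ (upper₁ {u} {z} u<D z<D) (upper-high {D + z} {u} (m≤m+n D z))) (+-identityʳ _)

    bipartite₂ : ∀ {u z} → u < D → bipartite u (D + D + z) ≡ mem z u
    bipartite₂ {u} {z} u<D = trans (cong₂ _+_ (upper₂ {u} {z} u<D) (upper-high {D + D + z} {u} (D≤₂ z))) (+-identityʳ _)

    bipartite-sym : ∀ u v → bipartite u v ≡ bipartite v u
    bipartite-sym u v = +-comm (upper u v) (upper v u)

  data Segment : ℕ → Set where
    variable-node : ∀ {u} → u < D → Segment u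
    first-copy    : ∀ {z} → z < D → Segment (D + z)
    second-copy   : ∀ {z} → z < D → Segment (D + D + z)

  N = D + D + D

  segment : ∀ u → u < N → Segment u
  segment u u<N with u <? D
  ... | yes u<D = variable-node u<D
  ... | no u≮D with u <? D + D
  ...   | yes u<2D = subst Segment (m+[n∸m]≡n (≮⇒≥ u≮D)) (first-copy (+-cancelˡ-< D _ _ (subst (_< D + D) (sym (m+[n∸m]≡n (≮⇒≥ u≮D))) u<2D)))
  ...   | no u≮2D  = subst Segment (m+[n∸m]≡n (≮⇒≥ u≮2D)) (second-copy (+-cancelˡ-< (D + D) _ _ (subst (_< N) (sym (m+[n∸m]≡n (≮⇒≥ u≮2D))) u<N)))

  sum-N : ∀ f → sumTo N f ≡ sumTo D f + sumTo D (λ z → f (D + z)) + sumTo D (λ z → f (D + D + z))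
  sum-N f = trans (sumTo-split (D + D) D f) (cong (_+ sumTo D (λ z → f (D + D + z))) (sumTo-split D D f))

  module _ (mem≤1 : ∀ z v → mem z v ≤ 1) where

    bipartite-graph : IsGraph N bipartite
    bipartite-graph = record
      { binary = λ u v u<N v<N → bin (segment u u<N) (segment v v<N)
      ; symm   = λ u v _ _ → bipartite-sym u v
      ; irrefl = λ v v<N → irr (segment v v<N) }
      where
      bin : ∀ {u v} → Segment u → Segment v → bipartite u v ≤ 1
      bin (variable-node p) (variable-node q) = ≤-trans (≤-reflexive (bipartite-low p q)) z≤n
      bin (variable-node p) (first-copy q)    = ≤-trans (≤-reflexive (bipartite₁ p q)) (mem≤1 _ _)
      bin (variable-node p) (second-copy q)   = ≤-trans (≤-reflexive (bipartite₂ p)) (mem≤1 _ _)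
      bin (first-copy {z} p)  (variable-node q) = ≤-trans (≤-reflexive (trans (bipartite-sym _ _) (bipartite₁ q p))) (mem≤1 _ _)
      bin (second-copy {z} p) (variable-node q) = ≤-trans (≤-reflexive (trans (bipartite-sym _ _) (bipartite₂ q))) (mem≤1 _ _)
      bin (first-copy {z} p)  (first-copy {y} q)   = ≤-trans (≤-reflexive (bipartite-high (m≤m+n D z) (m≤m+n D y))) z≤n
      bin (first-copy {z} p)  (second-copy {y} q)  = ≤-trans (≤-reflexive (bipartite-high (m≤m+n D z) (D≤₂ y))) z≤n
      bin (second-copy {z} p) (first-copy {y} q)   = ≤-trans (≤-reflexive (bipartite-high (D≤₂ z) (m≤m+n D y))) z≤n
      bin (second-copy {z} p) (second-copy {y} q)  = ≤-trans (≤-reflexive (bipartite-high (D≤₂ z) (D≤₂ y))) z≤n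
      irr : ∀ {v} → Segment v → bipartite v v ≡ 0
      irr (variable-node p)   = bipartite-low p p
      irr (first-copy {z} p)  = bipartite-high (m≤m+n D z) (m≤m+n D z)
      irr (second-copy {z} p) = bipartite-high (D≤₂ z) (D≤₂ z)

  BalancedRow : (ℕ → ℕ) → ℕ → Set
  BalancedRow x z = sumTo D (mem z) ≡ 2 * sumTo D (λ u → mem z u * x u)


  row-sum : ∀ {v z} → D ≤ v → (∀ u → u < D → bipartite u v ≡ mem z u) → (x : ℕ → ℕ) →
            sumTo N (λ u → bipartite v u * x u) ≡ sumTo D (λ u → mem z u * x u)
  row-sum {v} {z} D≤v h x = begin
    sumTo N (λ u → bipartite v u * x u)    ≡⟨ sum-N _ ⟩
    sumTo D (λ u → bipartite v u * x u) + sumTo D (λ y → bipartite v (D + y) * x (D + y)) + sumTo D (λ y → bipartite v (D + D + y) * x (D + D + y))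
      ≡⟨ cong₂ _+_ (cong₂ _+_ (sumTo-cong D λ u u<D → cong (_* x u) (trans (bipartite-sym v u) (h u u<D)))
                              (sumTo-0 D λ y _ → cong (_* x (D + y)) (bipartite-high D≤v (m≤m+n D y))))
                   (sumTo-0 D λ y _ → cong (_* x (D + D + y)) (bipartite-high D≤v (D≤₂ y))) ⟩
    sumTo D (λ u → mem z u * x u) + 0 + 0  ≡⟨ trans (+-identityʳ _) (+-identityʳ _) ⟩
    sumTo D (λ u → mem z u * x u)          ∎
    where open ≡-Reasoning

  row-degree : ∀ {v z} → D ≤ v → (∀ u → u < D → bipartite u v ≡ mem z u) → sumTo N (bipartite v) ≡ sumTo D (mem z)
  row-degree {v} {z} D≤v h =
    trans (sumTo-cong N λ u _ → sym (*-identityʳ _)) (trans (row-sum D≤v h (λ _ → 1)) (sumTo-cong D λ u _ → *-identityʳ _))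

  -- The neighbours of the first copy of z are exactly the members of constraint z.
  balanced-rows : ∀ {x} → Balanced N bipartite x → ∀ z → z < D → BalancedRow x z
  balanced-rows {x} bal z z<D =
    trans (sym (row-degree (m≤m+n D z) h)) (trans (bal (D + z) D+z<N) (cong (2 *_) (row-sum (m≤m+n D z) h x)))
    where
    h : ∀ u → u < D → bipartite u (D + z) ≡ mem z u
    h u u<D = bipartite₁ u<D z<D
    D+z<N : D + z < N
    D+z<N = ≤-trans (+-monoʳ-< D z<D) (m≤m+n (D + D) D)

  abstract

    doubled : (ℕ → ℕ) → ℕ → ℕ
    doubled x v = le (suc v) D * x v + le D v * le (suc v) (D + D)

    doubled-low : ∀ {x v} → v < D → doubled x v ≡ x v
    doubled-low {x} {v} v<D rewrite le-true v<D | le-false v<D = trans (+-identityʳ _) (+-identityʳ (x v))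

    doubled₁ : ∀ {x z} → z < D → doubled x (D + z) ≡ 1
    doubled₁ {x} {z} z<D rewrite le-false (s≤s (m≤m+n D z)) | le-true (m≤m+n D z) | le-true (+-monoʳ-< D z<D) = refl

    doubled₂ : ∀ {x z} → doubled x (D + D + z) ≡ 0
    doubled₂ {x} {z} rewrite le-false (s≤s (D≤₂ z)) | le-false (s≤s (m≤m+n (D + D) z)) = *-zeroʳ (le D (D + D + z))

  rows-balanced : ∀ {x} → (∀ z → z < D → BalancedRow x z) → Balanced N bipartite (doubled x)
  rows-balanced {x} rows v v<N = go (segment v v<N)
    where
    same : ∀ z → sumTo D (λ u → mem z u * doubled x u) ≡ sumTo D (λ u → mem z u * x u)
    same z = sumTo-cong D λ u u<D → cong (mem z u *_) (doubled-low u<D)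
    copy-row : ∀ {v z} → D ≤ v → (∀ u → u < D → bipartite u v ≡ mem z u) → z < D →
               sumTo N (bipartite v) ≡ 2 * sumTo N (λ u → bipartite v u * doubled x u)
    copy-row {z = z} D≤v h z<D =
      trans (row-degree D≤v h) (trans (rows z z<D) (cong (2 *_) (sym (trans (row-sum D≤v h (doubled x)) (same z)))))
    go : ∀ {v} → Segment v → sumTo N (bipartite v) ≡ 2 * sumTo N (λ u → bipartite v u * doubled x u)
    go (first-copy {z} z<D)  = copy-row (m≤m+n D z) (λ u u<D → bipartite₁ u<D z<D) z<D
    go (second-copy {z} z<D) = copy-row (D≤₂ z) (λ u u<D → bipartite₂ u<D) z<D
    go {v} (variable-node v<D) = trans degree (cong (2 *_) (sym colored))
      where
      s = sumTo D (λ z → mem z v)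
      degree : sumTo N (bipartite v) ≡ 2 * s
      degree = trans (sum-N (bipartite v))
        (trans (cong₂ _+_ (cong₂ _+_ (sumTo-0 D λ u u<D → bipartite-low v<D u<D) (sumTo-cong D λ z z<D → bipartite₁ v<D z<D))
                          (sumTo-cong D λ z _ → bipartite₂ v<D))
               (cong (s +_) (sym (+-identityʳ s))))
      colored : sumTo N (λ u → bipartite v u * doubled x u) ≡ s
      colored = trans (sum-N _)
        (trans (cong₂ _+_ (cong₂ _+_ (sumTo-0 D λ u u<D → cong (_* doubled x u) (bipartite-low v<D u<D))
                                     (sumTo-cong D λ z z<D → trans (cong₂ _*_ (bipartite₁ v<D z<D) (doubled₁ {x} z<D)) (*-identityʳ _)))
                          (sumTo-0 D λ z _ → trans (cong (bipartite v (D + D + z) *_) (doubled₂ {x} {z})) (*-zeroʳ (bipartite v (D + D + z)))))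
               (+-identityʳ s))

  doubled≤1 : ∀ {x} → (∀ v → v < D → x v ≤ 1) → ∀ v → v < N → doubled x v ≤ 1
  doubled≤1 {x} h v v<N with segment v v<N
  ... | variable-node v<D  = ≤-trans (≤-reflexive (doubled-low v<D)) (h v v<D)
  ... | first-copy z<D     = ≤-reflexive (doubled₁ {x} z<D)
  ... | second-copy {z} _  = ≤-trans (≤-reflexive (doubled₂ {x} {z})) z≤n

-- Codes below L name literals: 2 i is the variable i, 2 i + 1 its negation, and 1 is true.
-- Clause c demands that one of the literals nl c 0, …, nl c (k − 1) be false.  It owns a block of 2 k
-- further variables, exactly k of which have to be true: the negations of these k literals,
-- then one that is false, and k − 1 slack variables.
module Clauses (k₀ V₁ B : ℕ) (nl : ℕ → ℕ → ℕ) where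

  -- Since k ≥ 2, the last rank 2 k - 1 of a block exceeds k; so a rank is left over to carry the
  -- counting constraint of the block. With `K₁` in this form, `K` is `k + k` by computation.
  k k₁ K₁ K L D : ℕ
  k₁ = suc k₀
  k  = suc k₁
  K₁ = suc (k₀ + k)
  K  = suc K₁
  L  = suc V₁ * 2
  D  = L + B * K

  block rank : ℕ → ℕ
  block z = (z ∸ L) / K
  rank  z = (z ∸ L) % K

  -- Constraints are numbered like the variables, which gives the three segments of `Doubling` equal
  -- length. Below L, the number z stands for a literal paired with its negation; up to rank k, for
  -- the link between z and the literal it negates; above, for the whole block of z. The same
  -- constraint may be listed several times.
  Mem : ℕ → ℕ → Set
  Mem z v = (z < L × v < L × v / 2 ≡ z / 2)
          ⊎ (L ≤ z × rank z ≤ k × (v ≡ z ⊎ v ≡ nl (block z) (rank z)))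
          ⊎ (L ≤ z × k < rank z × L ≤ v × block v ≡ block z)

  owned : ℕ → ℕ → ℕ
  owned c l = L + (c * K + l)

  record Satisfies (α : ℕ → ℕ) : Set where
    field
      binary   : ∀ v → v < L → α v ≤ 1
      false₀   : α 0 ≡ 0
      literals : ∀ i → i < suc V₁ → α (i * 2) + α (suc (i * 2)) ≡ 1
      clauses  : ∀ c → c < B → ∃[ l ] (l < k × α (nl c l) ≡ 0)

  record Solves (x : ℕ → ℕ) : Set where
    field
      literals : ∀ i → i < suc V₁ → x (i * 2) + x (suc (i * 2)) ≡ 1
      links    : ∀ c l → c < B → l ≤ k → x (nl c l) + x (owned c l) ≡ 1
      blocks   : ∀ c → c < B → sumTo K (λ l → x (owned c l)) ≡ k

  k<K : k < K
  k<K = s≤s (m≤n⇒m≤1+n (m≤n+m k k₀))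

  owned≥L : ∀ c l → L ≤ owned c l
  owned≥L c l = m≤m+n L (c * K + l)

  block-owned : ∀ c {l} → l < K → block (owned c l) ≡ c
  block-owned c {l} l<K rewrite m+n∸m≡n L (c * K + l) = quotient≡ c l K₁ l<K

  rank-owned : ∀ c {l} → l < K → rank (owned c l) ≡ l
  rank-owned c {l} l<K rewrite m+n∸m≡n L (c * K + l) = remainder≡ c l K₁ l<K

  owned<D : ∀ {c l} → c < B → l < K → owned c l < D
  owned<D c<B l<K = +-monoʳ-< L (position< c<B l<K)

  owned-decomposition : ∀ {z} → L ≤ z → z ≡ owned (block z) (rank z)
  owned-decomposition {z} L≤z = trans (sym (m+[n∸m]≡n L≤z)) (cong (L +_) (divide (z ∸ L) K₁))

  block<B : ∀ {z} → L ≤ z → z < D → block z < B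
  block<B {z} L≤z z<D = m<n*o⇒m/o<n (+-cancelˡ-< L _ _ (subst (_< D) (sym (m+[n∸m]≡n L≤z)) z<D))

  rank<K : ∀ z → rank z < K
  rank<K z = m%n<n (z ∸ L) K

  module _ (nl<L : ∀ c l → c < B → l ≤ k → nl c l < L) (nl-top : ∀ c → c < B → nl c k ≡ 1)
           (mem : ℕ → ℕ → ℕ) (mem-yes : ∀ {z v} → Mem z v → mem z v ≡ 1) (mem-no : ∀ {z v} → ¬ Mem z v → mem z v ≡ 0) where

    open Doubling D mem using (BalancedRow)

    weight-no : ∀ {z v} (g : ℕ → ℕ) → ¬ Mem z v → mem z v * g v ≡ 0
    weight-no {v = v} g n = cong (_* g v) (mem-no n)

    weight-yes : ∀ {z v} (g : ℕ → ℕ) → Mem z v → mem z v * g v ≡ g v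
    weight-yes {v = v} g y = trans (cong (_* g v) (mem-yes y)) (+-identityʳ (g v))

    -- The weight g is arbitrary because a balanced row needs two instances: g = 1 gives the size of
    -- the constraint and g = x the number of its true members.
    literal-sum : ∀ z g → z < L → sumTo D (λ v → mem z v * g v) ≡ g (z / 2 * 2) + g (suc (z / 2 * 2))
    literal-sum z g z<L =
      trans (sumTo-pair D ≤-refl (≤-trans q<L (m≤m+n L (B * K))) λ v _ v≢p v≢q → weight-no g (other v≢p v≢q))
            (cong₂ _+_ (weight-yes g (inj₁ (z<L , <-trans ≤-refl q<L , m*n/n≡m i 2)))
                       (weight-yes g (inj₁ (z<L , q<L , trans (cong (_/ 2) (+-comm 1 (i * 2))) (quotient≡ i 1 1 ≤-refl)))))
      where
      i = z / 2
      q<L : suc (i * 2) < L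
      q<L = subst (_< L) (+-comm (i * 2) 1) (position< {i} {suc V₁} {1} {2} (m<n*o⇒m/o<n z<L) ≤-refl)
      other : ∀ {v} → v ≢ i * 2 → v ≢ suc (i * 2) → ¬ Mem z v
      other {v} v≢p v≢q (inj₁ (_ , _ , e)) with v % 2 | m%n<n v 2 | divide v 1
      ... | 0 | _ | d = v≢p (trans d (trans (+-identityʳ _) (cong (_* 2) e)))
      ... | 1 | _ | d = v≢q (trans d (trans (+-comm _ 1) (cong (λ j → suc (j * 2)) e)))
      ... | suc (suc _) | s≤s (s≤s ()) | _
      other v≢p v≢q (inj₂ (inj₁ (L≤z , _))) = <⇒≱ z<L L≤z
      other v≢p v≢q (inj₂ (inj₂ (L≤z , _))) = <⇒≱ z<L L≤z

    link-sum : ∀ z g → L ≤ z → z < D → rank z ≤ k →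
               sumTo D (λ v → mem z v * g v) ≡ g (nl (block z) (rank z)) + g z
    link-sum z g L≤z z<D r≤k =
      trans (sumTo-pair D (<-≤-trans (nl<L _ _ (block<B L≤z z<D) r≤k) L≤z) z<D λ v _ v≢p v≢q → weight-no g (other v≢p v≢q))
            (cong₂ _+_ (weight-yes g (inj₂ (inj₁ (L≤z , r≤k , inj₂ refl)))) (weight-yes g (inj₂ (inj₁ (L≤z , r≤k , inj₁ refl)))))
      where
      other : ∀ {v} → v ≢ nl (block z) (rank z) → v ≢ z → ¬ Mem z v
      other v≢p v≢q (inj₁ (z<L , _))                     = <⇒≱ z<L L≤z
      other v≢p v≢q (inj₂ (inj₁ (_ , _ , inj₁ e)))       = v≢q e
      other v≢p v≢q (inj₂ (inj₁ (_ , _ , inj₂ e)))       = v≢p e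
      other v≢p v≢q (inj₂ (inj₂ (_ , k<r , _)))          = <⇒≱ k<r r≤k

    block-sum : ∀ z g → L ≤ z → z < D → k < rank z →
                sumTo D (λ v → mem z v * g v) ≡ sumTo K (λ l → g (owned (block z) l))
    block-sum z g L≤z z<D k<r =
      trans (sumTo-block D (L + c * K) K inside λ v _ out → weight-no g (other out))
            (sumTo-cong K λ l l<K → trans (cong (λ v → mem z v * g v) (+-assoc L (c * K) l))
              (weight-yes g (inj₂ (inj₂ (L≤z , k<r , owned≥L c l , block-owned c l<K)))))
      where
      c = block z
      inside : L + c * K + K ≤ D
      inside = ≤-trans (≤-reflexive (trans (+-assoc L (c * K) K) (cong (L +_) (+-comm (c * K) K))))
                       (+-monoʳ-≤ L (*-monoˡ-≤ K (block<B L≤z z<D)))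
      other : ∀ {v} → v < L + c * K ⊎ L + c * K + K ≤ v → ¬ Mem z v
      other out (inj₁ (z<L , _))              = <⇒≱ z<L L≤z
      other out (inj₂ (inj₁ (_ , r≤k , _)))   = <⇒≱ k<r r≤k
      other {v} out (inj₂ (inj₂ (_ , _ , L≤v , e))) = beyond out
        where
        v≡ : v ≡ L + c * K + rank v
        v≡ = trans (owned-decomposition L≤v) (trans (cong (λ b → owned b (rank v)) e) (sym (+-assoc L (c * K) (rank v))))
        beyond : v < L + c * K ⊎ L + c * K + K ≤ v → ⊥
        beyond (inj₁ v<) = <⇒≱ v< (subst (L + c * K ≤_) (sym v≡) (m≤m+n _ (rank v)))
        beyond (inj₂ v≥) = <⇒≱ (subst (_< L + c * K + K) (sym v≡) (+-monoʳ-< (L + c * K) (rank<K v))) v≥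

    degree : ∀ z → sumTo D (mem z) ≡ sumTo D (λ v → mem z v * 1)
    degree z = sumTo-cong D λ v _ → sym (*-identityʳ (mem z v))

    rows⇒solves : ∀ {x} → (∀ z → z < D → BalancedRow x z) → Solves x
    rows⇒solves {x} rows = record { literals = lit ; links = lnk ; blocks = blk }
      where
      lit : ∀ i → i < suc V₁ → x (i * 2) + x (suc (i * 2)) ≡ 1
      lit i i≤V = sym (*-cancelˡ-≡ 1 _ 2 (trans (sym (trans (degree z) (literal-sum z (λ _ → 1) z<L)))
                    (trans (rows z (≤-trans z<L (m≤m+n L _))) (cong (2 *_) (trans (literal-sum z x z<L) (cong (λ j → x (j * 2) + x (suc (j * 2))) (m*n/n≡m i 2)))))))
        where
        z = i * 2
        z<L : z < L
        z<L = *-monoˡ-< 2 i≤V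
      lnk : ∀ c l → c < B → l ≤ k → x (nl c l) + x (owned c l) ≡ 1
      lnk c l c<B l≤k = sym (*-cancelˡ-≡ 1 _ 2 (trans (sym (trans (degree z) (link-sum z (λ _ → 1) L≤z z<D r≤k)))
                    (trans (rows z z<D) (cong (2 *_) (trans (link-sum z x L≤z z<D r≤k) (cong (λ v → x v + x z) (cong₂ nl (block-owned c l<K) (rank-owned c l<K))))))))
        where
        z = owned c l
        l<K = ≤-<-trans l≤k k<K
        L≤z = owned≥L c l
        z<D = owned<D c<B l<K
        r≤k = subst (_≤ k) (sym (rank-owned c l<K)) l≤k
      blk : ∀ c → c < B → sumTo K (λ l → x (owned c l)) ≡ k
      blk c c<B = sym (*-cancelˡ-≡ k _ 2 (trans (cong (k +_) (+-identityʳ k)) (trans (sym (trans (degree z) (trans (block-sum z (λ _ → 1) L≤z z<D k<r) (trans (sumTo-const K 1) (*-identityʳ K)))))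
                    (trans (rows z z<D) (cong (2 *_) (trans (block-sum z x L≤z z<D k<r) (sumTo-cong K λ l _ → cong (λ b → x (owned b l)) (block-owned c ≤-refl))))))))
        where
        z = owned c K₁
        L≤z = owned≥L c K₁
        z<D = owned<D c<B ≤-refl
        k<r : k < rank z
        k<r = subst (k <_) (sym (rank-owned c ≤-refl)) (s≤s (m≤n+m k k₀))

    solves⇒rows : ∀ {x} → Solves x → ∀ z → z < D → BalancedRow x z
    solves⇒rows {x} s z z<D with z <? L
    ... | yes z<L = trans (trans (degree z) (literal-sum z (λ _ → 1) z<L))
                          (cong (2 *_) (sym (trans (literal-sum z x z<L) (Solves.literals s (z / 2) (m<n*o⇒m/o<n z<L)))))
    ... | no z≮L with rank z ≤? k
    ...   | yes r≤k = trans (trans (degree z) (link-sum z (λ _ → 1) L≤z z<D r≤k))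
                            (cong (2 *_) (sym (trans (link-sum z x L≤z z<D r≤k)
                              (trans (cong (λ v → x (nl (block z) (rank z)) + x v) (owned-decomposition L≤z)) (Solves.links s (block z) (rank z) (block<B L≤z z<D) r≤k)))))
      where L≤z = ≮⇒≥ z≮L
    ...   | no r≰k  = trans (trans (degree z) (trans (block-sum z (λ _ → 1) L≤z z<D (≰⇒> r≰k)) (trans (sumTo-const K 1) (*-identityʳ K))))
                            (trans (cong (k +_) (sym (+-identityʳ k)))
                              (cong (2 *_) (sym (trans (block-sum z x L≤z z<D (≰⇒> r≰k)) (Solves.blocks s (block z) (block<B L≤z z<D))))))
      where L≤z = ≮⇒≥ z≮L

    -- Of the k true variables of a block at most k - 1 lie in its second half, which starts with a
    -- false one. So a negation in the first half is true, and its literal is false.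
    solves⇒satisfies : ∀ {x} → (∀ v → x v ≤ 1) → x 0 ≡ 0 → Solves x → Satisfies x
    solves⇒satisfies {x} x≤1 x₀ s = record { binary = λ v _ → x≤1 v ; false₀ = x₀ ; literals = Solves.literals s ; clauses = clause }
      where
      x₁ : x 1 ≡ 1
      x₁ = trans (cong (_+ x 1) (sym x₀)) (Solves.literals s 0 (s≤s z≤n))
      clause : ∀ c → c < B → ∃[ l ] (l < k × x (nl c l) ≡ 0)
      clause c c<B with sumTo-find k (λ l → x (owned c l)) some
        where
        rest = sumTo k (λ i → x (owned c (k + i)))
        x-top : x (owned c (k + 0)) ≡ 0
        x-top = trans (cong (λ i → x (owned c i)) (+-identityʳ k))
          (suc-injective (trans (cong (_+ x (owned c k)) (sym (trans (cong x (nl-top c c<B)) x₁))) (Solves.links s c k c<B ≤-refl)))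
        rest≤ : rest ≤ k₁
        rest≤ = begin
          rest                                                              ≡⟨ sumTo-head k₁ (λ i → x (owned c (k + i))) ⟩
          x (owned c (k + 0)) + sumTo k₁ (λ i → x (owned c (k + suc i)))    ≤⟨ +-mono-≤ (≤-reflexive x-top) (sumTo-bound k₁ λ i _ → x≤1 _) ⟩
          k₁ * 1                                                            ≡⟨ *-identityʳ k₁ ⟩
          k₁                                                                ∎
          where open ≤-Reasoning
        some : 1 ≤ sumTo k (λ l → x (owned c l))
        some = +-cancelʳ-≤ k₁ 1 _ (≤-trans (≤-reflexive (trans (sym (Solves.blocks s c c<B)) (sumTo-split k k (λ l → x (owned c l))))) (+-monoʳ-≤ _ rest≤))
      ... | l , l<k , 1≤ = l , l<k , n≤0⇒n≡0 (+-cancelʳ-≤ 1 _ 0 (≤-trans (+-monoʳ-≤ (x (nl c l)) 1≤) (≤-reflexive (Solves.links s c l c<B (<⇒≤ l<k)))))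

    module _ (α : ℕ → ℕ) (sat : Satisfies α) where

      open Satisfies sat

      satisfied : ℕ → ℕ
      satisfied c = sumTo k (λ l → 1 ∸ α (nl c l))

      -- Ranks up to k are forced by the links. Of the slack variables the first `k ∸ satisfied c`
      -- are made true, to fill the block up to k.
      inBlock : ℕ → ℕ → ℕ
      inBlock c r with r ≤? k
      ... | yes _ = 1 ∸ α (nl c r)
      ... | no _  = le (suc (r ∸ suc k)) (k ∸ satisfied c)

      assignment : ℕ → ℕ
      assignment v with v <? L
      ... | yes _ = α v
      ... | no _  = inBlock (block v) (rank v)

      assignment-low : ∀ {v} → v < L → assignment v ≡ α v
      assignment-low {v} v<L with v <? L
      ... | yes _ = refl
      ... | no v≮L = contradiction v<L v≮L

      assignment-owned : ∀ c {l} → l < K → assignment (owned c l) ≡ inBlock c l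
      assignment-owned c {l} l<K with owned c l <? L
      ... | yes o<L = contradiction (owned≥L c l) (<⇒≱ o<L)
      ... | no _    = cong₂ inBlock (block-owned c l<K) (rank-owned c l<K)

      inBlock-link : ∀ c {l} → l ≤ k → inBlock c l ≡ 1 ∸ α (nl c l)
      inBlock-link c {l} l≤k with l ≤? k
      ... | yes _ = refl
      ... | no l≰k = contradiction l≤k l≰k

      inBlock-slack : ∀ c i → inBlock c (k + suc i) ≡ le (suc i) (k ∸ satisfied c)
      inBlock-slack c i with k + suc i ≤? k
      ... | yes p = contradiction (≤-trans (≤-reflexive (sym (+-suc k i))) p) (<⇒≱ (s≤s (m≤m+n k i)))
      ... | no _  = cong (λ j → le (suc j) (k ∸ satisfied c)) (trans (cong (_∸ suc k) (+-suc k i)) (m+n∸m≡n (suc k) i))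

      assignment≤1 : ∀ v → v < D → assignment v ≤ 1
      assignment≤1 v v<D with v <? L
      ... | yes v<L = binary v v<L
      ... | no _ with rank v ≤? k
      ...   | yes _ = m∸n≤m 1 (α (nl (block v) (rank v)))
      ...   | no _  = m∸n≤m 1 (suc (rank v ∸ suc k) ∸ (k ∸ satisfied (block v)))

      assignment-solves : Solves assignment
      assignment-solves = record { literals = lit ; links = lnk ; blocks = blk }
        where
        lit : ∀ i → i < suc V₁ → assignment (i * 2) + assignment (suc (i * 2)) ≡ 1
        lit i i≤V = trans (cong₂ _+_ (assignment-low (<-trans ≤-refl q<L)) (assignment-low q<L)) (literals i i≤V)
          where
          q<L : suc (i * 2) < L
          q<L = subst (_< L) (+-comm (i * 2) 1) (position< {i} {suc V₁} {1} {2} i≤V ≤-refl)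
        lnk : ∀ c l → c < B → l ≤ k → assignment (nl c l) + assignment (owned c l) ≡ 1
        lnk c l c<B l≤k =
          trans (cong₂ _+_ (assignment-low n<L) (trans (assignment-owned c (≤-<-trans l≤k k<K)) (inBlock-link c l≤k)))
                (m+[n∸m]≡n (binary _ n<L))
          where n<L = nl<L c l c<B l≤k
        blk : ∀ c → c < B → sumTo K (λ l → assignment (owned c l)) ≡ k
        blk c c<B = begin
          sumTo (k + k) (λ l → assignment (owned c l))                        ≡⟨ sumTo-cong K (λ l l<K → assignment-owned c l<K) ⟩
          sumTo (k + k) (inBlock c)                                           ≡⟨ sumTo-split k k (inBlock c) ⟩
          sumTo k (inBlock c) + sumTo k (λ i → inBlock c (k + i))             ≡⟨ cong₂ _+_ (sumTo-cong k λ l l<k → inBlock-link c (<⇒≤ l<k)) (sumTo-head k₁ (λ i → inBlock c (k + i))) ⟩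
          S + (inBlock c (k + 0) + sumTo k₁ (λ i → inBlock c (k + suc i)))    ≡⟨ cong (S +_) (cong₂ _+_ top-false (trans (sumTo-cong k₁ λ i _ → inBlock-slack c i) slack)) ⟩
          S + (k ∸ S)                                                         ≡⟨ m+[n∸m]≡n S≤k ⟩
          k                                                                   ∎
          where
          open ≡-Reasoning
          S = satisfied c
          S≤k : S ≤ k
          S≤k = ≤-trans (sumTo-bound k λ l _ → m∸n≤m 1 (α (nl c l))) (≤-reflexive (*-identityʳ k))
          1≤S : 1 ≤ S
          1≤S with clauses c c<B
          ... | l , l<k , e = ≤-trans (≤-reflexive (cong (1 ∸_) (sym e))) (sumTo-member k (λ l → 1 ∸ α (nl c l)) l<k)
          α₁ : α 1 ≡ 1
          α₁ = trans (cong (_+ α 1) (sym false₀)) (literals 0 (s≤s z≤n))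
          top-false : inBlock c (k + 0) ≡ 0
          top-false = trans (cong (inBlock c) (+-identityʳ k)) (trans (inBlock-link c ≤-refl) (cong (1 ∸_) (trans (cong α (nl-top c c<B)) α₁)))
          -- The clause enters here: 1 ≤ S lets the `k ∸ S` true slack variables fit among the k - 1
          -- available.
          slack : sumTo k₁ (λ i → le (suc i) (k ∸ S)) ≡ k ∸ S
          slack = sumTo-threshold k₁ (k ∸ S) (∸-monoʳ-≤ k 1≤S) (λ i i< → le-true i<) (λ i ≤i _ → le-false (s≤s ≤i))

-- Computing the graph of a clause family

indicator-cong : ∀ {m m′} {P : Rel m} {P′ : Rel m′} (d : Definable P) (d′ : Definable P′) {w ρ ρ′} →
                 (P w ρ → P′ w ρ′) → (P′ w ρ′ → P w ρ) → indicator d w ρ ≡ indicator d′ w ρ′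
indicator-cong d d′ {w} {ρ} {ρ′} f g with decide d w ρ
... | yes p = trans (indicator-true d p) (sym (indicator-true d′ (f p)))
... | no ¬p = trans (indicator-false d ¬p) (sym (indicator-false d′ (¬p ∘ g)))

leᶜ : ∀ {m} {f g : Fun m} → Computable f → Computable g → Computable (λ w ρ → le (f w ρ) (g w ρ))
leᶜ c d = oneᶜ ∸ᶜ (c ∸ᶜ d)

-- One clause system for every word, uniformly computable. The length is a separate argument of `nl`
-- because an expression receives it as a variable.
record ClauseFamily : Set where
  field
    k₀     : ℕ
    V₁ B   : ℕ → ℕ
    nl     : List Bool → ℕ → ℕ → ℕ → ℕ
    V₁ᶜ    : ∀ {m} {n : Fun m} → Computable n → Computable (λ w ρ → V₁ (n w ρ))
    Bᶜ     : ∀ {m} {n : Fun m} → Computable n → Computable (λ w ρ → B (n w ρ))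
    nlᶜ    : ∀ {m} {n c l : Fun m} → Computable n → Computable c → Computable l →
             Computable (λ w ρ → nl w (n w ρ) (c w ρ) (l w ρ))
    nl<L   : ∀ w c l → c < B (length w) → l ≤ suc (suc k₀) → nl w (length w) c l < suc (V₁ (length w)) * 2
    nl-top : ∀ w c → c < B (length w) → nl w (length w) c (suc (suc k₀)) ≡ 1

  Satisfiable : List Bool → Set
  Satisfiable w = ∃[ α ] Clauses.Satisfies k₀ (V₁ (length w)) (B (length w)) (nl w (length w)) α

module Reduction (F : ClauseFamily) where

  open ClauseFamily F

  Memʷ : List Bool → ℕ → ℕ → ℕ → Set
  Memʷ w n = Clauses.Mem k₀ (V₁ n) (B n) (nl w n)

  K₁ : ℕ
  -- The number depends on `k₀` alone, so the other parameters are filled arbitrarily.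
  K₁ = Clauses.K₁ k₀ 0 0 (λ _ _ → 0)

  Lᶜ : ∀ {m} {n : Fun m} → Computable n → Computable (λ w ρ → suc (V₁ (n w ρ)) * 2)
  Lᶜ n = sucᶜ (V₁ᶜ n) *ᶜ constᶜ 2

  Dʷ : ℕ → ℕ
  Dʷ n = suc (V₁ n) * 2 + B n * suc K₁

  Dᶜ : ∀ {m} {n : Fun m} → Computable n → Computable (λ w ρ → Dʷ (n w ρ))
  Dᶜ n = Lᶜ n +ᶜ Bᶜ n *ᶜ constᶜ (suc K₁)

  blockᶜ : ∀ {m} {n z : Fun m} → Computable n → Computable z → Computable (λ w ρ → (z w ρ ∸ suc (V₁ (n w ρ)) * 2) / suc K₁)
  blockᶜ n z = quotᶜ (z ∸ᶜ Lᶜ n) (constᶜ K₁)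

  rankᶜ : ∀ {m} {n z : Fun m} → Computable n → Computable z → Computable (λ w ρ → (z w ρ ∸ suc (V₁ (n w ρ)) * 2) % suc K₁)
  rankᶜ n z = remᶜ (z ∸ᶜ Lᶜ n) (constᶜ K₁)

  memᵈ : ∀ {m} {n z v : Fun m} → Computable n → Computable z → Computable v →
         Definable (λ w ρ → Memʷ w (n w ρ) (z w ρ) (v w ρ))
  memᵈ n z v =
    ((z <ᵈ Lᶜ n) ×ᵈ (v <ᵈ Lᶜ n) ×ᵈ (quotᶜ v oneᶜ ≡ᵈ quotᶜ z oneᶜ)) ⊎ᵈ
    ((Lᶜ n ≤ᵈ z) ×ᵈ (rankᶜ n z ≤ᵈ constᶜ (suc (suc k₀))) ×ᵈ ((v ≡ᵈ z) ⊎ᵈ (v ≡ᵈ nlᶜ n (blockᶜ n z) (rankᶜ n z)))) ⊎ᵈ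
    ((Lᶜ n ≤ᵈ z) ×ᵈ (constᶜ (suc (suc k₀)) <ᵈ rankᶜ n z) ×ᵈ (Lᶜ n ≤ᵈ v) ×ᵈ (blockᶜ n v ≡ᵈ blockᶜ n z))

  abstract

    mem₃ : Definable {3} (λ w ρ → Memʷ w (lookup ρ (suc (suc zero))) (lookup ρ (suc zero)) (lookup ρ zero))
    mem₃ = memᵈ (varᶜ (suc (suc zero))) (varᶜ (suc zero)) (varᶜ zero)

    mem : List Bool → ℕ → ℕ → ℕ → ℕ
    mem w n z v = indicator mem₃ w (v ∷ z ∷ n ∷ [])

    mem-yes : ∀ {w n z v} → Memʷ w n z v → mem w n z v ≡ 1
    mem-yes {w} {n} {z} {v} = indicator-true mem₃ {w} {v ∷ z ∷ n ∷ []}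

    mem-no : ∀ {w n z v} → ¬ Memʷ w n z v → mem w n z v ≡ 0
    mem-no {w} {n} {z} {v} = indicator-false mem₃ {w} {v ∷ z ∷ n ∷ []}

    mem≤1 : ∀ w n z v → mem w n z v ≤ 1
    mem≤1 w n z v = m∸n≤m 1 (1 ∸ eval w (test mem₃) (v ∷ z ∷ n ∷ []))

    -- `mem` is fixed by one test in three variables, while code is generated afresh with arbitrary
    -- codes put in for them. Both tests decide the same relation, so their indicators agree.
    memᶜ : ∀ {m} {n z v : Fun m} → Computable n → Computable z → Computable v →
           Computable (λ w ρ → mem w (n w ρ) (z w ρ) (v w ρ))
    memᶜ {n = n′} {z′} {v′} n z v = castᶜ
      (λ w ρ → indicator-cong (memᵈ n z v) mem₃ {w} {ρ} {v′ w ρ ∷ z′ w ρ ∷ n′ w ρ ∷ []} id id)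
      (indicatorᶜ (memᵈ n z v))

  adj : List Bool → ℕ → ℕ → ℕ → ℕ
  adj w n = Doubling.bipartite (Dʷ n) (mem w n)

  orderʷ : ℕ → ℕ
  orderʷ n = Dʷ n + Dʷ n + Dʷ n

  abstract

    orderᶜ : ∀ {m} {n : Fun m} → Computable n → Computable (λ w ρ → orderʷ (n w ρ))
    orderᶜ n = Dᶜ n +ᶜ Dᶜ n +ᶜ Dᶜ n

    adjᶜ : Computable {3} (λ w ρ → adj w (lookup ρ (suc (suc zero))) (lookup ρ (suc zero)) (lookup ρ zero))
    adjᶜ = castᶜ (λ w ρ → sym (Doubling.bipartite-def (Dʷ (lookup ρ (suc (suc zero)))) (mem w (lookup ρ (suc (suc zero)))) (lookup ρ (suc zero)) (lookup ρ zero)))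
                 (upperᶜ (varᶜ (suc zero)) (varᶜ zero) +ᶜ upperᶜ (varᶜ zero) (varᶜ (suc zero)))
      where
      n : Computable {3} (λ w ρ → lookup ρ (suc (suc zero)))
      n = varᶜ (suc (suc zero))
      D : Computable {3} (λ w ρ → Dʷ (lookup ρ (suc (suc zero))))
      D = Dᶜ n
      upperᶜ : ∀ {u v : Fun 3} → Computable u → Computable v → Computable (λ w ρ →
        let n = lookup ρ (suc (suc zero)) ; D = Dʷ n in
        le (suc (u w ρ)) D * (le D (v w ρ) * le (suc (v w ρ)) (D + D) * mem w n (v w ρ ∸ D) (u w ρ)
                              + le (D + D) (v w ρ) * mem w n (v w ρ ∸ (D + D)) (u w ρ)))
      upperᶜ u v = leᶜ (sucᶜ u) D *ᶜ (leᶜ D v *ᶜ leᶜ (sucᶜ v) (D +ᶜ D) *ᶜ memᶜ n (v ∸ᶜ D) u +ᶜ leᶜ (D +ᶜ D) v *ᶜ memᶜ n (v ∸ᶜ (D +ᶜ D)) u)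

  order₁ : Exp 1
  order₁ = code (orderᶜ (varᶜ zero))

  order₂ : Exp 2
  order₂ = code (orderᶜ (varᶜ (suc zero)))

  reduce : Out 1
  reduce = for order₁ (emit one) ⨟ (emit (one ⊟ one) ⨟ for order₁ (for order₂ (emit (code adjᶜ))))

  reduced : List Bool → List Bool
  reduced w = evalOut w reduce (length w ∷ [])

  module _ (w : List Bool) where

    private
      n = length w
      N = orderʷ n

    open Doubling (Dʷ n) (mem w n) using (bipartite-graph; balanced-rows; rows-balanced; doubled≤1; doubled)

    reduced≡ : reduced w ≡ matrixWord N (λ u v → positive (adj w n u v))
    reduced≡ = cong₂ _++_ (cong (λ m → concatTo m (λ _ → true ∷ [])) (sound (orderᶜ (varᶜ zero)) w (n ∷ [])))
      (cong (false ∷_) (trans (cong (λ m → concatTo m row) (sound (orderᶜ (varᶜ zero)) w (n ∷ [])))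
        (concatTo-cong N λ u _ → trans (cong (λ m → concatTo m (λ v → positive (eval w (code adjᶜ) (v ∷ u ∷ n ∷ [])) ∷ []))
                                             (sound (orderᶜ (varᶜ (suc zero))) w (u ∷ n ∷ [])))
          (concatTo-cong N λ v _ → cong (λ a → positive a ∷ []) (sound adjᶜ w (v ∷ u ∷ n ∷ []))))))
      where
      row : ℕ → List Bool
      row u = concatTo (eval w order₂ (u ∷ n ∷ [])) (λ v → positive (eval w (code adjᶜ) (v ∷ u ∷ n ∷ [])) ∷ [])

    graph : IsGraph N (adj w n)
    graph = bipartite-graph (mem≤1 w n)

    coded-reduced : Coded (reduced w) N (adj w n)
    coded-reduced = subst (λ y → Coded y N (adj w n)) (sym reduced≡) (coded (Coded.total c) (Coded.ones c) (Coded.sep c)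
        λ u v u<N v<N → trans (Coded.cells c u v u<N v<N) (b2n-positive (IsGraph.binary graph u v u<N v<N)))
      where c = coded-matrixWord N (λ u v → positive (adj w n u v))

    open Clauses k₀ (V₁ n) (B n) (nl w n) using (rows⇒solves; solves⇒rows; solves⇒satisfies; assignment; assignment-solves; assignment≤1)

    satisfiable⇒colorable : Satisfiable w → EulerianStrongMajorityColoring 2 (reduced w)
    satisfiable⇒colorable (α , sat) = colorable coded-reduced graph
      (doubled≤1 (assignment≤1 (nl<L w) (nl-top w) (mem w n) mem-yes mem-no α sat))
      (rows-balanced (solves⇒rows (nl<L w) (nl-top w) (mem w n) mem-yes mem-no
        (assignment-solves (nl<L w) (nl-top w) (mem w n) mem-yes mem-no α sat)))

    colorable⇒satisfiable : EulerianStrongMajorityColoring 2 (reduced w) → Satisfiable w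
    colorable⇒satisfiable l with solution l
    ... | n′ , a , c′ , g′ , sol with coded-size-unique c′ coded-reduced
    -- Vertex 0 is the literal false, so the class that misses it is taken as the true variables.
    ...   | refl with sol 0
    ...     | x , x₀ , x≤1 , bal = x , solves⇒satisfies (nl<L w) (nl-top w) (mem w n) mem-yes mem-no x≤1 x₀
                (rows⇒solves (nl<L w) (nl-top w) (mem w n) mem-yes mem-no (balanced-rows bal′))
      where
      same : ∀ u v → u < N → v < N → a u v ≡ adj w n u v
      same = coded-entry-unique c′ coded-reduced
      bal′ : Balanced N (adj w n) x
      bal′ v v<N = trans (sumTo-cong N λ u u<N → sym (same v u v<N u<N))
        (trans (bal v v<N) (cong (2 *_) (sumTo-cong N λ u u<N → cong (_* x u) (same v u v<N u<N))))

  reduction : ∀ {L} → (∀ w → L w ⇔ Satisfiable w) → L ≤ₚ EulerianStrongMajorityColoring 2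
  reduction h = reduced , polyTime reduce , λ w → mk⇔
    (satisfiable⇒colorable w ∘ Equivalence.to (h w)) (Equivalence.from (h w) ∘ colorable⇒satisfiable w)

-- The tableau of a computation

record Finite (A : Set) : Set where
  constructor finite
  field
    elements : List A
    complete : ∀ a → a ∈ elements

open Finite public

module _ {A : Set} where

  -- The number of an element is read off its membership proof. Repetitions in the enumeration do no
  -- harm, since `nth` recovers the element in any case.
  position : ∀ {a : A} {xs} → a ∈ xs → ℕ
  position (here _)  = 0
  position (there p) = suc (position p)

  nth : List A → ℕ → Maybe A
  nth []       _       = nothing
  nth (x ∷ _)  zero    = just x
  nth (_ ∷ xs) (suc i) = nth xs i

  position<length : ∀ {a : A} {xs} (p : a ∈ xs) → position p < length xs
  position<length (here _)  = s≤s z≤n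
  position<length (there p) = s≤s (position<length p)

  nth-position : ∀ {a : A} {xs} (p : a ∈ xs) → nth xs (position p) ≡ just a
  nth-position (here refl) = refl
  nth-position (there p)   = nth-position p

finite-Fin : ∀ n → Finite (Fin n)
finite-Fin n = finite (allFin n) ∈-allFin

finite-⊤ : Finite ⊤
finite-⊤ = finite (tt ∷ []) λ _ → here refl

finite-Bool : Finite Bool
finite-Bool = finite (true ∷ false ∷ []) λ { true → here refl ; false → there (here refl) }

infixr 2 _⊎ᶠ_
infixr 3 _×ᶠ_

_⊎ᶠ_ : ∀ {A B} → Finite A → Finite B → Finite (A ⊎ B)
finite xs p ⊎ᶠ finite ys q = finite (List.map inj₁ xs ++ List.map inj₂ ys)
  λ { (inj₁ a) → ∈-++⁺ˡ (∈-map⁺ inj₁ (p a)) ; (inj₂ b) → ∈-++⁺ʳ (List.map inj₁ xs) (∈-map⁺ inj₂ (q b)) }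

_×ᶠ_ : ∀ {A B} → Finite A → Finite B → Finite (A × B)
finite xs p ×ᶠ finite ys q = finite (List.cartesianProductWith _,_ xs ys) λ (a , b) → ∈-cartesianProductWith⁺ _,_ (p a) (q b)

finite-Vec : ∀ {A} n → Finite A → Finite (Vec A n)
finite-Vec zero    F = finite ([] ∷ []) λ { [] → here refl }
finite-Vec (suc n) F@(finite xs p) with finite-Vec n F
... | finite vs q = finite (List.cartesianProductWith _∷_ xs vs) λ { (a ∷ v) → ∈-cartesianProductWith⁺ _∷_ (p a) (q v) }

finite-onto : ∀ {A B} (f : A → B) → (∀ b → ∃[ a ] f a ≡ b) → Finite A → Finite B
finite-onto f onto (finite xs p) = finite (List.map f xs) λ b →
  let a , e = onto b in subst (_∈ List.map f xs) e (∈-map⁺ f (p a))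

finite-Symbol : ∀ g → Finite (Symbol g)
finite-Symbol g = finite-onto symbol onto (finite-⊤ ⊎ᶠ finite-Bool ⊎ᶠ finite-Fin g)
  where
  symbol : ⊤ ⊎ Bool ⊎ Fin g → Symbol g
  symbol (inj₁ _)        = blank
  symbol (inj₂ (inj₁ b)) = bit b
  symbol (inj₂ (inj₂ i)) = extra i
  onto : ∀ s → ∃[ a ] symbol a ≡ s
  onto blank     = inj₁ tt , refl
  onto (bit b)   = inj₂ (inj₁ b) , refl
  onto (extra i) = inj₂ (inj₂ i) , refl

_≟ˢ_ : ∀ {g} (s z : Symbol g) → Dec (s ≡ z)
blank   ≟ˢ blank   = yes refl
blank   ≟ˢ bit _   = no λ ()
blank   ≟ˢ extra _ = no λ ()
bit _   ≟ˢ blank   = no λ ()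
bit a   ≟ˢ bit b   = map′ (cong bit) (λ { refl → refl }) (a Bool.≟ b)
bit _   ≟ˢ extra _ = no λ ()
extra _ ≟ˢ blank   = no λ ()
extra _ ≟ˢ bit _   = no λ ()
extra i ≟ˢ extra j = map′ (cong extra) (λ { refl → refl }) (i Fin.≟ j)

-- Tape cells addressed from the head

data Side : Set where
  lft rgt : Side

finite-Side : Finite Side
finite-Side = finite (lft ∷ rgt ∷ []) λ { lft → here refl ; rgt → there (here refl) }

-- Cells are addressed relative to the head, which is cell 0 on the right.
cellAt : ∀ {g} → Side → Tape g → ℕ → Symbol g
cellAt lft t j       = at (Tape.lefts t) j
cellAt rgt t zero    = Tape.head t
cellAt rgt t (suc j) = at (Tape.rights t) j

-- A cell address in a clause scheme, absolute or relative to the place j for which the scheme is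
-- instantiated. A move changes addresses by one, so constants below 3 are enough.
data Offset : Set where
  fixed shifted : Fin 3 → Offset

offset : Offset → ℕ → ℕ
offset (fixed k)   j = toℕ k
offset (shifted k) j = toℕ k + j

offset≤ : ∀ o j → offset o j ≤ 2 + j
offset≤ (fixed k)   j = ≤-trans (s≤s⁻¹ (Finₚ.toℕ<n k)) (m≤m+n 2 j)
offset≤ (shifted k) j = +-monoˡ-≤ j (s≤s⁻¹ (Finₚ.toℕ<n k))

Place : Set
Place = Side × Offset

-- The address of the cell just written, seen from the head after the move.
writtenPlace : Move → Side × Fin 3
writtenPlace stay  = rgt , zero
writtenPlace right = lft , zero
writtenPlace left  = rgt , suc zero

-- The third way of copying is needed for left moves only.
copiedPlaces : Move → Fin 3 → Place × Place
copiedPlaces stay  zero             = (rgt , shifted (suc zero)) , (rgt , shifted (suc zero))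
copiedPlaces stay  (suc _)          = (lft , shifted zero) , (lft , shifted zero)
copiedPlaces right zero             = (rgt , shifted (suc zero)) , (rgt , shifted zero)
copiedPlaces right (suc _)          = (lft , shifted zero) , (lft , shifted (suc zero))
copiedPlaces left  zero             = (rgt , shifted (suc zero)) , (rgt , shifted (suc (suc zero)))
copiedPlaces left  (suc zero)       = (lft , fixed zero)   , (rgt , fixed zero)
copiedPlaces left  (suc (suc zero)) = (lft , shifted (suc zero)) , (lft , shifted zero)

module _ {g : ℕ} where

  at-place : Place → ℕ → Tape g → Symbol g
  at-place (s , o) j t = cellAt s t (offset o j)

  written-cell : ∀ s m (t : Tape g) → cellAt (proj₁ (writtenPlace m)) (act (s , m) t) (toℕ (proj₂ (writtenPlace m))) ≡ s
  written-cell s stay  t                    = refl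
  written-cell s right (tape ls h [])       = refl
  written-cell s right (tape ls h (r ∷ rs)) = refl
  written-cell s left  (tape [] h rs)       = refl
  written-cell s left  (tape (l ∷ ls) h rs) = refl

  copied-cell : ∀ s m i j (t : Tape g) → let src , dst = copiedPlaces m i in
                at-place dst j (act (s , m) t) ≡ at-place src j t
  copied-cell s stay  zero             j       t                    = refl
  copied-cell s stay  (suc _)          j       t                    = refl
  copied-cell s right zero             zero    (tape ls h [])       = refl
  copied-cell s right zero             (suc j) (tape ls h [])       = refl
  copied-cell s right zero             zero    (tape ls h (r ∷ rs)) = refl
  copied-cell s right zero             (suc j) (tape ls h (r ∷ rs)) = refl
  copied-cell s right (suc _)          j       (tape ls h [])       = refl
  copied-cell s right (suc _)          j       (tape ls h (r ∷ rs)) = refl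
  copied-cell s left  zero             j       (tape [] h rs)       = refl
  copied-cell s left  zero             j       (tape (l ∷ ls) h rs) = refl
  copied-cell s left  (suc zero)       j       (tape [] h rs)       = refl
  copied-cell s left  (suc zero)       j       (tape (l ∷ ls) h rs) = refl
  copied-cell s left  (suc (suc zero)) j       (tape [] h rs)       = refl
  copied-cell s left  (suc (suc zero)) j       (tape (l ∷ ls) h rs) = refl

-- Every cell after a step has a cause before it. By the first bound the cell at distance k comes
-- from distance at most k + 1, so a window of known cells shrinks by at most one per step; the
-- second bound keeps the parameter j of the clause in range.
data Origin (m : Move) : Side → ℕ → Set where
  was-written : Origin m (proj₁ (writtenPlace m)) (toℕ (proj₂ (writtenPlace m)))
  was-copied  : ∀ i j → let (_ , src) , (side , dst) = copiedPlaces m i in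
                offset src j ≤ suc (offset dst j) → j ≤ offset dst j → Origin m side (offset dst j)

origin : ∀ m side k → Origin m side k
origin stay  rgt zero          = was-written
origin stay  rgt (suc j)       = was-copied zero j (n≤1+n _) (n≤1+n j)
origin stay  lft j             = was-copied (suc zero) j (n≤1+n j) ≤-refl
origin right rgt j             = was-copied zero j ≤-refl ≤-refl
origin right lft zero          = was-written
origin right lft (suc j)       = was-copied (suc zero) j (≤-trans (n≤1+n j) (n≤1+n _)) (n≤1+n j)
origin left  rgt zero          = was-copied (suc zero) 0 z≤n z≤n
origin left  rgt (suc zero)    = was-written
origin left  rgt (suc (suc j)) = was-copied zero j (≤-trans (n≤1+n _) (n≤1+n _)) (≤-trans (n≤1+n j) (n≤1+n _))
origin left  lft j             = was-copied (suc (suc zero)) j ≤-refl ≤-refl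

ifz : ℕ → ℕ → ℕ → ℕ
ifz zero    a b = a
ifz (suc _) a b = b

ifzᶜ : ∀ {m} {i f g : Fun m} → Computable i → Computable f → Computable g → Computable (λ w ρ → ifz (i w ρ) (f w ρ) (g w ρ))
ifzᶜ {i = i} {f} {g} c d e = castᶜ (λ w ρ → arith (i w ρ) (f w ρ) (g w ρ)) ((oneᶜ ∸ᶜ c) *ᶜ d +ᶜ (oneᶜ ∸ᶜ (oneᶜ ∸ᶜ c)) *ᶜ e)
  where
  arith : ∀ i a b → (1 ∸ i) * a + (1 ∸ (1 ∸ i)) * b ≡ ifz i a b
  arith zero    a b = trans (+-identityʳ (a + 0)) (+-identityʳ a)
  arith (suc i) a b rewrite 0∸n≡0 i = +-identityʳ b

-- The bits of ⟨ w , u ⟩ up to position 2 |w| do not depend on u.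
prefixBit : List Bool → ℕ → ℕ → ℕ
prefixBit w n j = ifz (j % 2) (le (suc j) (n * 2)) (bitAt w (j / 2))

-- The clauses that describe a computation

module Tableau (M : TM) (p q : Poly) where

  open TM M using (workTapes; extraSymbols; states; start; tapes; Γ; δ; Config)

  data Atom : Set where
    inState : Fin states → Atom
    inCell  : Side → Fin tapes → Γ → Atom

  -- Conditions settled by the input, the time and the place. They become the constant literals 0
  -- and 1, so a fixed finite list of schemes can be instantiated everywhere: where a guard fails,
  -- the instance is vacuous.
  data Guard : Set where
    atStart inCertificate pastCertificate never : Guard
    inPrefix : Bool → Guard

  data When : Set where
    now later : When

  delay : When → ℕ → ℕ
  delay now   t = t
  delay later t = suc t

  data Lit : Set where
    given     : Guard → Lit
    is is-not : When → Offset → Atom → Lit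

  -- Clauses are instantiated for all times t and all places j; each of them says that its literals are not all true.
  data Clause : Set where
    startState                    : Clause
    leftBlank                     : Fin tapes → Clause
    rightBlank                    : Fin workTapes → Clause
    prefix                        : Bool → Clause
    someSymbol blankTail pastEnd  : Clause
    moveState                     : Fin states → Vec Γ tapes → Clause
    written                       : Fin states → Vec Γ tapes → Fin tapes → Clause
    copied                        : Fin states → Vec Γ tapes → Fin tapes → Fin 3 → Γ → Clause

  here₀ this : Offset
  here₀ = fixed zero
  this  = shifted zero

  premises : Fin states → Vec Γ tapes → List Lit
  premises s h = is now here₀ (inState s) ∷ List.tabulate (λ i → is now here₀ (inCell rgt i (lookup h i)))

  Action : Set
  Action = Maybe (Fin states × Vec (Γ × Move) tapes)

  -- For a halt on the symbol false the clause consists of its premises only and so forbids the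
  -- situation. Any other halt adds a false literal, which makes the clause vacuous.
  rejecting : Γ → List Lit
  rejecting (bit false) = []
  rejecting _           = given never ∷ []

  newState : Γ → Action → List Lit
  newState h₀ nothing        = rejecting h₀
  newState h₀ (just (s , _)) = is-not later here₀ (inState s) ∷ []

  newCell : Fin tapes → Action → List Lit
  newCell i nothing         = given never ∷ []
  newCell i (just (_ , as)) =
    is-not later (fixed (proj₂ (writtenPlace m))) (inCell (proj₁ (writtenPlace m)) i (proj₁ (lookup as i))) ∷ []
    where m = proj₂ (lookup as i)

  oldCell : Fin tapes → Fin 3 → Γ → Action → List Lit
  oldCell i r z nothing         = given never ∷ []
  oldCell i r z (just (_ , as)) =
    is now (proj₂ (proj₁ places)) (inCell (proj₁ (proj₁ places)) i z) ∷
    is-not later (proj₂ (proj₂ places)) (inCell (proj₁ (proj₂ places)) i z) ∷ []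
    where places = copiedPlaces (proj₂ (lookup as i)) r

  literals : Clause → List Lit
  literals startState        = given atStart ∷ is-not now here₀ (inState start) ∷ []
  literals (leftBlank i)     = given atStart ∷ is-not now this (inCell lft i blank) ∷ []
  literals (rightBlank i)    = given atStart ∷ is-not now this (inCell rgt (suc i) blank) ∷ []
  literals (prefix b)        = given (inPrefix b) ∷ is-not now this (inCell rgt zero (bit b)) ∷ []
  -- The certificate is the only part of the start configuration left open. These three schemes
  -- demand bits followed by blanks, and nothing but blanks beyond the length bound.
  literals someSymbol        = given inCertificate ∷ is-not now this (inCell rgt zero (bit true)) ∷
                               is-not now this (inCell rgt zero (bit false)) ∷ is-not now this (inCell rgt zero blank) ∷ []
  literals blankTail         = given inCertificate ∷ is now this (inCell rgt zero blank) ∷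
                               is-not now (shifted (suc zero)) (inCell rgt zero blank) ∷ []
  literals pastEnd           = given pastCertificate ∷ is-not now this (inCell rgt zero blank) ∷ []
  literals (moveState s h)   = newState (Vec.head h) (δ s h) ++ premises s h
  literals (written s h i)   = newCell i (δ s h) ++ premises s h
  literals (copied s h i r z) = oldCell i r z (δ s h) ++ premises s h

  abstract

    finite-Γ : Finite Γ
    finite-Γ = finite-Symbol extraSymbols

    finite-Atom : Finite Atom
    finite-Atom = finite-onto [ inState , (λ (s , i , z) → inCell s i z) ]′
      (λ { (inState s) → inj₁ s , refl ; (inCell s i z) → inj₂ (s , i , z) , refl })
      (finite-Fin states ⊎ᶠ (finite-Side ×ᶠ finite-Fin tapes ×ᶠ finite-Γ))

    finite-Clause : Finite Clause
    finite-Clause = finite (single ++ lefts ++ rights ++ prefixes ++ moveds ++ writtens ++ copieds) λ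
      { startState           → ∈-++⁺ˡ {xs = single} (here refl)
      ; someSymbol           → ∈-++⁺ˡ {xs = single} (there (here refl))
      ; blankTail            → ∈-++⁺ˡ {xs = single} (there (there (here refl)))
      ; pastEnd              → ∈-++⁺ˡ {xs = single} (there (there (there (here refl))))
      ; (leftBlank i)        → ∈-++⁺ʳ single (∈-++⁺ˡ (∈-map⁺ leftBlank (∈-allFin i)))
      ; (rightBlank i)       → ∈-++⁺ʳ single (∈-++⁺ʳ lefts (∈-++⁺ˡ (∈-map⁺ rightBlank (∈-allFin i))))
      ; (prefix b)           → ∈-++⁺ʳ single (∈-++⁺ʳ lefts (∈-++⁺ʳ rights (∈-++⁺ˡ (∈-map⁺ prefix (complete finite-Bool b)))))
      ; (moveState s h)      → ∈-++⁺ʳ single (∈-++⁺ʳ lefts (∈-++⁺ʳ rights (∈-++⁺ʳ prefixes (∈-++⁺ˡ (∈-map⁺ moved (complete situations (s , h)))))))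
      ; (written s h i)      → ∈-++⁺ʳ single (∈-++⁺ʳ lefts (∈-++⁺ʳ rights (∈-++⁺ʳ prefixes (∈-++⁺ʳ moveds (∈-++⁺ˡ
                                 (∈-map⁺ wrote (complete (situations ×ᶠ finite-Fin tapes) ((s , h) , i))))))))
      ; (copied s h i r z)   → ∈-++⁺ʳ single (∈-++⁺ʳ lefts (∈-++⁺ʳ rights (∈-++⁺ʳ prefixes (∈-++⁺ʳ moveds (∈-++⁺ʳ writtens
                                 (∈-map⁺ copy′ (complete (situations ×ᶠ finite-Fin tapes ×ᶠ finite-Fin 3 ×ᶠ finite-Γ) ((s , h) , i , r , z))))))))
      }
      where
      Situation : Set
      Situation = Fin states × Vec Γ tapes
      situations : Finite Situation
      situations = finite-Fin states ×ᶠ finite-Vec tapes finite-Γ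
      moved : Situation → Clause
      moved (s , h) = moveState s h
      wrote : Situation × Fin tapes → Clause
      wrote ((s , h) , i) = written s h i
      copy′ : Situation × Fin tapes × Fin 3 × Γ → Clause
      copy′ ((s , h) , i , r , z) = copied s h i r z
      single lefts rights prefixes moveds writtens copieds : List Clause
      single   = startState ∷ someSymbol ∷ blankTail ∷ pastEnd ∷ []
      lefts    = List.map leftBlank (allFin tapes)
      rights   = List.map rightBlank (allFin workTapes)
      prefixes = List.map prefix (elements finite-Bool)
      moveds   = List.map moved (elements situations)
      writtens = List.map wrote (elements (situations ×ᶠ finite-Fin tapes))
      copieds  = List.map copy′ (elements (situations ×ᶠ finite-Fin tapes ×ᶠ finite-Fin 3 ×ᶠ finite-Γ))

  -- n is the length of the input; W₁ n bounds the running time on inputs paired with a certificate.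
  W₁ S₁ V₁ B : ℕ → ℕ
  W₁ n = ⟦ p ⟧ (suc (n * 2 + ⟦ q ⟧ n))

  -- Bounds every cell address: j is at most `W₁ n`, and an offset adds at most 2.
  S₁ n = suc (suc (suc (W₁ n)))

  A₁ C₁ : ℕ
  A₁ = length (elements finite-Atom)
  C₁ = length (elements finite-Clause)

  -- One time more than in `B`, since `later` refers to the time after t. The radices are successors
  -- because they serve as divisors; as a result some clause numbers belong to no clause.
  V₁ n = suc (suc (W₁ n)) * suc (S₁ n) * suc A₁
  B n  = suc (W₁ n) * suc (W₁ n) * suc C₁

  atomIndex : Atom → ℕ
  atomIndex a = position (complete finite-Atom a)

  clauseIndex : Clause → ℕ
  clauseIndex κ = position (complete finite-Clause κ)

  variableIndex : ℕ → ℕ → ℕ → Atom → ℕ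
  variableIndex n t k a = (t * suc (S₁ n) + k) * suc A₁ + atomIndex a

  GuardHolds : Guard → List Bool → ℕ → ℕ → ℕ → Set
  GuardHolds atStart         w n t j = t ≡ 0
  GuardHolds inCertificate   w n t j = t ≡ 0 × n * 2 < j
  GuardHolds pastCertificate w n t j = t ≡ 0 × n * 2 + ⟦ q ⟧ n < j
  GuardHolds never           w n t j = 0 ≡ 1
  GuardHolds (inPrefix b)    w n t j = t ≡ 0 × j ≤ n * 2 × prefixBit w n j ≡ b2n b

  guardᵈ : ∀ {m} γ {n t j : Fun m} → Computable n → Computable t → Computable j →
           Definable (λ w ρ → GuardHolds γ w (n w ρ) (t w ρ) (j w ρ))
  guardᵈ atStart         n t j = t ≡ᵈ constᶜ 0
  guardᵈ inCertificate   n t j = (t ≡ᵈ constᶜ 0) ×ᵈ (n *ᶜ constᶜ 2 <ᵈ j)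
  guardᵈ pastCertificate n t j = (t ≡ᵈ constᶜ 0) ×ᵈ (n *ᶜ constᶜ 2 +ᶜ polyᶜ q n <ᵈ j)
  guardᵈ never           n t j = constᶜ 0 ≡ᵈ constᶜ 1
  guardᵈ (inPrefix b)    n t j = (t ≡ᵈ constᶜ 0) ×ᵈ (j ≤ᵈ n *ᶜ constᶜ 2) ×ᵈ
    (ifzᶜ (remᶜ j oneᶜ) (leᶜ (sucᶜ j) (n *ᶜ constᶜ 2)) (inputᶜ (quotᶜ j oneᶜ)) ≡ᵈ constᶜ (b2n b))

  abstract

    guard₃ : ∀ γ → Definable {3} (λ w ρ → GuardHolds γ w (lookup ρ zero) (lookup ρ (suc zero)) (lookup ρ (suc (suc zero))))
    guard₃ γ = guardᵈ γ (varᶜ zero) (varᶜ (suc zero)) (varᶜ (suc (suc zero)))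

    guardValue : Guard → List Bool → ℕ → ℕ → ℕ → ℕ
    guardValue γ w n t j = indicator (guard₃ γ) w (n ∷ t ∷ j ∷ [])

    guardᶜ : ∀ {m} γ {n t j : Fun m} → Computable n → Computable t → Computable j →
             Computable (λ w ρ → guardValue γ w (n w ρ) (t w ρ) (j w ρ))
    guardᶜ γ {n′} {t′} {j′} n t j = castᶜ
      (λ w ρ → indicator-cong (guardᵈ γ n t j) (guard₃ γ) {w} {ρ} {n′ w ρ ∷ t′ w ρ ∷ j′ w ρ ∷ []} id id)
      (indicatorᶜ (guardᵈ γ n t j))

    guard-true : ∀ γ {w n t j} → GuardHolds γ w n t j → guardValue γ w n t j ≡ 1
    guard-true γ {w} {n} {t} {j} = indicator-true (guard₃ γ) {w} {n ∷ t ∷ j ∷ []}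

    guard-holds : ∀ γ {w n t j} → guardValue γ w n t j ≡ 1 → GuardHolds γ w n t j
    guard-holds γ {w} {n} {t} {j} = indicator-holds (guard₃ γ) {w} {n ∷ t ∷ j ∷ []}

    guard≤1 : ∀ γ w n t j → guardValue γ w n t j ≤ 1
    guard≤1 γ w n t j = m∸n≤m 1 (1 ∸ eval w (test (guard₃ γ)) (n ∷ t ∷ j ∷ []))

  -- Variables are shifted by one, since the codes 0 and 1 are the constants that the guards
  -- evaluate to.
  litCode : List Bool → ℕ → ℕ → ℕ → Lit → ℕ
  litCode w n t j (given γ)      = guardValue γ w n t j
  litCode w n t j (is τ o a)     = suc (variableIndex n (delay τ t) (offset o j) a) * 2
  litCode w n t j (is-not τ o a) = suc (suc (variableIndex n (delay τ t) (offset o j) a) * 2)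

  -- Past the end the literal is 1, which is neutral in the demand that not all literals be true.
  -- This brings all clauses to one common length.
  select : List Bool → ℕ → ℕ → ℕ → List Lit → ℕ → ℕ
  select w n t j []       l       = 1
  select w n t j (x ∷ xs) zero    = litCode w n t j x
  select w n t j (x ∷ xs) (suc l) = select w n t j xs l

  -- A number that belongs to no clause gets the false literal `never` and so demands nothing.
  clauseAt : List Clause → ℕ → List Lit
  clauseAt κs i = maybe literals (given never ∷ []) (nth κs i)

  timeOf placeOf : ℕ → ℕ → ℕ
  timeOf  n c = c / suc C₁ / suc (W₁ n)
  placeOf n c = c / suc C₁ % suc (W₁ n)

  kindOf : ℕ → ℕ
  kindOf c = c % suc C₁

  nl : List Bool → ℕ → ℕ → ℕ → ℕ
  nl w n c l = select w n (timeOf n c) (placeOf n c) (clauseAt (elements finite-Clause) (kindOf c)) l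

  width : List Clause → ℕ
  width []       = 1
  width (κ ∷ κs) = length (literals κ) ⊔ width κs

  k₀ : ℕ
  k₀ = width (elements finite-Clause)

  length-clauseAt : ∀ κs i → length (clauseAt κs i) ≤ width κs
  length-clauseAt []       i       = ≤-refl
  length-clauseAt (κ ∷ κs) zero    = m≤m⊔n _ (width κs)
  length-clauseAt (κ ∷ κs) (suc i) = ≤-trans (length-clauseAt κs i) (m≤n⊔m (length (literals κ)) _)

  select-end : ∀ w n t j xs {l} → length xs ≤ l → select w n t j xs l ≡ 1
  select-end w n t j []       _       = refl
  select-end w n t j (x ∷ xs) (s≤s h) = select-end w n t j xs h

  variable<V₁ : ∀ n {t k} a → t ≤ suc (W₁ n) → k ≤ S₁ n → variableIndex n t k a < V₁ n
  variable<V₁ n a t≤ k≤ = position< (position< (s≤s t≤) (s≤s k≤)) (m≤n⇒m≤1+n (position<length (complete finite-Atom a)))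

  lit-variable : ∀ n {t j} τ o a → t < suc (W₁ n) → j < suc (W₁ n) → variableIndex n (delay τ t) (offset o j) a < V₁ n
  lit-variable n {t} {j} τ o a t< j< = variable<V₁ n a (delay≤ τ) (≤-trans (offset≤ o j) (s≤s (s≤s (≤-trans (s≤s⁻¹ j<) (n≤1+n (W₁ n))))))
    where
    delay≤ : ∀ τ → delay τ t ≤ suc (W₁ n)
    delay≤ now   = <⇒≤ t<
    delay≤ later = t<

  code< : ∀ {v V} → v < V → suc (suc v * 2) < suc V * 2
  code< {v} {V} v<V = *-monoˡ-≤ 2 (s≤s v<V)

  litCode< : ∀ w n {t j} x → t < suc (W₁ n) → j < suc (W₁ n) → litCode w n t j x < suc (V₁ n) * 2
  litCode< w n {t} {j} (given γ) t< j< = ≤-trans (s≤s (guard≤1 γ w n t j)) (s≤s (s≤s z≤n))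
  litCode< w n (is τ o a)     t< j< = <-trans (n<1+n _) (code< (lit-variable n τ o a t< j<))
  litCode< w n (is-not τ o a) t< j< = code< (lit-variable n τ o a t< j<)

  select< : ∀ w n {t j} xs l → t < suc (W₁ n) → j < suc (W₁ n) → select w n t j xs l < suc (V₁ n) * 2
  select< w n []       l       t< j< = s≤s (s≤s z≤n)
  select< w n (x ∷ xs) zero    t< j< = litCode< w n x t< j<
  select< w n (x ∷ xs) (suc l) t< j< = select< w n xs l t< j<

  time< : ∀ n {c} → c < B n → timeOf n c < suc (W₁ n)
  time< n c<B = m<n*o⇒m/o<n (m<n*o⇒m/o<n c<B)

  place< : ∀ n c → placeOf n c < suc (W₁ n)
  place< n c = m%n<n (c / suc C₁) (suc (W₁ n))

  W₁ᶜ : ∀ {m} {n : Fun m} → Computable n → Computable (λ w ρ → W₁ (n w ρ))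
  W₁ᶜ n = polyᶜ p (sucᶜ (n *ᶜ constᶜ 2 +ᶜ polyᶜ q n))

  S₁ᶜ : ∀ {m} {n : Fun m} → Computable n → Computable (λ w ρ → S₁ (n w ρ))
  S₁ᶜ n = sucᶜ (sucᶜ (sucᶜ (W₁ᶜ n)))

  offsetᶜ : ∀ {m} o {j : Fun m} → Computable j → Computable (λ w ρ → offset o (j w ρ))
  offsetᶜ (fixed k)   j = constᶜ (toℕ k)
  offsetᶜ (shifted k) j = constᶜ (toℕ k) +ᶜ j

  delayᶜ : ∀ {m} τ {t : Fun m} → Computable t → Computable (λ w ρ → delay τ (t w ρ))
  delayᶜ now   t = t
  delayᶜ later t = sucᶜ t

  variableᶜ : ∀ {m} {n t k : Fun m} a → Computable n → Computable t → Computable k →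
              Computable (λ w ρ → variableIndex (n w ρ) (t w ρ) (k w ρ) a)
  variableᶜ a n t k = (t *ᶜ sucᶜ (S₁ᶜ n) +ᶜ k) *ᶜ constᶜ (suc A₁) +ᶜ constᶜ (atomIndex a)

  litᶜ : ∀ {m} {n t j : Fun m} x → Computable n → Computable t → Computable j →
         Computable (λ w ρ → litCode w (n w ρ) (t w ρ) (j w ρ) x)
  litᶜ (given γ)      n t j = guardᶜ γ n t j
  litᶜ (is τ o a)     n t j = sucᶜ (variableᶜ a n (delayᶜ τ t) (offsetᶜ o j)) *ᶜ constᶜ 2
  litᶜ (is-not τ o a) n t j = sucᶜ (sucᶜ (variableᶜ a n (delayᶜ τ t) (offsetᶜ o j)) *ᶜ constᶜ 2)

  selectᶜ : ∀ {m} {n t j l : Fun m} xs → Computable n → Computable t → Computable j → Computable l →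
            Computable (λ w ρ → select w (n w ρ) (t w ρ) (j w ρ) xs (l w ρ))
  selectᶜ []       n t j l = oneᶜ
  selectᶜ {n = n′} {t′} {j′} {l′} (x ∷ xs) n t j l =
    castᶜ (λ w ρ → cases w (n′ w ρ) (t′ w ρ) (j′ w ρ) (l′ w ρ)) (ifzᶜ l (litᶜ x n t j) (selectᶜ xs n t j (l ∸ᶜ oneᶜ)))
    where
    cases : ∀ w n t j l → ifz l (litCode w n t j x) (select w n t j xs (l ∸ 1)) ≡ select w n t j (x ∷ xs) l
    cases w n t j zero    = refl
    cases w n t j (suc l) = refl

  pickᶜ : ∀ {m} {n t j i l : Fun m} κs → Computable n → Computable t → Computable j → Computable i → Computable l →
          Computable (λ w ρ → select w (n w ρ) (t w ρ) (j w ρ) (clauseAt κs (i w ρ)) (l w ρ))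
  pickᶜ []       n t j i l = selectᶜ (given never ∷ []) n t j l
  pickᶜ {n = n′} {t′} {j′} {i′} {l′} (κ ∷ κs) n t j i l =
    castᶜ (λ w ρ → cases w (n′ w ρ) (t′ w ρ) (j′ w ρ) (i′ w ρ) (l′ w ρ)) (ifzᶜ i (selectᶜ (literals κ) n t j l) (pickᶜ κs n t j (i ∸ᶜ oneᶜ) l))
    where
    cases : ∀ w n t j i l → ifz i (select w n t j (literals κ) l) (select w n t j (clauseAt κs (i ∸ 1)) l)
                            ≡ select w n t j (clauseAt (κ ∷ κs) i) l
    cases w n t j zero    l = refl
    cases w n t j (suc i) l = refl

  family : ClauseFamily
  family = record
    { k₀     = k₀
    ; V₁     = V₁
    ; B      = B
    ; nl     = nl
    ; V₁ᶜ    = λ n → sucᶜ (sucᶜ (W₁ᶜ n)) *ᶜ sucᶜ (S₁ᶜ n) *ᶜ constᶜ (suc A₁)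
    ; Bᶜ     = λ n → sucᶜ (W₁ᶜ n) *ᶜ sucᶜ (W₁ᶜ n) *ᶜ constᶜ (suc C₁)
    ; nlᶜ    = λ n c l → pickᶜ (elements finite-Clause) n
                 (quotᶜ (quotᶜ c (constᶜ C₁)) (W₁ᶜ n)) (remᶜ (quotᶜ c (constᶜ C₁)) (W₁ᶜ n)) (remᶜ c (constᶜ C₁)) l
    ; nl<L   = λ w c l c<B _ → select< w (length w) (clauseAt (elements finite-Clause) (kindOf c)) l (time< (length w) c<B) (place< (length w) c)
    -- `k₀` is the greatest length of a clause, so index k₀ + 2 lies past the end of each and reads
    -- 1, as the constant in the block requires.
    ; nl-top = λ w c _ → select-end w (length w) (timeOf (length w) c) (placeOf (length w) c)
                 (clauseAt (elements finite-Clause) (kindOf c))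
                 (≤-trans (length-clauseAt (elements finite-Clause) (kindOf c)) (m≤n+m k₀ 2))
    }

  module _ (w : List Bool) where

    private
      n W : ℕ
      n = length w
      W = suc (W₁ n)

    Holds : (ℕ → ℕ) → ℕ → ℕ → Lit → Set
    Holds α t j x = α (litCode w n t j x) ≡ 1

    -- `Satisfies` with the padding and the numbering of clauses undone.
    record Model (α : ℕ → ℕ) : Set where
      field
        binary   : ∀ v → v < suc (V₁ n) * 2 → α v ≤ 1
        false₀   : α 0 ≡ 0
        opposite : ∀ i → i < suc (V₁ n) → α (i * 2) + α (suc (i * 2)) ≡ 1
        obeys    : ∀ κ t j → t < W → j < W → ¬ All (Holds α t j) (literals κ)

    satisfiable⇒model : ClauseFamily.Satisfiable family w → ∃[ α ] Model α
    satisfiable⇒model (α , sat) = α , record { binary = binary ; false₀ = false₀ ; opposite = literals′ ; obeys = obey }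
      where
      open Clauses.Satisfies sat renaming (literals to literals′; clauses to clauses′)
      α₁ : α 1 ≡ 1
      α₁ = trans (cong (_+ α 1) (sym false₀)) (literals′ 0 (s≤s z≤n))
      selected : ∀ {t j} xs l → All (Holds α t j) xs → α (select w n t j xs l) ≡ 1
      selected []       l       _        = α₁
      selected (x ∷ xs) zero    (h ∷ _)  = h
      selected (x ∷ xs) (suc l) (_ ∷ hs) = selected xs l hs
      obey : ∀ κ t j → t < W → j < W → ¬ All (Holds α t j) (literals κ)
      obey κ t j t<W j<W hs = contradiction (trans (sym (selected (literals κ) l hs)) (subst (λ y → α y ≡ 0) nl≡ e)) λ ()
        where
        κs = elements finite-Clause
        i = clauseIndex κ
        c = (t * W + j) * suc C₁ + i
        i<C : i < suc C₁
        i<C = m≤n⇒m≤1+n (position<length (complete finite-Clause κ))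
        violated = clauses′ c (position< (position< t<W j<W) i<C)
        l = proj₁ violated
        e = proj₂ (proj₂ violated)
        q≡ : c / suc C₁ ≡ t * W + j
        q≡ = quotient≡ (t * W + j) i C₁ i<C
        nl≡ : nl w n c l ≡ select w n t j (literals κ) l
        nl≡ = trans (cong (λ i → select w n (timeOf n c) (placeOf n c) (clauseAt κs i) l) (remainder≡ (t * W + j) i C₁ i<C))
          (trans (cong₂ (λ t j → select w n t j (clauseAt κs i) l)
                        (trans (cong (_/ suc (W₁ n)) q≡) (quotient≡ t j (W₁ n) j<W)) (trans (cong (_% suc (W₁ n)) q≡) (remainder≡ t j (W₁ n) j<W)))
                 (cong (λ r → select w n t j (maybe literals (given never ∷ []) r) l) (nth-position (complete finite-Clause κ))))

    model⇒satisfiable : ∀ {α} → Model α → ClauseFamily.Satisfiable family w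
    model⇒satisfiable {α} m = α , record { binary = binary ; false₀ = false₀ ; literals = opposite ; clauses = clause }
      where
      open Model m
      find : ∀ {t j} xs → t < W → j < W → ¬ All (Holds α t j) xs → ∃[ l ] (l < length xs × α (select w n t j xs l) ≡ 0)
      find []       t< j< no-all = contradiction [] no-all
      find {t} {j} (x ∷ xs) t< j< no-all with α (litCode w n t j x) in eq | binary (litCode w n t j x) (litCode< w n x t< j<)
      ... | zero  | _ = 0 , s≤s z≤n , eq
      ... | suc zero | _ with find xs t< j< (λ hs → no-all (eq ∷ hs))
      ...   | l , l< , e = suc l , s≤s l< , e
      find (x ∷ xs) t< j< no-all | suc (suc _) | s≤s ()
      violated : ∀ r t j → t < W → j < W → ¬ All (Holds α t j) (maybe literals (given never ∷ []) r)
      violated (just κ) t j t< j< hs = obeys κ t j t< j< hs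
      violated nothing  t j t< j< (h ∷ _) with guardValue never w n t j in eq | guard≤1 never w n t j
      ... | zero     | _ = contradiction (trans (sym false₀) h) λ ()
      ... | suc zero | _ = contradiction (guard-holds never eq) λ ()
      violated nothing t j t< j< (h ∷ _) | suc (suc _) | s≤s ()
      clause : ∀ c → c < B n → ∃[ l ] (l < suc (suc k₀) × α (nl w n c l) ≡ 0)
      clause c c<B with find (clauseAt (elements finite-Clause) (kindOf c)) (time< n c<B) (place< n c)
                             (violated (nth (elements finite-Clause) (kindOf c)) _ _ (time< n c<B) (place< n c))
      ... | l , l< , e = l , ≤-trans l< (≤-trans (length-clauseAt (elements finite-Clause) (kindOf c)) (m≤n+m k₀ 2)) , e

-- From a model to an accepted certificate

at-map-bit : ∀ {g} w i → i < length w → at {g} (List.map bit w) i ≡ bit (positive (bitAt w i))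
at-map-bit (true ∷ w)  zero    _       = refl
at-map-bit (false ∷ w) zero    _       = refl
at-map-bit (true ∷ w)  (suc i) (s≤s h) = at-map-bit w i h
at-map-bit (false ∷ w) (suc i) (s≤s h) = at-map-bit w i h

at-map-pair : ∀ {g} x u j → at {g} (List.map bit ⟨ x , u ⟩) (suc (length x * 2 + j)) ≡ at (List.map bit u) j
at-map-pair []      u j = refl
at-map-pair (b ∷ x) u j = at-map-pair x u j

-- Even positions hold flags, 1 before the separator at `length x * 2` and 0 there; odd positions
-- hold the bits of x.
prefixBit-pair : ∀ x u j → j ≤ length x * 2 → prefixBit x (length x) j ≡ bitAt ⟨ x , u ⟩ j
prefixBit-pair x u j j≤ with j % 2 | m%n<n j 2 | divide j 1
... | suc zero | _ | d = trans (sym (pair-bit x u h<)) (cong (bitAt ⟨ x , u ⟩) (sym (trans d (+-comm _ 1))))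
  where
  h< : j / 2 < length x
  h< = *-cancelʳ-< 2 (j / 2) (length x) (≤-trans (≤-reflexive (sym (trans d (+-comm _ 1)))) j≤)
... | suc (suc _) | s≤s (s≤s ()) | _
... | zero | _ | d with m≤n⇒m<n∨m≡n j≤
...   | inj₁ j< = trans (le-true j<) (sym (trans (cong (bitAt ⟨ x , u ⟩) (trans d (+-identityʳ _)))
                    (pair-flag x u (*-cancelʳ-< 2 (j / 2) (length x) (≤-trans (s≤s (≤-reflexive (sym (trans d (+-identityʳ _))))) j<)))))
...   | inj₂ e = trans (le-false (s≤s (≤-reflexive (sym e)))) (sym (trans (cong (bitAt ⟨ x , u ⟩) e) (pair-end x u)))

input-right : ∀ {g} y k → cellAt rgt (inputTape {g} y) k ≡ at (List.map bit y) k
input-right []      zero    = refl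
input-right []      (suc k) = refl
input-right (b ∷ y) zero    = refl
input-right (b ∷ y) (suc k) = refl

input-left : ∀ {g} y k → cellAt lft (inputTape {g} y) k ≡ blank
input-left []      k = refl
input-left (b ∷ y) k = refl

blank-cell : ∀ {g} s k → cellAt {g} s blankTape k ≡ blank
blank-cell lft k       = refl
blank-cell rgt zero    = refl
blank-cell rgt (suc k) = refl

readOutput-head : ∀ {g} (t : Tape g) b → readOutput t ≡ b ∷ [] → Tape.head t ≡ bit b
readOutput-head (tape _ (bit _) _) b e = cong bit (Listₚ.∷-injectiveˡ e)
readOutput-head (tape _ blank _) b ()
readOutput-head (tape _ (extra _) _) b ()

module Soundness (M : TM) (p q : Poly) (x : List Bool) where

  open TM M using (workTapes; extraSymbols; states; start; tapes; Γ; δ; Config; initial; output; _⇓[_]_)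
  open Tableau M p q

  private
    n W P : ℕ
    n = length x
    W = suc (W₁ n)
    P = ⟦ q ⟧ n

  module _ {α : ℕ → ℕ} (m : Model x α) where

    open Model m

    True : ℕ → ℕ → Atom → Set
    True t k a = α (suc (variableIndex n t k a) * 2) ≡ 1

    α₁ : α 1 ≡ 1
    α₁ = trans (cong (_+ α 1) (sym false₀)) (opposite 0 (s≤s z≤n))

    granted : ∀ γ {t j} → GuardHolds γ x n t j → Holds x α t j (given γ)
    granted γ h = trans (cong α (guard-true γ h)) α₁

    true-or-not : ∀ τ o a {t j} → t < W → j < W → True (delay τ t) (offset o j) a ⊎ Holds x α t j (is-not τ o a)
    true-or-not τ o a {t} {j} t< j< with α (suc (variableIndex n (delay τ t) (offset o j) a) * 2) in eq
                                       | opposite (suc (variableIndex n (delay τ t) (offset o j) a)) (s≤s (lit-variable n τ o a t< j<))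
    ... | zero     | e = inj₂ e
    ... | suc zero | e = inj₁ refl
    ... | suc (suc _) | ()

    conclude : ∀ τ o a {t j} → t < W → j < W → ¬ Holds x α t j (is-not τ o a) → True (delay τ t) (offset o j) a
    conclude τ o a t< j< h with true-or-not τ o a t< j<
    ... | inj₁ y = y
    ... | inj₂ y = contradiction y h

    0<W : 0 < W
    0<W = s≤s z≤n

    first : ℕ → Γ → Set
    first k z = True 0 k (inCell rgt zero z)

    bitAt₀ : ℕ → Bool
    bitAt₀ k = positive (α (suc (variableIndex n 0 k (inCell rgt zero (bit true))) * 2))

    isBlank : ∀ k → Dec (first k blank)
    isBlank k = α (suc (variableIndex n 0 k (inCell rgt zero blank)) * 2) ≟ 1

    -- A model may make several symbols true in one cell. The certificate therefore stops at the
    -- first cell where blank is true, and before that prefers true to false.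
    extract : ℕ → ℕ → List Bool
    extract zero    k = []
    extract (suc f) k with isBlank k
    ... | yes _ = []
    ... | no _  = bitAt₀ k ∷ extract f (suc k)

    length-extract : ∀ f k → length (extract f k) ≤ f
    length-extract zero    k = z≤n
    length-extract (suc f) k with isBlank k
    ... | yes _ = z≤n
    ... | no _  = s≤s (length-extract f (suc k))

    blank-tail : ∀ k j → n * 2 < k → first k blank → k + j < W → first (k + j) blank
    blank-tail k zero    k> h _   rewrite +-identityʳ k = h
    blank-tail k (suc j) k> h k+j< rewrite +-suc k j =
      conclude now (shifted (suc zero)) _ 0<W k+j<′ λ v →
        obeys blankTail 0 (k + j) 0<W k+j<′ (granted inCertificate (refl , ≤-trans k> (m≤m+n k j)) ∷ blank-tail k j k> h k+j<′ ∷ v ∷ [])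
      where k+j<′ = <-trans (n<1+n (k + j)) k+j<

    first-bit : ∀ k → n * 2 < k → k < W → ¬ first k blank → first k (bit (bitAt₀ k))
    first-bit k k> k< b with true-or-not now this (inCell rgt zero (bit true)) {0} {k} 0<W k<
    ... | inj₁ y = subst (λ c → first k (bit c)) (sym (cong positive y)) y
    ... | inj₂ t = subst (λ c → first k (bit c)) (sym (cong positive α≡0)) (conclude now this _ 0<W k< λ v →
          obeys someSymbol 0 k 0<W k< (granted inCertificate (refl , k>) ∷ t ∷ v ∷ not-blank ∷ []))
      where
      i : ℕ
      i = variableIndex n 0 k (inCell rgt zero (bit true))
      α≡0 : α (suc i * 2) ≡ 0
      α≡0 = +-cancelʳ-≡ 1 _ 0 (trans (cong (α (suc i * 2) +_) (sym t))
              (opposite (suc i) (s≤s (lit-variable n {0} {k} now this (inCell rgt zero (bit true)) 0<W k<))))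
      not-blank : Holds x α 0 k (is-not now this (inCell rgt zero blank))
      not-blank with true-or-not now this (inCell rgt zero blank) {0} {k} 0<W k<
      ... | inj₁ y = contradiction y b
      ... | inj₂ y = y

    extract-true : ∀ f k j → n * 2 < k → f + k ≡ suc (n * 2 + P) → k + j < W → first (k + j) (at (List.map bit (extract f k)) j)
    -- The fuel starts at the length bound for certificates, so it runs out exactly where `pastEnd`
    -- begins to apply.
    extract-true zero k j k> e k+j< = conclude now this _ 0<W k+j< λ v →
      obeys pastEnd 0 (k + j) 0<W k+j< (granted pastCertificate (refl , ≤-trans (≤-reflexive (sym e)) (m≤m+n k j)) ∷ v ∷ [])
    extract-true (suc f) k j k> e k+j< with isBlank k
    ... | yes b = blank-tail k j k> b k+j<
    extract-true (suc f) k (suc j) k> e k+j< | no _ =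
      subst (λ i → first i (at (List.map bit (extract f (suc k))) j)) (sym (+-suc k j))
        (extract-true f (suc k) j (m≤n⇒m≤1+n k>) (trans (+-suc f k) e) (subst (_< W) (+-suc k j) k+j<))
    extract-true (suc f) k zero k> e k+j< | no b rewrite +-identityʳ k = first-bit k k> k+j< b

    certificate : List Bool
    certificate = extract P (suc (n * 2))

    y : List Bool
    y = ⟨ x , certificate ⟩

    input-true : ∀ k → k < W → first k (at (List.map bit y) k)
    input-true k k< with k ≤? n * 2
    ... | yes k≤ = subst (first k) (sym (at-map-bit y k k<|y|)) (conclude now this _ 0<W k< λ v →
                     obeys (prefix (positive (bitAt y k))) 0 k 0<W k<
                       (granted (inPrefix (positive (bitAt y k))) (refl , k≤ , trans (prefixBit-pair x certificate k k≤) (sym (b2n-positive (bitAt≤1 y k)))) ∷ v ∷ []))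
      where
      k<|y| : k < length y
      k<|y| = subst (k <_) (sym (length-pair x certificate)) (s≤s (≤-trans k≤ (m≤m+n (n * 2) (length certificate))))
    ... | no k≰ = subst (λ i → first i (at (List.map bit y) i)) k≡
                    (subst (first (suc (n * 2) + j)) (sym (at-map-pair x certificate j))
                      (extract-true P (suc (n * 2)) j ≤-refl (trans (+-suc P (n * 2)) (cong suc (+-comm P (n * 2)))) (subst (_< W) (sym k≡) k<)))
      where
      j = k ∸ suc (n * 2)
      k≡ : suc (n * 2) + j ≡ k
      k≡ = m+[n∸m]≡n (≰⇒> k≰)

    -- Only truths are tracked: the description of the actual configuration holds in the model,
    -- whatever else does. The window of known cells loses one cell per step, in accordance with
    -- `Origin`.
    record Inv (t : ℕ) (c : Config) : Set where
      field
        in-state : True t 0 (inState (proj₁ c))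
        in-cell  : ∀ s i k → k + t < W → True t k (inCell s i (cellAt s (lookup (proj₂ c) i) k))

    initial-inv : Inv 0 (initial y)
    initial-inv = record
      { in-state = conclude now here₀ (inState start) {0} {0} 0<W 0<W λ v → obeys startState 0 0 0<W 0<W (granted atStart refl ∷ v ∷ [])
      ; in-cell  = λ s i k k< → cell s i k (subst (_< W) (+-identityʳ k) k<)
      }
      where
      cell : ∀ s i k → k < W → True 0 k (inCell s i (cellAt s (lookup (proj₂ (initial y)) i) k))
      cell rgt zero k k< = subst (first k) (sym (input-right y k)) (input-true k k<)
      cell rgt (suc i) k k< rewrite Vecₚ.lookup-replicate i (blankTape {extraSymbols}) =
        subst (λ z → True 0 k (inCell rgt (suc i) z)) (sym (blank-cell rgt k))
          (conclude now this _ 0<W k< λ v → obeys (rightBlank i) 0 k 0<W k< (granted atStart refl ∷ v ∷ []))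
      cell lft i k k< = subst (λ z → True 0 k (inCell lft i z)) (sym (left-blank i))
          (conclude now this _ 0<W k< λ v → obeys (leftBlank i) 0 k 0<W k< (granted atStart refl ∷ v ∷ []))
        where
        left-blank : ∀ i → cellAt lft (lookup (proj₂ (initial y)) i) k ≡ blank
        left-blank zero    = input-left y k
        left-blank (suc i) rewrite Vecₚ.lookup-replicate i (blankTape {extraSymbols}) = refl

    premises-hold : ∀ {t j s ts} → t < W → Inv t (s , ts) → All (Holds x α t j) (premises s (Vec.map Tape.head ts))
    premises-hold {t} {j} {s} {ts} t< inv = Inv.in-state inv ∷ tabulate⁺ {f = λ i → is now here₀ (inCell rgt i (lookup (Vec.map Tape.head ts) i))} λ i →
      subst (λ z → True t 0 (inCell rgt i z)) (sym (Vecₚ.lookup-map i Tape.head ts)) (Inv.in-cell inv rgt i 0 t<)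

    step-inv : ∀ {t s ts s′ as} → t < W → δ s (Vec.map Tape.head ts) ≡ just (s′ , as) →
               Inv t (s , ts) → Inv (suc t) (s′ , Vec.zipWith act as ts)
    step-inv {t} {s} {ts} {s′} {as} t< eq inv = record { in-state = in-state′ ; in-cell = in-cell′ }
      where
      h = Vec.map Tape.head ts
      prem : ∀ {j} → All (Holds x α t j) (premises s h)
      prem {j} = premises-hold {t} {j} {s} {ts} t< inv
      in-state′ : True (suc t) 0 (inState s′)
      in-state′ = conclude later here₀ (inState s′) {t} {0} t< 0<W λ v →
        obeys (moveState s h) t 0 t< 0<W (subst (λ r → All (Holds x α t 0) (newState (Vec.head h) r ++ premises s h)) (sym eq) (v ∷ prem))
      in-cell′ : ∀ side i k → k + suc t < W → True (suc t) k (inCell side i (cellAt side (lookup (Vec.zipWith act as ts) i) k))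
      in-cell′ side i k k< rewrite Vecₚ.lookup-zipWith act i as ts = from-origin (origin (proj₂ (lookup as i)) side k)  k<
        where
        z = proj₁ (lookup as i)
        mv = proj₂ (lookup as i)
        ti = lookup ts i
        from-origin : ∀ {side k} → Origin mv side k → k + suc t < W → True (suc t) k (inCell side i (cellAt side (act (lookup as i) ti) k))
        from-origin was-written k< = subst (λ z → True (suc t) _ (inCell _ i z)) (sym (written-cell z mv ti))
          (conclude later (fixed (proj₂ (writtenPlace mv))) _ {t} {0} t< 0<W λ v →
            obeys (written s h i) t 0 t< 0<W (subst (λ r → All (Holds x α t 0) (newCell i r ++ premises s h)) (sym eq) (v ∷ prem)))
        from-origin (was-copied r j src≤ j≤) k< = subst (λ z → True (suc t) _ (inCell _ i z)) (sym (copied-cell z mv r j ti))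
          (conclude later (proj₂ (proj₂ places)) _ {t} {j} t< j<W λ v →
            obeys (copied s h i r (at-place (proj₁ places) j ti)) t j t< j<W
              (subst (λ a → All (Holds x α t j) (oldCell i r (at-place (proj₁ places) j ti) a ++ premises s h)) (sym eq)
                (Inv.in-cell inv _ i _ (≤-<-trans (≤-trans (+-monoˡ-≤ t src≤) (≤-reflexive (sym (+-suc _ t)))) k<) ∷ v ∷ prem)))
          where
          places = copiedPlaces mv r
          j<W : j < W
          j<W = ≤-<-trans (≤-trans j≤ (m≤m+n _ (suc t))) k<

    -- The invariant is carried along the run. At a halt with output false it makes all premises of
    -- a `moveState` clause true, and that clause has no other literal.
    no-rejection : ∀ {t s c d} → t + s < W → Inv t c → c ⇓[ s ] d → output d ≢ false ∷ []
    no-rejection {t} {c = σ , ts@(t₀ ∷ _)} t< inv (TM.halt eq) out with δ σ (Vec.map Tape.head ts) in δ≡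
    ... | nothing = obeys (moveState σ (Vec.map Tape.head ts)) t 0 t<W 0<W
                      (subst (λ r → All (Holds x α t 0) (newState (Tape.head t₀) r ++ premises σ (Vec.map Tape.head ts))) (sym δ≡)
                        (subst (λ z → All (Holds x α t 0) (rejecting z ++ premises σ (Vec.map Tape.head ts)))
                               (sym (readOutput-head t₀ false out)) (premises-hold {t} {0} {σ} {ts} t<W inv)))
      where t<W = subst (_< W) (+-identityʳ t) t<
    no-rejection {t} {suc s} {c = σ , ts} t< inv (TM.next eq r) out with δ σ (Vec.map Tape.head ts) in δ≡
    no-rejection {t} {suc s} {c = σ , ts} t< inv (TM.next refl r) out | just (σ′ , as) =
      no-rejection (subst (_< W) (+-suc t s) t<) (step-inv (≤-<-trans (m≤m+n t (suc s)) t<) δ≡ inv) r out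

    length-certificate : length certificate ≤ P
    length-certificate = length-extract P (suc (n * 2))

  model-sound : ∀ (V : List Bool → Bool) →
                (∀ w → ∃[ t ] ∃[ d ] (initial w ⇓[ t ] d × t ≤ ⟦ p ⟧ (length w) × output d ≡ V w ∷ [])) →
                ∃ (Model x) → ∃[ u ] (length u ≤ P × V ⟨ x , u ⟩ ≡ true)
  model-sound V run (α , m) = certificate m , length-certificate m , accepted-by _ refl
    where
    accepted-by : ∀ b → V (y m) ≡ b → b ≡ true
    accepted-by true  _ = refl
    accepted-by false e with run (y m)
    ... | t , d , r , t≤ , out = contradiction (trans out (cong (_∷ []) e))
      -- `W₁` was defined from the longest pair that can arise, and polynomials are monotone, so the
      -- whole run fits into the tableau.
      (no-rejection m {0} (s≤s (≤-trans t≤ (⟦⟧-mono p (≤-trans (≤-reflexive (length-pair x (certificate m)))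
                                                           (s≤s (+-monoʳ-≤ (n * 2) (length-certificate m))))))) (initial-inv m) r)

-- From an accepting run to a model

bit-or-blank : ∀ {g} w i → let c = at {g} (List.map bit w) i in c ≡ bit true ⊎ c ≡ bit false ⊎ c ≡ blank
bit-or-blank []          i       = inj₂ (inj₂ refl)
bit-or-blank (true ∷ w)  zero    = inj₁ refl
bit-or-blank (false ∷ w) zero    = inj₂ (inj₁ refl)
bit-or-blank (b ∷ w)     (suc i) = bit-or-blank w i

blank-beyond : ∀ {g} w i → length w ≤ i → at {g} (List.map bit w) i ≡ blank
blank-beyond []      i       _       = refl
blank-beyond (b ∷ w) (suc i) (s≤s h) = blank-beyond w i h

blank-next : ∀ {g} w i → at {g} (List.map bit w) i ≡ blank → at {g} (List.map bit w) (suc i) ≡ blank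
blank-next []      i       _ = refl
blank-next (b ∷ w) (suc i) h = blank-next w i h

lookup-ext : ∀ {A : Set} {m} (xs ys : Vec A m) → (∀ i → lookup xs i ≡ lookup ys i) → xs ≡ ys
lookup-ext xs ys h = trans (sym (Vecₚ.tabulate∘lookup xs)) (trans (Vecₚ.tabulate-cong h) (Vecₚ.tabulate∘lookup ys))

module Computation (M : TM) where

  open TM M using (Config; _⇓[_]_) renaming (step to stepᴹ)

  -- A halted configuration is repeated, so that the tableau is defined at all times.
  advance : Config → Config
  advance c = maybe id c (stepᴹ c)

  after : ℕ → Config → Config
  after zero    c = c
  after (suc t) c = advance (after t c)

  after-advance : ∀ t c → after (suc t) c ≡ after t (advance c)
  after-advance zero    c = refl
  after-advance (suc t) c = cong advance (after-advance t c)

  after-halted : ∀ t {c} → stepᴹ c ≡ nothing → after t c ≡ c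
  after-halted zero    h = refl
  after-halted (suc t) {c} h = trans (cong advance (after-halted t h)) (cong (maybe id c) h)

  -- By determinism, and because `after` stays put after halting, a halt seen at any time of the
  -- tableau is the halt of the given run and has its output.
  halting-unique : ∀ {c s d} → c ⇓[ s ] d → ∀ t → stepᴹ (after t c) ≡ nothing → after t c ≡ d
  halting-unique (TM.halt h)   t       _  = after-halted t h
  halting-unique (TM.next h r) zero    h′ = contradiction (trans (sym h) h′) λ ()
  halting-unique {c} (TM.next {c′ = c′} h r) (suc t) h′ = trans shift (halting-unique r t (trans (cong stepᴹ (sym shift)) h′))
    where
    shift : after (suc t) c ≡ after t c′
    shift = trans (after-advance t c) (cong (after t ∘ maybe id c) h)

module Completeness (M : TM) (p q : Poly) (x u : List Bool) (|u|≤ : length u ≤ ⟦ q ⟧ (length x)) where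

  open TM M using (workTapes; extraSymbols; states; start; tapes; Γ; δ; Config; initial; output; _⇓[_]_) renaming (step to stepᴹ)
  open Tableau M p q
  open Computation M

  private
    n W : ℕ
    n = length x
    W = suc (W₁ n)

    y : List Bool
    y = ⟨ x , u ⟩

  config : ℕ → Config
  config t = after t (initial y)

  cellOf : ℕ → Side → Fin tapes → ℕ → Γ
  cellOf t s i k = cellAt s (lookup (proj₂ (config t)) i) k

  True : ℕ → ℕ → Atom → Set
  True t k (inState s)    = proj₁ (config t) ≡ s
  True t k (inCell s i z) = cellOf t s i k ≡ z

  true? : ∀ t k a → Dec (True t k a)
  true? t k (inState s)    = proj₁ (config t) Fin.≟ s
  true? t k (inCell s i z) = cellOf t s i k ≟ˢ z

  truth : ℕ → ℕ → Atom → Bool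
  truth t k a = does (true? t k a)

  decode : ℕ → Bool
  decode v = maybe (truth (v / suc A₁ / suc (S₁ n)) (v / suc A₁ % suc (S₁ n))) false (nth (elements finite-Atom) (v % suc A₁))

  decode-variable : ∀ t k a → k ≤ S₁ n → decode (variableIndex n t k a) ≡ truth t k a
  decode-variable t k a k≤ =
    trans (cong (λ i → maybe (truth (v / suc A₁ / suc (S₁ n)) (v / suc A₁ % suc (S₁ n))) false (nth (elements finite-Atom) i)) (remainder≡ r (atomIndex a) A₁ a<))
      (trans (cong (maybe (truth (v / suc A₁ / suc (S₁ n)) (v / suc A₁ % suc (S₁ n))) false) (nth-position (complete finite-Atom a)))
        (cong₂ (λ t k → truth t k a) (trans (cong (_/ suc (S₁ n)) r≡) (quotient≡ t k (S₁ n) (s≤s k≤)))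
                                     (trans (cong (_% suc (S₁ n)) r≡) (remainder≡ t k (S₁ n) (s≤s k≤)))))
    where
    r v : ℕ
    r = t * suc (S₁ n) + k
    v = variableIndex n t k a
    a< : atomIndex a < suc A₁
    a< = m≤n⇒m≤1+n (position<length (complete finite-Atom a))
    r≡ : v / suc A₁ ≡ r
    r≡ = quotient≡ r (atomIndex a) A₁ a<

  -- Index 0 is the constant false of the literal codes; the atoms are numbered from 1 on.
  base : ℕ → ℕ
  base zero    = 0
  base (suc v) = b2n (decode v)

  signed : ℕ → ℕ → ℕ
  signed zero    b = b
  signed (suc _) b = 1 ∸ b

  α : ℕ → ℕ
  α z = signed (z % 2) (base (z / 2))

  base≤1 : ∀ i → base i ≤ 1
  base≤1 zero    = z≤n
  base≤1 (suc v) = b2n≤1 (decode v)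

  signed≤1 : ∀ s {b} → b ≤ 1 → signed s b ≤ 1
  signed≤1 zero    h = h
  signed≤1 (suc _) {b} h = m∸n≤m 1 b

  α-even : ∀ i → α (i * 2) ≡ base i
  α-even i = cong₂ signed ([m+kn]%n≡m%n 0 i 2) (cong base (m*n/n≡m i 2))

  α-odd : ∀ i → α (suc (i * 2)) ≡ 1 ∸ base i
  α-odd i = cong₂ signed ([m+kn]%n≡m%n 1 i 2) (cong base (trans (cong (_/ 2) (+-comm 1 (i * 2))) (quotient≡ i 1 1 ≤-refl)))

  -- What a literal says about the actual run, so that clauses can be checked without reference to
  -- codes.
  Meaning : ℕ → ℕ → Lit → Set
  Meaning t j (given γ)      = GuardHolds γ x n t j
  Meaning t j (is τ o a)     = True (delay τ t) (offset o j) a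
  Meaning t j (is-not τ o a) = ¬ True (delay τ t) (offset o j) a

  α-variable : ∀ t k a → k ≤ S₁ n → base (suc (variableIndex n t k a)) ≡ b2n (truth t k a)
  α-variable t k a k≤ = cong b2n (decode-variable t k a k≤)

  offset-bound : ∀ o {j} → j < W → offset o j ≤ S₁ n
  offset-bound o {j} j< = ≤-trans (offset≤ o j) (s≤s (s≤s (≤-trans (s≤s⁻¹ j<) (n≤1+n (W₁ n)))))

  meaning : ∀ {t j} → j < W → ∀ {l} → Holds x α t j l → Meaning t j l
  meaning {t} {j} j< {given γ} h with guardValue γ x n t j in eq | guard≤1 γ x n t j
  ... | zero     | _ = contradiction h λ ()
  ... | suc zero | _ = guard-holds γ eq
  meaning {t} {j} j< {given γ} h | suc (suc _) | s≤s ()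
  meaning {t} {j} j< {is τ o a} h
    with true? (delay τ t) (offset o j) a
       | trans (sym (α-variable (delay τ t) (offset o j) a (offset-bound o j<))) (trans (sym (α-even (suc (variableIndex n (delay τ t) (offset o j) a)))) h)
  ... | yes y | _ = y
  meaning {t} {j} j< {is-not τ o a} h y =
    contradiction (trans (sym h) (trans (α-odd (suc (variableIndex n (delay τ t) (offset o j) a))) (cong (1 ∸_) (trans (α-variable (delay τ t) (offset o j) a (offset-bound o j<))
      (cong b2n (dec-true (true? (delay τ t) (offset o j) a) y)))))) λ ()

  Situated : ℕ → Fin states → Vec Γ tapes → Set
  Situated t s h = ∃[ ts ] (config t ≡ (s , ts) × Vec.map Tape.head ts ≡ h)

  situated : ∀ {t j s h} → All (Meaning t j) (premises s h) → Situated t s h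
  situated {t} {j} {s} {h} (in-state ∷ in-cells) =
    proj₂ (config t) , cong (_, proj₂ (config t)) in-state ,
    lookup-ext _ h λ i → trans (Vecₚ.lookup-map i Tape.head (proj₂ (config t)))
      (tabulate⁻ {f = λ i → is now here₀ (inCell rgt i (lookup h i))} in-cells i)

  stepped : ∀ {t s h s′ as} ((ts , _) : Situated t s h) → δ s h ≡ just (s′ , as) → config (suc t) ≡ (s′ , Vec.zipWith act as ts)
  stepped {t} {s} (ts , e , refl) eq = trans (cong advance e) (cong (maybe id (s , ts)) (cong (Maybe.map _) eq))

  halted : ∀ {t s h} → Situated t s h → δ s h ≡ nothing → stepᴹ (config t) ≡ nothing
  halted (ts , e , refl) eq = trans (cong stepᴹ e) (cong (Maybe.map _) eq)

  certificate-cell : ∀ {j} → n * 2 < j → cellOf 0 rgt zero j ≡ at (List.map bit u) (j ∸ suc (n * 2))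
  certificate-cell {j} h = trans (input-right y j) (trans (cong (at (List.map bit y)) (sym (m+[n∸m]≡n h))) (at-map-pair x u (j ∸ suc (n * 2))))

  module _ {s d} (run : initial y ⇓[ s ] d) (accepting : output d ≡ true ∷ []) where

    rejected : ∀ {t j} z → All (Meaning t j) (rejecting z) → z ≡ bit false
    rejected (bit false) _ = refl
    rejected (bit true)  (() ∷ _)
    rejected blank       (() ∷ _)
    rejected (extra _)   (() ∷ _)

    not-rejecting : ∀ {t j s h} → Situated t s h → δ s h ≡ nothing → ¬ All (Meaning t j) (rejecting (Vec.head h))
    not-rejecting {t} {j} {s} {h} sit@(ts@(t₀ ∷ _) , e , refl) eq hs =
      contradiction (trans (sym (readOutput-head t₀ true accepted-output)) (rejected {t} {j} (Tape.head t₀) hs)) λ ()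
      where
      accepted-output : readOutput t₀ ≡ true ∷ []
      accepted-output = trans (cong output (trans (sym e) (halting-unique run t (halted {t} {s} {h} sit eq)))) accepting

    -- The assignment describes an actual run, and each clause excludes something that no such run
    -- does. Acceptance enters only through `moveState` at a halt, and the length bound on the
    -- certificate only through `pastEnd`.
    consistent : ∀ κ {t j} → ¬ All (Meaning t j) (literals κ)
    consistent startState (refl ∷ absent ∷ []) = absent refl
    consistent (leftBlank zero) {j = j} (refl ∷ absent ∷ []) = absent (input-left y j)
    consistent (leftBlank (suc i)) {j = j} (refl ∷ absent ∷ []) =
      absent (trans (cong (λ t → cellAt lft t j) (Vecₚ.lookup-replicate i (blankTape {extraSymbols}))) refl)
    consistent (rightBlank i) {j = j} (refl ∷ absent ∷ []) =
      absent (trans (cong (λ t → cellAt rgt t j) (Vecₚ.lookup-replicate i (blankTape {extraSymbols}))) (blank-cell rgt j))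
    consistent (prefix b) {j = j} ((refl , j≤ , e) ∷ absent ∷ []) =
      absent (trans (input-right y j) (trans (at-map-bit y j j<|y|) (cong bit (trans (cong positive (trans (sym (prefixBit-pair x u j j≤)) e)) (positive-b2n b)))))
      where
      j<|y| : j < length y
      j<|y| = subst (j <_) (sym (length-pair x u)) (s≤s (≤-trans j≤ (m≤m+n (n * 2) (length u))))
      positive-b2n : ∀ b → positive (b2n b) ≡ b
      positive-b2n true  = refl
      positive-b2n false = refl
    consistent someSymbol {j = j} ((refl , h) ∷ no-true ∷ no-false ∷ no-blank ∷ []) with bit-or-blank {extraSymbols} u (j ∸ suc (n * 2))
    ... | inj₁ e        = no-true (trans (certificate-cell h) e)
    ... | inj₂ (inj₁ e) = no-false (trans (certificate-cell h) e)
    ... | inj₂ (inj₂ e) = no-blank (trans (certificate-cell h) e)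
    consistent blankTail {j = j} ((refl , h) ∷ b ∷ absent ∷ []) =
      absent (trans (certificate-cell (m≤n⇒m≤1+n h)) (trans (cong (at (List.map bit u)) (+-∸-assoc 1 h))
        (blank-next u (j ∸ suc (n * 2)) (trans (sym (certificate-cell h)) b))))
    consistent pastEnd {j = j} ((refl , h) ∷ absent ∷ []) =
      absent (trans (certificate-cell (≤-trans (s≤s (m≤m+n (n * 2) _)) h)) (blank-beyond u (j ∸ suc (n * 2))
        (≤-trans |u|≤ (≤-trans (≤-reflexive (sym (m+n∸m≡n (suc (n * 2)) (⟦ q ⟧ n)))) (∸-monoˡ-≤ (suc (n * 2)) h)))))
    consistent (moveState s h) {t} {j} hs with ++⁻ (newState (Vec.head h) (δ s h)) hs
    ... | hs₁ , hs₂ = go (δ s h) refl hs₁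
      where
      sit : Situated t s h
      sit = situated {t} {j} hs₂
      go : ∀ r → δ s h ≡ r → ¬ All (Meaning t j) (newState (Vec.head h) r)
      go nothing         eq hs            = not-rejecting {t} {j} sit eq hs
      go (just (s′ , _)) eq (absent ∷ []) = absent (cong proj₁ (stepped {t} sit eq))
    consistent (written s h i) {t} {j} hs with ++⁻ (newCell i (δ s h)) hs
    ... | hs₁ , hs₂ = go (δ s h) refl hs₁
      where
      sit : Situated t s h
      sit = situated {t} {j} hs₂
      go : ∀ r → δ s h ≡ r → ¬ All (Meaning t j) (newCell i r)
      go nothing          eq (() ∷ _)
      go (just (s′ , as)) eq (absent ∷ []) =
        absent (trans (cong (λ c → cellAt (proj₁ pl) (lookup (proj₂ c) i) (toℕ (proj₂ pl))) (stepped {t} sit eq))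
               (trans (cong (λ tp → cellAt (proj₁ pl) tp (toℕ (proj₂ pl))) (Vecₚ.lookup-zipWith act i as (proj₁ sit)))
                      (written-cell (proj₁ (lookup as i)) (proj₂ (lookup as i)) (lookup (proj₁ sit) i))))
        where pl = writtenPlace (proj₂ (lookup as i))
    consistent (copied s h i r z) {t} {j} hs with ++⁻ (oldCell i r z (δ s h)) hs
    ... | hs₁ , hs₂ = go (δ s h) refl hs₁
      where
      sit : Situated t s h
      sit = situated {t} {j} hs₂
      go : ∀ a → δ s h ≡ a → ¬ All (Meaning t j) (oldCell i r z a)
      go nothing          eq (() ∷ _)
      go (just (s′ , as)) eq (old ∷ absent ∷ []) =
        absent (trans (cong (λ c → at-place dst j (lookup (proj₂ c) i)) (stepped {t} sit eq))
               (trans (cong (at-place dst j) (Vecₚ.lookup-zipWith act i as (proj₁ sit)))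
               (trans (copied-cell (proj₁ (lookup as i)) (proj₂ (lookup as i)) r j (lookup (proj₁ sit) i))
               (trans (cong (λ c → at-place src j (lookup (proj₂ c) i)) (sym (proj₁ (proj₂ sit)))) old))))
        where
        src = proj₁ (copiedPlaces (proj₂ (lookup as i)) r)
        dst = proj₂ (copiedPlaces (proj₂ (lookup as i)) r)

    model : Model x α
    model = record
      { binary   = λ v _ → signed≤1 (v % 2) (base≤1 (v / 2))
      ; false₀   = refl
      ; opposite = λ i _ → trans (cong₂ _+_ (α-even i) (α-odd i)) (m+[n∸m]≡n (base≤1 i))
      ; obeys    = λ κ t j _ j< hs → consistent κ {t} {j} (All.map (λ {l} → meaning {t} {j} j< {l}) hs)
      }

-- Hardness and completeness

coloring-hard : NPHard (EulerianStrongMajorityColoring 2)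
coloring-hard L (V , q , (M , p , run) , L⇔) = Reduction.reduction (Tableau.family M p q) λ x → mk⇔
  (λ l → let u , u≤ , v = Equivalence.to (L⇔ x) l
             t , d , r , _ , o = run ⟨ x , u ⟩
         in Tableau.model⇒satisfiable M p q x
              (Completeness.model M p q x u u≤ r (trans o (cong (_∷ []) v))))
  (λ s → Equivalence.from (L⇔ x) (Soundness.model-sound M p q x V run (Tableau.satisfiable⇒model M p q x s)))

theorem12 : NPComplete (EulerianStrongMajorityColoring 2)
theorem12 = coloring-NP , coloring-hard
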